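{- Let $d\ge2$ and let $\Delta\subseteq\mathbb{Q}^d$ be a $d$-dimensional IP simplex of Gorenstein index $g$. Then $$\mathrm{Vol}(\Delta)\,\mathrm{Vol}(\Delta^*)\le \frac{t_{g,d+1}^2}{g^{d+2}}.$$ Equality holds if and only if there is $H\in\mathrm{GL}(d,\mathbb{Q})$ such that $\Delta\cong H\cdot\Delta(P)$, where $P$ is the $d\times(d+1)$ matrix whose first $d$ columns are the standard basis vectors $e_1,\dots,e_d$ and whose last column is $\big(-\tfrac{t_{g,d+1}}{s_{g,1}},\dots,-\tfrac{t_{g,d+1}}{s_{g,d}}\big)^T$.
   Context: An IP simplex is a full-dimensional simplex in $\mathbb{Q}^d$ with rational vertices containing the origin in its interior. Its dual is $\Delta^*=\{u\in\mathbb{Q}^d:\langle u,v\rangle\ge-1\ \forall v\in\Delta\}$. $g_{\mathbb{Q}}(\Delta)$ is the least positive integer $k$ with $k\Delta$ having vertices in $\mathbb{Z}^d$, and the Gorenstein index is $g(\Delta)=g_{\mathbb{Q}}(\Delta)g_{\mathbb{Q}}(\Delta^*)$. $\mathrm{Vol}$ is $d!$ times Euclidean volume. $\cong$ means equality up to $\mathrm{GL}(d,\mathbb{Z})$; $\Delta(P)$ is the convex hull of the columns of $P$. Sylvester sequences: $s_{g,1}=g+1$, $s_{g,k+1}=s_{g,k}(s_{g,k}-1)+1$, $t_{g,k}=s_{g,k}-1$. -}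

module Defs where

open import Algebra.Bundles using (CommutativeRing)
open import Data.Bool.Base using (if_then_else_)
open import Data.Fin.Base using (Fin; fromℕ; toℕ)
open import Data.Fin.Properties using () renaming (_≟_ to _≟ᶠ_)
open import Data.Integer.Base as ℤ using (ℤ; +_)
import Data.Integer.Properties as ℤ
open import Data.List.Base as List using (List)
open import Data.List.Relation.Unary.All using (All)
open import Data.List.Relation.Unary.AllPairs using (AllPairs)
open import Data.List.Relation.Unary.Any using (Any)
open import Data.Nat.Base as ℕ using (ℕ; zero; suc; NonZero; _!)
import Data.Nat.Properties as ℕ
open import Data.Product.Base using (∃₂; ∃-syntax; Σ-syntax; _×_)
open import Data.Rational.Base
  using (ℚ; 0ℚ; 1ℚ; _+_; _*_; _-_; -_; _/_; _≤_; _<_; ∣_∣)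
import Data.Rational.Properties as ℚ
open import Data.Vec.Functional using (Vector; foldr; insertAt; transpose)
open import Level using (0ℓ)
open import Relation.Binary.PropositionalEquality using (_≡_; _≗_)
open import Relation.Nullary.Decidable using (does)
open import Relation.Unary using (Pred; _∈_; _⊆_; _≐_; _⊥_)

------------------------------------------------------------------------
-- Matrices

Matrix : Set → ℕ → ℕ → Set
Matrix A m n = Vector (Vector A n) m

module LinearAlgebra (R : CommutativeRing 0ℓ 0ℓ) where
  open CommutativeRing R
    using (Carrier; _≈_; 0#; 1#; semiring) renaming (_*_ to _*ᴿ_)
  open import Algebra.Properties.Semiring.Sum semiring public using (sum)

  identity : ∀ {n} → Matrix Carrier n n
  identity i j = if does (i ≟ᶠ j) then 1# else 0#

  _⊗_ : ∀ {l m n} → Matrix Carrier l m → Matrix Carrier m n → Matrix Carrier l n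
  (A ⊗ B) i k = sum (λ j → A i j *ᴿ B j k)

  record GL (n : ℕ) : Set where
    field
      matrix   : Matrix Carrier n n
      inverse  : Matrix Carrier n n
      inverseˡ : ∀ i j → (inverse ⊗ matrix) i j ≈ identity i j
      inverseʳ : ∀ i j → (matrix ⊗ inverse) i j ≈ identity i j

open LinearAlgebra ℤ.+-*-commutativeRing public
  using () renaming (GL to GLℤ; module GL to GLℤ)
open LinearAlgebra ℚ.+-*-commutativeRing public
  using (sum; identity) renaming (GL to GLℚ; module GL to GLℚ)

fromℤ : ℤ → ℚ
fromℤ z = z / 1

fromNat : ℕ → ℚ
fromNat n = fromℤ (+ n)

------------------------------------------------------------------------
-- Points and subsets of ℚᵈ

-- Points are functions, compared pointwise (≗); every set constructed below
-- is closed under pointwise equality.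

Point : ℕ → Set
Point d = Vector ℚ d

Subset : ℕ → Set₁
Subset d = Pred (Point d) 0ℓ

⟨_,_⟩ : ∀ {d} → Point d → Point d → ℚ
⟨ u , v ⟩ = sum (λ i → u i * v i)

image : ∀ {d} → Matrix ℚ d d → Subset d → Subset d
image A S x = ∃[ y ] y ∈ S × x ≗ (λ i → ⟨ A i , y ⟩)

dilate : ∀ {d} → ℕ → Subset d → Subset d
dilate k S x = ∃[ y ] y ∈ S × x ≗ (λ i → fromNat k * y i)

conv : ∀ {d n} → Vector (Point d) n → Subset d
conv v x = ∃[ c ] (∀ i → 0ℚ ≤ c i) × sum c ≡ 1ℚ ×
                  x ≗ (λ k → sum (λ i → c i * v i k))

polar : ∀ {d} → Subset d → Subset d
polar S u = ∀ v → v ∈ S → - 1ℚ ≤ ⟨ u , v ⟩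

-- Interior with respect to the sup-norm, i.e. for the usual topology.
Interior : ∀ {d} → Subset d → Subset d
Interior S p = ∃[ ε ] 0ℚ < ε × (∀ x → (∀ k → ∣ x k - p k ∣ ≤ ε) → x ∈ S)

-- Equality up to GL(d,ℤ).
infix 4 _≅_
_≅_ : ∀ {d} → Subset d → Subset d → Set
_≅_ {d} S T =
  Σ[ U ∈ GLℤ d ] S ≐ image (λ i j → fromℤ (GLℤ.matrix U i j)) T

------------------------------------------------------------------------
-- IP simplices

AffinelyIndependent : ∀ {d n} → Vector (Point d) n → Set
AffinelyIndependent v =
  ∀ c → sum c ≡ 0ℚ → (∀ k → sum (λ i → c i * v i k) ≡ 0ℚ) → ∀ i → c i ≡ 0ℚ

record IPSimplex (d : ℕ) : Set where
  field
    vertex            : Vector (Point d) (suc d)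
    affineIndependent : AffinelyIndependent vertex
    originInterior    : (λ _ → 0ℚ) ∈ Interior (conv vertex)

  body : Subset d
  body = conv vertex

------------------------------------------------------------------------
-- Gorenstein index

-- The vertices of a polytope are its extreme points.
IsVertex : ∀ {d} → Subset d → Subset d
IsVertex S x = x ∈ S × (∀ y z t → y ∈ S → z ∈ S → 0ℚ < t → t < 1ℚ →
                        x ≗ (λ i → (1ℚ - t) * y i + t * z i) → y ≗ z)

HasIntegralVertices : ∀ {d} → Subset d → Set
HasIntegralVertices S = ∀ x → IsVertex S x → ∀ i → ∃[ z ] x i ≡ fromℤ z

IsRationalGorensteinIndex : ∀ {d} → Subset d → ℕ → Set
IsRationalGorensteinIndex S k =
  0 ℕ.< k × HasIntegralVertices (dilate k S) ×
  (∀ m → 0 ℕ.< m → HasIntegralVertices (dilate m S) → k ℕ.≤ m)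

IsGorensteinIndex : ∀ {d} → Subset d → ℕ → Set
IsGorensteinIndex S g =
  ∃₂ λ k l → IsRationalGorensteinIndex S k ×
             IsRationalGorensteinIndex (polar S) l × g ≡ k ℕ.* l

------------------------------------------------------------------------
-- Volume

-- The half-open box ∏ᵢ [lower i , upper i).
record Box (d : ℕ) : Set where
  field
    lower upper : Point d
    lower≤upper : ∀ i → lower i ≤ upper i

  points : Subset d
  points x = ∀ i → lower i ≤ x i × x i < upper i

  measure : ℚ
  measure = foldr _*_ 1ℚ (λ i → upper i - lower i)

totalMeasure : ∀ {d} → List (Box d) → ℚ
totalMeasure bs = List.foldr _+_ 0ℚ (List.map Box.measure bs)

Packing : ∀ {d} → Subset d → List (Box d) → Set
Packing S bs = All (λ b → Box.points b ⊆ S) bs ×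
               AllPairs (λ b c → Box.points b ⊥ Box.points c) bs

Covering : ∀ {d} → Subset d → List (Box d) → Set
Covering S bs = S ⊆ (λ x → Any (λ b → x ∈ Box.points b) bs)

-- Euclidean volume as Jordan content: inner and outer content both equal q.
-- A packing never has larger total measure than a covering, so q is unique.
-- Restricting to rational points is harmless for a polytope S with rational
-- vertices: they are dense in it, so its content is that of its real hull.
IsEuclideanVolume : ∀ {d} → Subset d → ℚ → Set
IsEuclideanVolume S q = ∀ ε → 0ℚ < ε →
  (∃[ bs ] Packing S bs × q - ε < totalMeasure bs) ×
  (∃[ bs ] Covering S bs × totalMeasure bs < q + ε)

IsVol : ∀ {d} → Subset d → ℚ → Set
IsVol {d} S a = ∃[ q ] IsEuclideanVolume S q × a ≡ fromNat (d !) * q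

------------------------------------------------------------------------
-- Sylvester sequences

-- Indices are shifted to start at 0: sylvester g k = s_{g,k+1} and
-- sylvesterPred g k = t_{g,k+1}.
sylvester : ℕ → ℕ → ℕ
sylvester g zero    = suc g
sylvester g (suc k) = suc (sylvester g k ℕ.* (sylvester g k ℕ.∸ 1))

sylvesterPred : ℕ → ℕ → ℕ
sylvesterPred g k = sylvester g k ℕ.∸ 1

instance
  sylvester-nonZero : ∀ {g k} → NonZero (sylvester g k)
  sylvester-nonZero {k = zero}  = _
  sylvester-nonZero {k = suc k} = _

-- t_{g,d+1}² / g^{d+2}
volumeBound : (g d : ℕ) .{{_ : NonZero g}} → ℚ
volumeBound g d = + (sylvesterPred g d ℕ.^ 2) / (g ℕ.^ (d ℕ.+ 2))
  where instance _ = ℕ.m^n≢0 g (d ℕ.+ 2)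

-- The d×(d+1) matrix with columns e₁, …, e_d, (-t_{g,d+1}/s_{g,i})ᵢ.
extremalMatrix : (g d : ℕ) → Matrix ℚ d (suc d)
extremalMatrix g d = transpose (insertAt identity (fromℕ d) lastColumn)
  where
  lastColumn : Point d
  lastColumn i = - (+ sylvesterPred g d / sylvester g (toℕ i))

-- Convex hull of the columns.
columnHull : ∀ {d n} → Matrix ℚ d n → Subset d
columnHull P = conv (transpose P)

-- Let β be the barycentric coordinates of the origin in Δ and uᵢ the dual vertices, so that
-- ⟨uᵢ, vⱼ⟩ = δᵢⱼ/βᵢ − 1.  Then Vol(Δ) Vol(Δ*) = ∏ 1/βᵢ: the content is computed from the standard
-- simplex by an elimination which transforms Δ and Δ* by contragredient maps, whose determinants
-- cancel.  Extreme points k vᵢ and l uᵢ are integral and g = k l, so aᵢ = g/βᵢ is a positive integer,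
-- and ∑ 1/aᵢ = 1/g.  It remains to bound ∏ aᵢ by t²/g with t = t_{g,d+1}.  With a₁ ≤ a₂ ≤ … and
-- b = (s_{g,1}, …, s_{g,d}, t), the partial sums of 1/aᵢ never exceed those of 1/bᵢ, so summation by
-- parts gives ∑ aᵢ/bᵢ ≤ d + 1 and AM-GM gives ∏ aᵢ ≤ ∏ bᵢ = t²/g, with equality only for a = b.
-- The coordinates β determine Δ up to GL(d, ℚ).

{-# OPTIONS --safe #-}
module Submission where

open import Defs
open import Algebra.Bundles using (CommutativeRing)
open import Data.Fin.Base using (Fin; zero; suc; fromℕ; toℕ; opposite; punchIn; punchOut)
import Data.Fin.Permutation as Permutation
open import Data.Fin.Permutation using (Permutation; _⟨$⟩ʳ_; _⟨$⟩ˡ_)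
open import Data.Unit.Base using (⊤; tt)
open import Data.Fin.Properties using (all?; any?; ¬∀⟶∃¬; punchOut-injective; <⇒notInjective; opposite-involutive; opposite-suc; toℕ-fromℕ) renaming (_≟_ to _≟ᶠ_)
open import Data.Integer.Base as ℤ using (ℤ; -[1+_])
import Data.Integer.Properties as ℤ
open import Data.List.Base as List using (List; []; _∷_; _++_)
open import Data.List.Relation.Unary.All as All using (All; []; _∷_)
import Data.List.Relation.Unary.All.Properties as All
open import Data.List.Relation.Unary.AllPairs as AllPairs using (AllPairs; []; _∷_)
import Data.List.Relation.Unary.AllPairs.Properties as AllPairs
open import Data.List.Relation.Unary.Any as Any using (Any; here; there)
import Data.List.Relation.Unary.Any.Properties as Any
open import Data.Nat.Base as ℕ using (ℕ; zero; suc; NonZero; _!)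
import Data.Nat.Properties as ℕ
open import Data.Product.Base using (_,_; proj₁; proj₂; ∃₂; ∃-syntax; Σ-syntax; _×_)
open import Data.Rational.Base using (ℚ; 0ℚ; 1ℚ; _+_; _*_; _-_; -_; _/_; _≤_; _<_; ∣_∣; 1/_)
import Data.Rational.Base as ℚ
import Data.Rational.Properties as ℚ
import Data.Rational.Unnormalised.Base as ℚᵘ
import Data.Rational.Unnormalised.Properties as ℚᵘ
open import Data.Sum.Base using (inj₁; inj₂; [_,_])
import Data.Vec.Functional as V
open import Data.Vec.Functional using (Vector)
open import Data.Vec.Functional.Properties using (insertAt-lookup; insertAt-punchIn)
open import Function.Base using (_∘_; id; flip; case_of_)
open import Function.Bundles using (_⇔_; mk⇔)
open import Level using (0ℓ)
open import Relation.Binary.PropositionalEquality using (_≡_; _≢_; _≗_; refl; sym; trans; cong; cong₂; subst; subst₂; module ≡-Reasoning)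
open import Relation.Nullary using (¬_; Dec; yes; no)
open import Relation.Nullary.Negation using (contradiction)
open import Relation.Nullary.Decidable using (dec⇒maybe)
open import Relation.Unary using (_∈_; _⊆_; _≐_; _⊥_; _∪_)
open import Tactic.RingSolver using (solve-∀)
open import Tactic.RingSolver.Core.AlmostCommutativeRing using (AlmostCommutativeRing; fromCommutativeRing)
open import Algebra.Definitions.RawSemiring ℚ.+-*-rawSemiring using (_^_)
open import Algebra.Properties.Semiring.Sum (CommutativeRing.semiring ℚ.+-*-commutativeRing) using (sum-cong-≗; *-distribˡ-sum; *-distribʳ-sum; ∑-distrib-+; ∑-comm; sum-replicate-zero; sum-permute)
open import Algebra.Properties.CommutativeMonoid.Sum ℚ.*-1-commutativeMonoid using () renaming (sum to product; sum-cong-≗ to product-cong-≗; sum-permute to product-permute; ∑-distrib-+ to ∏-distrib-*)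

-- The comparison of partial sums is where integrality enters. A positive remainder `1/g − ∑ 1/aᵢ`
-- is a fraction with denominator `g ∏ aᵢ`, so a sum of `n` unit fractions closer to `1/g` than the
-- Sylvester sum would need `g ∏ aᵢ > t_{g,n+1}`; but summation by parts and AM-GM would then force
-- `g ∏ aᵢ ≤ t_{g,n+1}`. The same estimate thus drives the induction and gives the final bound. The
-- volumes are Jordan contents over ℚ, without integrals or determinants. A linear map is therefore
-- factored into elementary maps, whose effect on boxes is checked by hand, and the factor found in
-- this way depends a priori on the factorisation. For this reason an automorphism is carried
-- together with its transpose under one factorisation: both scale content by the same factor, which
-- cancels in the product of the two volumes without ever being evaluated. Vertices are extreme
-- points of the dilated bodies, so integrality of `k vᵢ` and `l uᵢ` is available only after these
-- points have been shown to be extreme.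

private
  variable
    d n : ℕ

ℚ-ring : AlmostCommutativeRing 0ℓ 0ℓ
ℚ-ring = fromCommutativeRing ℚ.+-*-commutativeRing (λ x → dec⇒maybe (0ℚ ℚ.≟ x))

-- Ordered field arithmetic

p≤q⇒0≤q-p : ∀ {p q} → p ≤ q → 0ℚ ≤ q - p
p≤q⇒0≤q-p {p} {q} p≤q = subst (_≤ q - p) (ℚ.+-inverseʳ p) (ℚ.+-monoˡ-≤ (- p) p≤q)

p<q⇒0<q-p : ∀ {p q} → p < q → 0ℚ < q - p
p<q⇒0<q-p {p} {q} p<q = subst (_< q - p) (ℚ.+-inverseʳ p) (ℚ.+-monoˡ-< (- p) p<q)

private
  difference+p : ∀ p q → (q - p) + p ≡ q
  difference+p = solve-∀ ℚ-ring

-- The working form of most inequalities below: a ring identity rewrites the difference of the two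
-- sides as an expression `r` whose sign is evident.
≤-from : ∀ {p q} r → q - p ≡ r → 0ℚ ≤ r → p ≤ q
≤-from {p} {q} _ refl 0≤ =
  subst₂ _≤_ (ℚ.+-identityˡ p) (difference+p p q) (ℚ.+-monoˡ-≤ p 0≤)

<-from : ∀ {p q} r → q - p ≡ r → 0ℚ < r → p < q
<-from {p} {q} _ refl 0< =
  subst₂ _<_ (ℚ.+-identityˡ p) (difference+p p q) (ℚ.+-monoˡ-< p 0<)

≤-resp : ∀ {p q p′ q′} → p ≤ q → q - p ≡ q′ - p′ → p′ ≤ q′
≤-resp p≤q eq = ≤-from _ (sym eq) (p≤q⇒0≤q-p p≤q)

<-resp : ∀ {p q p′ q′} → p < q → q - p ≡ q′ - p′ → p′ < q′
<-resp p<q eq = <-from _ (sym eq) (p<q⇒0<q-p p<q)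

+-nonNeg : ∀ {p q} → 0ℚ ≤ p → 0ℚ ≤ q → 0ℚ ≤ p + q
+-nonNeg = ℚ.+-mono-≤

+-pos-nonNeg : ∀ {p q} → 0ℚ < p → 0ℚ ≤ q → 0ℚ < p + q
+-pos-nonNeg = ℚ.+-mono-<-≤

*-nonNeg : ∀ {p q} → 0ℚ ≤ p → 0ℚ ≤ q → 0ℚ ≤ p * q
*-nonNeg {p} {q} 0≤p 0≤q =
  subst (_≤ p * q) (ℚ.*-zeroˡ q) (ℚ.*-monoʳ-≤-nonNeg q {{ℚ.nonNegative 0≤q}} 0≤p)

*-pos : ∀ {p q} → 0ℚ < p → 0ℚ < q → 0ℚ < p * q
*-pos {p} {q} 0<p 0<q =
  subst (_< p * q) (ℚ.*-zeroˡ q) (ℚ.*-monoˡ-<-pos q {{ℚ.positive 0<q}} 0<p)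

*-monoˡ-≤ : ∀ {p q} r → 0ℚ ≤ r → p ≤ q → r * p ≤ r * q
*-monoˡ-≤ r 0≤r = ℚ.*-monoˡ-≤-nonNeg r {{ℚ.nonNegative 0≤r}}

*-monoʳ-≤ : ∀ {p q} r → 0ℚ ≤ r → p ≤ q → p * r ≤ q * r
*-monoʳ-≤ r 0≤r = ℚ.*-monoʳ-≤-nonNeg r {{ℚ.nonNegative 0≤r}}

*-monoˡ-< : ∀ {p q} r → 0ℚ < r → p < q → r * p < r * q
*-monoˡ-< r 0<r = ℚ.*-monoʳ-<-pos r {{ℚ.positive 0<r}}

*-mono-≤ : ∀ {p q r s} → 0ℚ ≤ r → 0ℚ ≤ q → p ≤ q → r ≤ s → p * r ≤ q * s
*-mono-≤ 0≤r 0≤q p≤q r≤s =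
  ℚ.≤-trans (*-monoʳ-≤ _ 0≤r p≤q) (*-monoˡ-≤ _ 0≤q r≤s)

*-cancelˡ-≤ : ∀ {p q} r → 0ℚ < r → r * p ≤ r * q → p ≤ q
*-cancelˡ-≤ r 0<r = ℚ.*-cancelˡ-≤-pos r {{ℚ.positive 0<r}}

*-cancelˡ-< : ∀ {p q} r → 0ℚ < r → r * p < r * q → p < q
*-cancelˡ-< r 0<r = ℚ.*-cancelˡ-<-nonNeg r {{ℚ.nonNegative (ℚ.<⇒≤ 0<r)}}

0<1 : 0ℚ < 1ℚ
0<1 = ℚ.positive⁻¹ 1ℚ

0≤1 : 0ℚ ≤ 1ℚ
0≤1 = ℚ.<⇒≤ 0<1

0≤p*p : ∀ p → 0ℚ ≤ p * p
0≤p*p p with ℚ.≤-total 0ℚ p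
... | inj₁ 0≤p = *-nonNeg 0≤p 0≤p
... | inj₂ p≤0 = subst (0ℚ ≤_) (neg-square p) (*-nonNeg 0≤-p 0≤-p)
  where
  0≤-p = ℚ.neg-antimono-≤ p≤0
  neg-square : ∀ p → (- p) * (- p) ≡ p * p
  neg-square = solve-∀ ℚ-ring

-p≤∣p∣ : ∀ p → - p ≤ ∣ p ∣
-p≤∣p∣ p with ℚ.∣p∣≡p∨∣p∣≡-p p
... | inj₂ eq = ℚ.≤-reflexive (sym eq)
... | inj₁ eq = ℚ.≤-trans (ℚ.neg-antimono-≤ (ℚ.∣p∣≡p⇒0≤p eq)) (ℚ.0≤∣p∣ p)

p≤∣p∣ : ∀ p → p ≤ ∣ p ∣
p≤∣p∣ p = subst₂ _≤_ (neg-involutive p) (ℚ.∣-p∣≡∣p∣ p) (-p≤∣p∣ (- p))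
  where
  neg-involutive : ∀ p → - (- p) ≡ p
  neg-involutive = solve-∀ ℚ-ring

≤⇒≯ : ∀ {p q} → p ≤ q → ¬ q < p
≤⇒≯ p≤q q<p = ℚ.<-irrefl refl (ℚ.<-≤-trans q<p p≤q)

-- The junk value is recip 0ℚ = 0ℚ.
recip : ℚ → ℚ
recip p with p ℚ.≟ 0ℚ
... | yes _  = 0ℚ
... | no p≢0 = (1/ p) {{ℚ.≢-nonZero p≢0}}

*-recip : ∀ {p} → p ≢ 0ℚ → p * recip p ≡ 1ℚ
*-recip {p} p≢0 with p ℚ.≟ 0ℚ
... | yes p≡0 = contradiction p≡0 p≢0
... | no  p≢0 = ℚ.*-inverseʳ p {{ℚ.≢-nonZero p≢0}}

pos⇒≢0 : ∀ {p} → 0ℚ < p → p ≢ 0ℚ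
pos⇒≢0 0<p p≡0 = ℚ.<⇒≢ 0<p (sym p≡0)

*-recip-pos : ∀ {p} → 0ℚ < p → p * recip p ≡ 1ℚ
*-recip-pos = *-recip ∘ pos⇒≢0

recip-pos : ∀ {p} → 0ℚ < p → 0ℚ < recip p
recip-pos {p} 0<p = *-cancelˡ-< p 0<p
  (subst₂ _<_ (sym (ℚ.*-zeroʳ p)) (sym (*-recip-pos 0<p)) 0<1)

*-cancelˡ-≡ : ∀ {p q} r → r ≢ 0ℚ → r * p ≡ r * q → p ≡ q
*-cancelˡ-≡ {p} {q} r r≢0 eq = begin
  p  ≡⟨ sym (cancel p) ⟩
  recip r * (r * p)  ≡⟨ cong (recip r *_) eq ⟩
  recip r * (r * q)  ≡⟨ cancel q ⟩
  q  ∎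
  where
  open ≡-Reasoning
  assoc : ∀ a b c → a * (b * c) ≡ (b * a) * c
  assoc = solve-∀ ℚ-ring
  cancel : ∀ x → recip r * (r * x) ≡ x
  cancel x = trans (assoc (recip r) r x) (trans (cong (_* x) (*-recip r≢0)) (ℚ.*-identityˡ x))

recip-unique : ∀ {p q} → p * q ≡ 1ℚ → q ≡ recip p
recip-unique {p} {q} pq≡1 = *-cancelˡ-≡ p p≢0 (trans pq≡1 (sym (*-recip p≢0)))
  where
  p≢0 : p ≢ 0ℚ
  p≢0 refl = ℚ.1≢0 (trans (sym pq≡1) (ℚ.*-zeroˡ q))

-- Integers inside ℚ

toℚᵘ-fromℤ : ∀ z → ℚ.toℚᵘ (fromℤ z) ℚᵘ.≃ ℚᵘ.mkℚᵘ z 0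
toℚᵘ-fromℤ z = ℚ.toℚᵘ-fromℚᵘ (ℚᵘ.mkℚᵘ z 0)

fromℤ-homo-+ : ∀ y z → fromℤ (y ℤ.+ z) ≡ fromℤ y + fromℤ z
fromℤ-homo-+ y z = ℚ.toℚᵘ-injective (begin
  ℚ.toℚᵘ (fromℤ (y ℤ.+ z))  ≈⟨ toℚᵘ-fromℤ (y ℤ.+ z) ⟩
  ℚᵘ.mkℚᵘ (y ℤ.+ z) 0  ≈⟨ ℚᵘ.*≡* (cong (ℤ._* ℤ.+ 1) (cong₂ ℤ._+_ (sym (ℤ.*-identityʳ y)) (sym (ℤ.*-identityʳ z)))) ⟩
  ℚᵘ.mkℚᵘ y 0 ℚᵘ.+ ℚᵘ.mkℚᵘ z 0  ≈⟨ ℚᵘ.+-cong (toℚᵘ-fromℤ y) (toℚᵘ-fromℤ z) ⟨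
  ℚ.toℚᵘ (fromℤ y) ℚᵘ.+ ℚ.toℚᵘ (fromℤ z)  ≈⟨ ℚ.toℚᵘ-homo-+ (fromℤ y) (fromℤ z) ⟨
  ℚ.toℚᵘ (fromℤ y + fromℤ z)  ∎)
  where open ℚᵘ.≃-Reasoning

fromℤ-homo-* : ∀ y z → fromℤ (y ℤ.* z) ≡ fromℤ y * fromℤ z
fromℤ-homo-* y z = ℚ.toℚᵘ-injective (begin
  ℚ.toℚᵘ (fromℤ (y ℤ.* z))  ≈⟨ toℚᵘ-fromℤ (y ℤ.* z) ⟩
  ℚᵘ.mkℚᵘ y 0 ℚᵘ.* ℚᵘ.mkℚᵘ z 0  ≈⟨ ℚᵘ.*-cong (toℚᵘ-fromℤ y) (toℚᵘ-fromℤ z) ⟨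
  ℚ.toℚᵘ (fromℤ y) ℚᵘ.* ℚ.toℚᵘ (fromℤ z)  ≈⟨ ℚ.toℚᵘ-homo-* (fromℤ y) (fromℤ z) ⟨
  ℚ.toℚᵘ (fromℤ y * fromℤ z)  ∎)
  where open ℚᵘ.≃-Reasoning

fromℤ-mono-≤ : ∀ y z → y ℤ.≤ z → fromℤ y ≤ fromℤ z
fromℤ-mono-≤ y z y≤z = ℚ.toℚᵘ-cancel-≤
  (ℚᵘ.≤-respʳ-≃ (ℚᵘ.≃-sym (toℚᵘ-fromℤ z)) (ℚᵘ.≤-respˡ-≃ (ℚᵘ.≃-sym (toℚᵘ-fromℤ y))
    (ℚᵘ.*≤* (subst₂ ℤ._≤_ (sym (ℤ.*-identityʳ y)) (sym (ℤ.*-identityʳ z)) y≤z))))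

fromℤ-mono-< : ∀ y z → y ℤ.< z → fromℤ y < fromℤ z
fromℤ-mono-< y z y<z = ℚ.toℚᵘ-cancel-<
  (ℚᵘ.<-respʳ-≃ (ℚᵘ.≃-sym (toℚᵘ-fromℤ z)) (ℚᵘ.<-respˡ-≃ (ℚᵘ.≃-sym (toℚᵘ-fromℤ y))
    (ℚᵘ.*<* (subst₂ ℤ._<_ (sym (ℤ.*-identityʳ y)) (sym (ℤ.*-identityʳ z)) y<z))))

fromℤ-cancel-≤ : ∀ y z → fromℤ y ≤ fromℤ z → y ℤ.≤ z
fromℤ-cancel-≤ y z p with y ℤ.≤? z
... | yes y≤z = y≤z
... | no y≰z = contradiction (fromℤ-mono-< z y (ℤ.≰⇒> y≰z)) (≤⇒≯ p)

fromℤ-cancel-< : ∀ y z → fromℤ y < fromℤ z → y ℤ.< z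
fromℤ-cancel-< y z p with y ℤ.<? z
... | yes y<z = y<z
... | no y≮z = contradiction p (≤⇒≯ (fromℤ-mono-≤ z y (ℤ.≮⇒≥ y≮z)))

fromNat-homo-+ : ∀ m n → fromNat (m ℕ.+ n) ≡ fromNat m + fromNat n
fromNat-homo-+ m n = trans (cong fromℤ (ℤ.pos-+ m n)) (fromℤ-homo-+ (ℤ.+ m) (ℤ.+ n))

fromNat-suc : ∀ n → fromNat (suc n) ≡ 1ℚ + fromNat n
fromNat-suc = fromNat-homo-+ 1

fromNat-homo-* : ∀ m n → fromNat (m ℕ.* n) ≡ fromNat m * fromNat n
fromNat-homo-* m n = trans (cong fromℤ (ℤ.pos-* m n)) (fromℤ-homo-* (ℤ.+ m) (ℤ.+ n))

fromNat-homo-^ : ∀ m n → fromNat (m ℕ.^ n) ≡ fromNat m ^ n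
fromNat-homo-^ m zero    = refl
fromNat-homo-^ m (suc n) =
  trans (fromNat-homo-* m (m ℕ.^ n)) (cong (fromNat m *_) (fromNat-homo-^ m n))

fromNat-mono-≤ : ∀ m n → m ℕ.≤ n → fromNat m ≤ fromNat n
fromNat-mono-≤ m n m≤n = fromℤ-mono-≤ (ℤ.+ m) (ℤ.+ n) (ℤ.+≤+ m≤n)

fromNat-cancel-≤ : ∀ m n → fromNat m ≤ fromNat n → m ℕ.≤ n
fromNat-cancel-≤ m n p = ℤ.drop‿+≤+ (fromℤ-cancel-≤ (ℤ.+ m) (ℤ.+ n) p)

fromNat-cancel-< : ∀ m n → fromNat m < fromNat n → m ℕ.< n
fromNat-cancel-< m n p = ℤ.drop‿+<+ (fromℤ-cancel-< (ℤ.+ m) (ℤ.+ n) p)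

fromNat-injective : ∀ m n → fromNat m ≡ fromNat n → m ≡ n
fromNat-injective m n eq = ℕ.≤-antisym (fromNat-cancel-≤ m n (ℚ.≤-reflexive eq))
                                       (fromNat-cancel-≤ n m (ℚ.≤-reflexive (sym eq)))

fromNat-nonNeg : ∀ n → 0ℚ ≤ fromNat n
fromNat-nonNeg n = fromNat-mono-≤ 0 n ℕ.z≤n

fromNat-pos : ∀ n → 0 ℕ.< n → 0ℚ < fromNat n
fromNat-pos n 0<n = fromℤ-mono-< (ℤ.+ 0) (ℤ.+ n) (ℤ.+<+ 0<n)

pos-fromℤ⇒fromNat : ∀ z → 0ℚ < fromℤ z → ∃[ n ] 0 ℕ.< n × fromℤ z ≡ fromNat n
pos-fromℤ⇒fromNat (ℤ.+ n)    p = n , fromNat-cancel-< 0 n p , refl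
pos-fromℤ⇒fromNat -[1+ n ] p = contradiction (fromℤ-cancel-< (ℤ.+ 0) -[1+ n ] p) λ ()

/-*-cancel : ∀ z n .{{_ : NonZero n}} → (z / n) * fromNat n ≡ fromℤ z
/-*-cancel z n@(suc m) = ℚ.toℚᵘ-injective (begin
  ℚ.toℚᵘ ((z / n) * fromNat n)  ≈⟨ ℚ.toℚᵘ-homo-* (z / n) (fromNat n) ⟩
  ℚ.toℚᵘ (z / n) ℚᵘ.* ℚ.toℚᵘ (fromNat n)  ≈⟨ ℚᵘ.*-cong (ℚ.toℚᵘ-fromℚᵘ (ℚᵘ.mkℚᵘ z m)) (toℚᵘ-fromℤ (ℤ.+ n)) ⟩
  ℚᵘ.mkℚᵘ z m ℚᵘ.* ℚᵘ.mkℚᵘ (ℤ.+ n) 0  ≈⟨ ℚᵘ.*≡* (trans (ℤ.*-identityʳ (z ℤ.* ℤ.+ n)) (cong (λ k → z ℤ.* ℤ.+ k) (sym (ℕ.*-identityʳ n)))) ⟩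
  ℚᵘ.mkℚᵘ z 0  ≈⟨ toℚᵘ-fromℤ z ⟨
  ℚ.toℚᵘ (fromℤ z)  ∎)
  where open ℚᵘ.≃-Reasoning

-- A nonnegative fraction is at most its numerator, as its denominator is at least 1; a negative one
-- is at most 0.
archimedean : ∀ p → ∃[ n ] p ≤ fromNat n
archimedean p@(ℚ.mkℚ (ℤ.+ n) d _) = n , ℚ.toℚᵘ-cancel-≤
  (ℚᵘ.≤-respʳ-≃ (ℚᵘ.≃-sym (toℚᵘ-fromℤ (ℤ.+ n)))
    (ℚᵘ.*≤* (ℤ.*-monoˡ-≤-nonNeg (ℤ.+ n) {ℤ.+ 1} {ℤ.+ suc d} (ℤ.+≤+ (ℕ.s≤s ℕ.z≤n)))))
archimedean p@(ℚ.mkℚ -[1+ _ ] _ _) = 0 , ℚ.<⇒≤ (ℚ.negative⁻¹ p)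

-- Inner and outer content

-- Only says that the inner content is at least `q`, as `Outer` only says that the outer content is
-- at most `q`. The two halves of a volume are kept apart because inclusions of sets transport them
-- in opposite directions.
record Inner (S : Subset d) (q : ℚ) : Set where
  field packing : ∀ ε → 0ℚ < ε → ∃[ bs ] Packing S bs × q - ε < totalMeasure bs

record Outer (S : Subset d) (q : ℚ) : Set where
  field covering : ∀ ε → 0ℚ < ε → ∃[ bs ] Covering S bs × totalMeasure bs < q + ε

open Inner public
open Outer public

½ : ℚ
½ = ℤ.+ 1 / 2

half-pos : ∀ {ε} → 0ℚ < ε → 0ℚ < ½ * ε
half-pos = *-pos (ℚ.positive⁻¹ ½)

private
  packed-mono : ∀ {S T : Subset d} {bs} → S ⊆ T → All (λ b → Box.points b ⊆ S) bs → All (λ b → Box.points b ⊆ T) bs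
  packed-mono S⊆T []           = []
  packed-mono S⊆T (b⊆S ∷ bs⊆S) = (λ x∈b → S⊆T (b⊆S x∈b)) ∷ packed-mono S⊆T bs⊆S

  packed-⊥ : ∀ {S T : Subset d} {bs cs} → S ⊥ T → All (λ b → Box.points b ⊆ S) bs → All (λ c → Box.points c ⊆ T) cs →
             All (λ b → All (λ c → Box.points b ⊥ Box.points c) cs) bs
  packed-⊥ {S = S} {T = T} S⊥T []           cs⊆T = []
  packed-⊥ {S = S} {T = T} S⊥T (_∷_ {x = b} b⊆S bs⊆S) cs⊆T = row cs⊆T ∷ packed-⊥ S⊥T bs⊆S cs⊆T
    where
    row : ∀ {cs} → All (λ c → Box.points c ⊆ T) cs → All (λ c → Box.points b ⊥ Box.points c) cs
    row []           = []
    row (c⊆T ∷ cs⊆T) = (λ (x∈b , x∈c) → S⊥T (b⊆S x∈b , c⊆T x∈c)) ∷ row cs⊆T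

inner-mono : ∀ {S T : Subset d} {p q} → S ⊆ T → q ≤ p → Inner S p → Inner T q
packing (inner-mono S⊆T q≤p inner) ε 0<ε with bs , (bs⊆S , disjoint) , p-ε< ← packing inner ε 0<ε =
  bs , (packed-mono S⊆T bs⊆S , disjoint) , ℚ.≤-<-trans (ℚ.+-monoˡ-≤ (- ε) q≤p) p-ε<

outer-mono : ∀ {S T : Subset d} {p q} → S ⊆ T → p ≤ q → Outer T p → Outer S q
covering (outer-mono S⊆T p≤q outer) ε 0<ε with bs , T⊆bs , <p+ε ← covering outer ε 0<ε =
  bs , T⊆bs ∘ S⊆T , ℚ.<-≤-trans <p+ε (ℚ.+-monoˡ-≤ ε p≤q)

-- The step size min(1, ε/2(c+1)).
private
  smallStep : ∀ c ε → 0ℚ ≤ c → 0ℚ < ε → ∃[ η ] 0ℚ < η × η ≤ 1ℚ × c * η ≤ ½ * ε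
  smallStep c ε 0≤c 0<ε with ℚ.≤-total ((½ * ε) * recip (1ℚ + c)) 1ℚ
  ... | inj₁ η≤1 = _ , 0<η , η≤1 , cη≤
    where
    0<1+c = +-pos-nonNeg 0<1 0≤c
    0<η = *-pos (half-pos 0<ε) (recip-pos 0<1+c)
    identity₁ : ∀ h c r → h * ((1ℚ + c) * r) - c * (h * r) ≡ h * r
    identity₁ = solve-∀ ℚ-ring
    cη≤ : c * ((½ * ε) * recip (1ℚ + c)) ≤ ½ * ε
    cη≤ = subst (c * ((½ * ε) * recip (1ℚ + c)) ≤_)
      (trans (cong ((½ * ε) *_) (*-recip-pos 0<1+c)) (ℚ.*-identityʳ _))
      (≤-from _ (identity₁ (½ * ε) c (recip (1ℚ + c))) (ℚ.<⇒≤ 0<η))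
  ... | inj₂ 1≤η = 1ℚ , 0<1 , ℚ.≤-refl , c≤
    where
    0<1+c = +-pos-nonNeg 0<1 0≤c
    identity₂ : ∀ h c r → (1ℚ + c) * (h * r) - (1ℚ + c) * 1ℚ ≡ h * ((1ℚ + c) * r) - 1ℚ - c
    identity₂ = solve-∀ ℚ-ring
    identity₃ : ∀ h c → h * 1ℚ - 1ℚ - c + 1ℚ ≡ h - c * 1ℚ
    identity₃ = solve-∀ ℚ-ring
    h-1-c : 0ℚ ≤ (½ * ε) * 1ℚ - 1ℚ - c
    h-1-c = subst (λ z → 0ℚ ≤ (½ * ε) * z - 1ℚ - c) (*-recip-pos 0<1+c)
      (subst (0ℚ ≤_) (identity₂ (½ * ε) c (recip (1ℚ + c)))
        (p≤q⇒0≤q-p (*-monoˡ-≤ (1ℚ + c) (ℚ.<⇒≤ 0<1+c) 1≤η)))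
    c≤ : c * 1ℚ ≤ ½ * ε
    c≤ = ≤-from _ (sym (identity₃ (½ * ε) c)) (+-nonNeg h-1-c 0≤1)

-- Trades the ε of the definition for errors linear in a step size. Here and in `outer-limit` the
-- bound `η ≤ 1` lets `c` be fixed in advance; in `content-simplex` the outer error is controlled by
-- a simplex of size `r + 1`.
inner-limit : ∀ {S : Subset d} {q} c → 0ℚ ≤ c → (∀ η → 0ℚ < η → η ≤ 1ℚ → Inner S (q - c * η)) → Inner S q
packing (inner-limit {q = q} c 0≤c inner) ε 0<ε
  with η , 0<η , η≤1 , cη≤ ← smallStep c ε 0≤c 0<ε
  with bs , bs-packing , < ← packing (inner η 0<η η≤1) (½ * ε) (half-pos 0<ε) =
  bs , bs-packing , ℚ.≤-<-trans (≤-from _ (eq q (c * η) ε) (p≤q⇒0≤q-p cη≤)) <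
  where
  eq : ∀ q x ε → q - x - ½ * ε - (q - ε) ≡ ½ * ε - x
  eq = solve-∀ ℚ-ring

outer-limit : ∀ {S : Subset d} {q} c → 0ℚ ≤ c → (∀ η → 0ℚ < η → η ≤ 1ℚ → Outer S (q + c * η)) → Outer S q
covering (outer-limit {q = q} c 0≤c outer) ε 0<ε
  with η , 0<η , η≤1 , cη≤ ← smallStep c ε 0≤c 0<ε
  with bs , bs-covering , < ← covering (outer η 0<η η≤1) (½ * ε) (half-pos 0<ε) =
  bs , bs-covering , ℚ.<-≤-trans < (≤-from _ (eq q (c * η) ε) (p≤q⇒0≤q-p cη≤))
  where
  eq : ∀ q x ε → q + ε - (q + x + ½ * ε) ≡ ½ * ε - x
  eq = solve-∀ ℚ-ring

inner-nonPos : ∀ {S : Subset d} {q} → q ≤ 0ℚ → Inner S q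
packing (inner-nonPos {q = q} q≤0) ε 0<ε = [] , ([] , []) , ℚ.≤-<-trans (ℚ.+-monoˡ-≤ (- ε) q≤0)
  (subst (_< 0ℚ) (sym (ℚ.+-identityˡ (- ε))) (ℚ.neg-antimono-< 0<ε))

totalMeasure-++ : ∀ (bs cs : List (Box d)) →
                  totalMeasure (bs ++ cs) ≡ totalMeasure bs + totalMeasure cs
totalMeasure-++ []       cs = sym (ℚ.+-identityˡ _)
totalMeasure-++ (b ∷ bs) cs =
  trans (cong (Box.measure b +_) (totalMeasure-++ bs cs))
        (sym (ℚ.+-assoc (Box.measure b) (totalMeasure bs) (totalMeasure cs)))

inner-⊎ : ∀ {S T U : Subset d} {p q} → S ⊆ U → T ⊆ U → S ⊥ T → Inner S p → Inner T q → Inner U (p + q)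
packing (inner-⊎ {p = p} {q = q} S⊆U T⊆U S⊥T innerS innerT) ε 0<ε
  with bs , (bs⊆S , bs⊥) , <bs ← packing innerS (½ * ε) (half-pos 0<ε)
  with cs , (cs⊆T , cs⊥) , <cs ← packing innerT (½ * ε) (half-pos 0<ε) =
  bs ++ cs ,
  (All.++⁺ (packed-mono S⊆U bs⊆S) (packed-mono T⊆U cs⊆T) ,
   AllPairs.++⁺ bs⊥ cs⊥ (packed-⊥ S⊥T bs⊆S cs⊆T)) ,
  subst₂ _<_ (eq p q ε) (sym (totalMeasure-++ bs cs)) (ℚ.+-mono-< <bs <cs)
  where
  eq : ∀ p q ε → p - ½ * ε + (q - ½ * ε) ≡ p + q - ε
  eq = solve-∀ ℚ-ring

outer-∪ : ∀ {S T U : Subset d} {p q} → U ⊆ S ∪ T → Outer S p → Outer T q → Outer U (p + q)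
covering (outer-∪ {p = p} {q = q} U⊆ outerS outerT) ε 0<ε
  with bs , S⊆bs , bs< ← covering outerS (½ * ε) (half-pos 0<ε)
  with cs , T⊆cs , cs< ← covering outerT (½ * ε) (half-pos 0<ε) =
  bs ++ cs ,
  [ Any.++⁺ˡ ∘ S⊆bs , Any.++⁺ʳ bs ∘ T⊆cs ] ∘ U⊆ ,
  subst₂ _<_ (sym (totalMeasure-++ bs cs)) (eq p q ε) (ℚ.+-mono-< bs< cs<)
  where
  eq : ∀ p q ε → p + ½ * ε + (q + ½ * ε) ≡ p + q + ε
  eq = solve-∀ ℚ-ring

inner-box : ∀ (b : Box d) → Inner (Box.points b) (Box.measure b)
packing (inner-box b) ε 0<ε = (b ∷ []) , (id ∷ [] , [] ∷ []) ,
  <-from ε (eq (Box.measure b) ε) 0<ε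
  where
  eq : ∀ m ε → m + 0ℚ - (m - ε) ≡ ε
  eq = solve-∀ ℚ-ring

outer-box : ∀ (b : Box d) → Outer (Box.points b) (Box.measure b)
covering (outer-box b) ε 0<ε = (b ∷ []) , here , <-from ε (eq (Box.measure b) ε) 0<ε
  where
  eq : ∀ m ε → m + ε - (m + 0ℚ) ≡ ε
  eq = solve-∀ ℚ-ring

outer-∅ : ∀ {S : Subset d} → (∀ {x} → ¬ S x) → Outer S 0ℚ
covering (outer-∅ S-empty) ε 0<ε = [] , (λ x∈S → contradiction x∈S S-empty) ,
  subst (0ℚ <_) (sym (ℚ.+-identityˡ ε)) 0<ε

measure-nonNeg : ∀ (b : Box d) → 0ℚ ≤ Box.measure b
measure-nonNeg {d} b = go d (Box.lower b) (Box.upper b) (Box.lower≤upper b)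
  where
  go : ∀ d (l u : Point d) → (∀ i → l i ≤ u i) → 0ℚ ≤ V.foldr _*_ 1ℚ (λ i → u i - l i)
  go zero    l u l≤u = 0≤1
  go (suc d) l u l≤u =
    *-nonNeg (p≤q⇒0≤q-p (l≤u zero)) (go d (l ∘ suc) (u ∘ suc) (l≤u ∘ suc))

-- Products of an interval with a set

Slab : ℚ → ℚ → Subset d → Subset (suc d)
Slab l u T x = (l ≤ x zero × x zero < u) × T (x ∘ suc)

slabBox : ∀ {l u} → l ≤ u → Box d → Box (suc d)
slabBox {l = l} {u = u} l≤u b = record
  { lower       = l V.∷ Box.lower b
  ; upper       = u V.∷ Box.upper b
  ; lower≤upper = λ { zero → l≤u ; (suc i) → Box.lower≤upper b i }
  }

tailBox : Box (suc d) → Box d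
tailBox b = record
  { lower       = Box.lower b ∘ suc
  ; upper       = Box.upper b ∘ suc
  ; lower≤upper = Box.lower≤upper b ∘ suc
  }

slabBox-⊇ : ∀ {l u} (l≤u : l ≤ u) (b : Box d) → Slab l u (Box.points b) ⊆ Box.points (slabBox l≤u b)
slabBox-⊇ l≤u b (x₀∈ , x∈) zero    = x₀∈
slabBox-⊇ l≤u b (x₀∈ , x∈) (suc i) = x∈ i

totalMeasure-slabBox : ∀ {l u} (l≤u : l ≤ u) (bs : List (Box d)) →
  totalMeasure (List.map (slabBox l≤u) bs) ≡ (u - l) * totalMeasure bs
totalMeasure-slabBox {l = l} {u = u} l≤u []       = sym (ℚ.*-zeroʳ (u - l))
totalMeasure-slabBox {l = l} {u = u} l≤u (b ∷ bs) =
  trans (cong ((u - l) * Box.measure b +_) (totalMeasure-slabBox l≤u bs))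
        (sym (ℚ.*-distribˡ-+ (u - l) (Box.measure b) (totalMeasure bs)))

inner-slab : ∀ {p} {T : Subset d} {l u} → 0ℚ ≤ p → Inner T p → Inner (Slab l u T) ((u - l) * p)
inner-slab {p = p} {T = T} {l = l} {u = u} 0≤p inner with ℚ.≤-total l u
-- The slab is empty and the claimed value is not positive. Slabs shrunk by an error term therefore
-- need no check that their width has stayed positive.
... | inj₂ u≤l = inner-nonPos (≤-from _ (eq u l p) (*-nonNeg (p≤q⇒0≤q-p u≤l) 0≤p))
  where
  eq : ∀ u l p → 0ℚ - (u - l) * p ≡ (l - u) * p
  eq = solve-∀ ℚ-ring
... | inj₁ l≤u = inner-limit (u - l) (p≤q⇒0≤q-p l≤u) step
  where
  step : ∀ η → 0ℚ < η → η ≤ 1ℚ → Inner (Slab l u T) ((u - l) * p - (u - l) * η)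
  packing (step η 0<η _) ε 0<ε with bs , (bs⊆T , bs⊥) , <bs ← packing inner η 0<η =
    List.map (slabBox l≤u) bs ,
    (packed bs⊆T ,
     AllPairs.map⁺ (AllPairs.map (λ {b} {c} → apart b c) bs⊥)) ,
    ℚ.<-≤-trans (<-from ε (eq (u - l) p η ε) 0<ε)
      (subst ((u - l) * (p - η) ≤_) (sym (totalMeasure-slabBox l≤u bs))
        (*-monoˡ-≤ (u - l) (p≤q⇒0≤q-p l≤u) (ℚ.<⇒≤ <bs)))
    where
    packed : ∀ {bs} → All (λ b → Box.points b ⊆ T) bs →
             All (λ b → Box.points b ⊆ Slab l u T) (List.map (slabBox l≤u) bs)
    packed []           = []
    packed (b⊆T ∷ bs⊆T) = (λ x∈ → x∈ zero , b⊆T (x∈ ∘ suc)) ∷ packed bs⊆T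
    apart : ∀ b c → Box.points b ⊥ Box.points c →
            Box.points (slabBox l≤u b) ⊥ Box.points (slabBox l≤u c)
    apart _ _ b⊥c (x∈b , x∈c) = b⊥c (x∈b ∘ suc , x∈c ∘ suc)
    eq : ∀ w p η ε → w * (p - η) - (w * p - w * η - ε) ≡ ε
    eq = solve-∀ ℚ-ring

outer-slab : ∀ {l u} {T : Subset d} {p} → l ≤ u → Outer T p → Outer (Slab l u T) ((u - l) * p)
outer-slab {l = l} {u = u} {T = T} {p = p} l≤u outer = outer-limit (u - l) (p≤q⇒0≤q-p l≤u) step
  where
  step : ∀ η → 0ℚ < η → η ≤ 1ℚ → Outer (Slab l u T) ((u - l) * p + (u - l) * η)
  covering (step η 0<η _) ε 0<ε with bs , T⊆bs , bs< ← covering outer η 0<η =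
    List.map (slabBox l≤u) bs ,
    (λ (x₀∈ , x∈) → Any.map⁺ (Any.map (λ {b} x∈b → slabBox-⊇ l≤u b (x₀∈ , x∈b)) (T⊆bs x∈))) ,
    ℚ.≤-<-trans
      (subst (_≤ (u - l) * (p + η)) (sym (totalMeasure-slabBox l≤u bs))
        (*-monoˡ-≤ (u - l) (p≤q⇒0≤q-p l≤u) (ℚ.<⇒≤ bs<)))
      (<-from ε (eq (u - l) p η ε) 0<ε)
    where
    eq : ∀ w p η ε → (w * p + w * η + ε) - w * (p + η) ≡ ε
    eq = solve-∀ ℚ-ring

Content : Subset d → ℚ → Set
Content S q = Inner S q × Outer S q

content-≐ : ∀ {S T : Subset d} {q} → S ≐ T → Content S q → Content T q
content-≐ (S⊆T , T⊆S) (inner , outer) =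
  inner-mono S⊆T ℚ.≤-refl inner , outer-mono T⊆S ℚ.≤-refl outer

content⇒volume : ∀ {S : Subset d} {q} → Content S q → IsEuclideanVolume S q
content⇒volume (inner , outer) ε 0<ε = packing inner ε 0<ε , covering outer ε 0<ε

-- Maps whose preimages scale the content

-- Testing boxes is enough: preimages under any map preserve disjointness and coverings, so packings
-- and coverings pull back and `content-scale` follows without injectivity of `h`.
record Scaling (h : Point d → Point d) (m : ℚ) : Set where
  field
    factor-pos : 0ℚ < m
    innerBox   : ∀ b → Inner (Box.points b ∘ h) (m * Box.measure b)
    outerBox   : ∀ b → Outer (Box.points b ∘ h) (m * Box.measure b)

⋃ : List (Box d) → Subset d
⋃ bs x = Any (λ b → Box.points b x) bs

module _ {h : Point d → Point d} {m} (scaling : Scaling h m) where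
  open Scaling scaling

  private
    inner-⋃ : ∀ bs → AllPairs (λ b c → Box.points b ⊥ Box.points c) bs →
              Inner (⋃ bs ∘ h) (m * totalMeasure bs)
    inner-⋃ []       _          = inner-nonPos (ℚ.≤-reflexive (ℚ.*-zeroʳ m))
    inner-⋃ (b ∷ bs) (b⊥ ∷ bs⊥) =
      subst (Inner _) (sym (ℚ.*-distribˡ-+ m (Box.measure b) (totalMeasure bs)))
        (inner-⊎ here there (λ (x∈b , x∈bs) → disjoint b⊥ x∈b x∈bs) (innerBox b) (inner-⋃ bs bs⊥))
      where
      disjoint : ∀ {bs x} → All (λ c → Box.points b ⊥ Box.points c) bs → Box.points b x → ¬ ⋃ bs x
      disjoint (b⊥c ∷ _) x∈b (here x∈c)   = b⊥c (x∈b , x∈c)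
      disjoint (_ ∷ b⊥)  x∈b (there x∈bs) = disjoint b⊥ x∈b x∈bs

    outer-⋃ : ∀ bs → Outer (⋃ bs ∘ h) (m * totalMeasure bs)
    outer-⋃ []       = subst (Outer _) (sym (ℚ.*-zeroʳ m)) (outer-∅ λ ())
    outer-⋃ (b ∷ bs) =
      subst (Outer _) (sym (ℚ.*-distribˡ-+ m (Box.measure b) (totalMeasure bs)))
        (outer-∪ (λ { (here x∈b) → inj₁ x∈b ; (there x∈bs) → inj₂ x∈bs }) (outerBox b) (outer-⋃ bs))

  inner-scale : ∀ {S q} → Inner S q → Inner (S ∘ h) (m * q)
  inner-scale {S} {q} inner = inner-limit m (ℚ.<⇒≤ factor-pos) step
    where
    step : ∀ η → 0ℚ < η → η ≤ 1ℚ → Inner (S ∘ h) (m * q - m * η)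
    step η 0<η _ with bs , (bs⊆S , bs⊥) , < ← packing inner η 0<η =
      inner-mono (∈S bs⊆S)
        (subst (_≤ m * totalMeasure bs) (eq m q η) (*-monoˡ-≤ m (ℚ.<⇒≤ factor-pos) (ℚ.<⇒≤ <)))
        (inner-⋃ bs bs⊥)
      where
      eq : ∀ m q η → m * (q - η) ≡ m * q - m * η
      eq = solve-∀ ℚ-ring
      ∈S : ∀ {bs x} → All (λ b → Box.points b ⊆ S) bs → ⋃ bs (h x) → S (h x)
      ∈S (b⊆S ∷ _)  (here x∈b)   = b⊆S x∈b
      ∈S (_ ∷ bs⊆S) (there x∈bs) = ∈S bs⊆S x∈bs

  outer-scale : ∀ {S q} → Outer S q → Outer (S ∘ h) (m * q)
  outer-scale {S} {q} outer = outer-limit m (ℚ.<⇒≤ factor-pos) step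
    where
    step : ∀ η → 0ℚ < η → η ≤ 1ℚ → Outer (S ∘ h) (m * q + m * η)
    step η 0<η _ with bs , S⊆bs , < ← covering outer η 0<η =
      outer-mono S⊆bs
        (subst (m * totalMeasure bs ≤_) (ℚ.*-distribˡ-+ m q η)
          (*-monoˡ-≤ m (ℚ.<⇒≤ factor-pos) (ℚ.<⇒≤ <)))
        (outer-⋃ bs)

  content-scale : ∀ {S q} → Content S q → Content (S ∘ h) (m * q)
  content-scale (inner , outer) = inner-scale inner , outer-scale outer

scaling-∘ : ∀ {h k : Point d → Point d} {m n} →
            Scaling h m → Scaling k n → Scaling (h ∘ k) (m * n)
scaling-∘ {m = m} {n} H K = record
  { factor-pos = *-pos (factor-pos H) (factor-pos K)
  ; innerBox   = λ b → subst (Inner _) (eq m n (Box.measure b)) (inner-scale K (innerBox H b))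
  ; outerBox   = λ b → subst (Outer _) (eq m n (Box.measure b)) (outer-scale K (outerBox H b))
  }
  where
  open Scaling
  eq : ∀ m n x → n * (m * x) ≡ m * n * x
  eq = solve-∀ ℚ-ring

points-cong : ∀ (b : Box d) {x y : Point d} → x ≗ y → Box.points b x → Box.points b y
points-cong b x≗y x∈b i =
  subst (_ ≤_) (x≗y i) (proj₁ (x∈b i)) , subst (_< _) (x≗y i) (proj₂ (x∈b i))

scaling-cong : ∀ {h k : Point d → Point d} {m n} → (∀ x → h x ≗ k x) → m ≡ n →
               Scaling h m → Scaling k n
scaling-cong h≗k refl H = record
  { factor-pos = factor-pos
  ; innerBox   = λ b → inner-mono (λ {x} → points-cong b (h≗k x)) ℚ.≤-refl (innerBox b)
  ; outerBox   = λ b → outer-mono (λ {x} → points-cong b (sym ∘ h≗k x)) ℚ.≤-refl (outerBox b)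
  }
  where open Scaling H

-- Elementary maps

affine : Point d → Point d → Point d → Point d
affine β t x i = β i * x i + t i

module _ {β : Point d} (t : Point d) (0<β : ∀ i → 0ℚ < β i) where
  private
    cancel : ∀ i y → β i * ((y - t i) * recip (β i)) ≡ y - t i
    cancel i y = trans (eq (β i) (y - t i) (recip (β i)))
      (trans (cong (_* (y - t i)) (*-recip-pos (0<β i))) (ℚ.*-identityˡ _))
      where
      eq : ∀ b y r → b * (y * r) ≡ b * r * y
      eq = solve-∀ ℚ-ring

    difference : ∀ i x y → (β i * x + t i) - y ≡ β i * x - β i * ((y - t i) * recip (β i))
    difference i x y = trans (eq (β i * x) (t i) y) (cong (λ z → β i * x - z) (sym (cancel i y)))
      where
      eq : ∀ b t y → (b + t) - y ≡ b - (y - t)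
      eq = solve-∀ ℚ-ring

    difference′ : ∀ i x y → y - (β i * x + t i) ≡ β i * ((y - t i) * recip (β i)) - β i * x
    difference′ i x y = trans (eq (β i * x) (t i) y) (cong (λ z → z - β i * x) (sym (cancel i y)))
      where
      eq : ∀ b t y → y - (b + t) ≡ (y - t) - b
      eq = solve-∀ ℚ-ring

    module _ (b : Box d) where
      open Box b

      preimage : Box d
      preimage = record
        { lower       = λ i → (lower i - t i) * recip (β i)
        ; upper       = λ i → (upper i - t i) * recip (β i)
        ; lower≤upper = λ i → *-monoʳ-≤ (recip (β i)) (ℚ.<⇒≤ (recip-pos (0<β i)))
                                (ℚ.+-monoˡ-≤ (- t i) (lower≤upper i))
        }

      measure-preimage : Box.measure preimage ≡ product (recip ∘ β) * measure
      measure-preimage = trans (product-cong-≗ width) (∏-distrib-* (recip ∘ β) (λ i → upper i - lower i))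
        where
        eq : ∀ u t l r → (u - t) * r - (l - t) * r ≡ r * (u - l)
        eq = solve-∀ ℚ-ring
        width : ∀ i → (upper i - t i) * recip (β i) - (lower i - t i) * recip (β i) ≡
                      recip (β i) * (upper i - lower i)
        width i = eq (upper i) (t i) (lower i) (recip (β i))

      preimage-⊆ : Box.points preimage ⊆ points ∘ affine β t
      preimage-⊆ {x} x∈ i =
        ≤-resp (*-monoˡ-≤ (β i) (ℚ.<⇒≤ (0<β i)) (proj₁ (x∈ i))) (sym (difference i (x i) (lower i))) ,
        <-resp (*-monoˡ-< (β i) (0<β i) (proj₂ (x∈ i))) (sym (difference′ i (x i) (upper i)))

      preimage-⊇ : points ∘ affine β t ⊆ Box.points preimage
      preimage-⊇ {x} x∈ i =
        *-cancelˡ-≤ (β i) (0<β i) (≤-resp (proj₁ (x∈ i)) (difference i (x i) (lower i))) ,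
        *-cancelˡ-< (β i) (0<β i) (<-resp (proj₂ (x∈ i)) (difference′ i (x i) (upper i)))

  scaling-affine : Scaling (affine β t) (product (recip ∘ β))
  scaling-affine = record
    { factor-pos = go 0<β
    ; innerBox   = λ b → inner-mono (λ {x} → preimage-⊆ b {x}) (ℚ.≤-reflexive (sym (measure-preimage b))) (inner-box (preimage b))
    ; outerBox   = λ b → outer-mono (λ {x} → preimage-⊇ b {x}) (ℚ.≤-reflexive (measure-preimage b)) (outer-box (preimage b))
    }
    where
    go : ∀ {d} {β : Point d} → (∀ i → 0ℚ < β i) → 0ℚ < product (recip ∘ β)
    go {zero}  0<β = 0<1
    go {suc d} 0<β = *-pos (recip-pos (0<β zero)) (go (0<β ∘ suc))

swap : ∀ {A : Set} → Vector A (suc (suc d)) → Vector A (suc (suc d))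
swap x zero          = x (suc zero)
swap x (suc zero)    = x zero
swap x (suc (suc i)) = x (suc (suc i))

scaling-swap : Scaling (swap {d}) 1ℚ
scaling-swap {d} = record
  { factor-pos = 0<1
  ; innerBox   = λ b → inner-mono (λ {x} → swap-⊆ b {x}) (ℚ.≤-reflexive (sym (measure-swap b))) (inner-box (swapBox b))
  ; outerBox   = λ b → outer-mono (λ {x} → swap-⊇ b {x}) (ℚ.≤-reflexive (measure-swap b)) (outer-box (swapBox b))
  }
  where
  module _ (b : Box (suc (suc d))) where
    open Box b
    swapBox : Box (suc (suc d))
    swapBox = record
      { lower       = swap lower
      ; upper       = swap upper
      ; lower≤upper = λ where
          zero          → lower≤upper (suc zero)
          (suc zero)    → lower≤upper zero
          (suc (suc i)) → lower≤upper (suc (suc i))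
      }
    measure-swap : Box.measure swapBox ≡ 1ℚ * measure
    measure-swap = eq (upper zero - lower zero) (upper (suc zero) - lower (suc zero)) (Box.measure (tailBox (tailBox b)))
      where
      eq : ∀ x y z → y * (x * z) ≡ 1ℚ * (x * (y * z))
      eq = solve-∀ ℚ-ring
    swap-⊆ : Box.points swapBox ⊆ points ∘ swap
    swap-⊆ x∈ zero          = x∈ (suc zero)
    swap-⊆ x∈ (suc zero)    = x∈ zero
    swap-⊆ x∈ (suc (suc i)) = x∈ (suc (suc i))
    swap-⊇ : points ∘ swap ⊆ Box.points swapBox
    swap-⊇ x∈ zero          = x∈ (suc zero)
    swap-⊇ x∈ (suc zero)    = x∈ zero
    swap-⊇ x∈ (suc (suc i)) = x∈ (suc (suc i))

lift : (Point d → Point d) → Point (suc d) → Point (suc d)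
lift h x = x zero V.∷ h (x ∘ suc)

scaling-lift : ∀ {h : Point d → Point d} {m} → Scaling h m → Scaling (lift h) m
scaling-lift {h = h} {m} H = record
  { factor-pos = factor-pos
  ; innerBox   = λ b → inner-mono
      (λ { (x₀∈ , x∈) zero → x₀∈ ; (x₀∈ , x∈) (suc i) → x∈ i })
      (ℚ.≤-reflexive (eq m (width b) (Box.measure (tailBox b))))
      (inner-slab (*-nonNeg (ℚ.<⇒≤ factor-pos) (measure-nonNeg (tailBox b))) (innerBox (tailBox b)))
  ; outerBox   = λ b → outer-mono
      (λ x∈ → x∈ zero , x∈ ∘ suc)
      (ℚ.≤-reflexive (sym (eq m (width b) (Box.measure (tailBox b)))))
      (outer-slab (Box.lower≤upper b zero) (outerBox (tailBox b)))
  }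
  where
  open Scaling H
  width : Box (suc _) → ℚ
  width b = Box.upper b zero - Box.lower b zero
  eq : ∀ m w x → m * (w * x) ≡ w * (m * x)
  eq = solve-∀ ℚ-ring

negate₀ : Point (suc d) → Point (suc d)
negate₀ x = (- x zero) V.∷ (x ∘ suc)

-- The preimage of a half-open box is half-open on the wrong side, hence only approximated by boxes.
scaling-negate₀ : Scaling (negate₀ {d}) 1ℚ
scaling-negate₀ {d} = record
  { factor-pos = 0<1
  ; innerBox   = λ b → inner-limit (Box.measure (tailBox b)) (measure-nonNeg (tailBox b))
      λ η 0<η _ → inner-mono (λ {x} → negate-⊆ b η 0<η {x})
        (ℚ.≤-reflexive (eq₁ (Box.lower b zero) (Box.upper b zero) η (Box.measure (tailBox b))))
        (inner-slab (measure-nonNeg (tailBox b)) (inner-box (tailBox b)))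
  ; outerBox   = λ b → outer-limit (Box.measure (tailBox b)) (measure-nonNeg (tailBox b))
      λ η 0<η _ → outer-mono (λ {x} → negate-⊇ b η 0<η {x})
        (ℚ.≤-reflexive (eq₂ (Box.lower b zero) (Box.upper b zero) η (Box.measure (tailBox b))))
        (outer-slab
          (≤-from _ (eq₃ (Box.lower b zero) (Box.upper b zero) η)
            (+-nonNeg (p≤q⇒0≤q-p (Box.lower≤upper b zero)) (ℚ.<⇒≤ 0<η)))
          (outer-box (tailBox b)))
  }
  where
  eq₁ : ∀ l u η m → 1ℚ * ((u - l) * m) - m * η ≡ (- l - (- u + η)) * m
  eq₁ = solve-∀ ℚ-ring
  eq₂ : ∀ l u η m → (- l + η - - u) * m ≡ 1ℚ * ((u - l) * m) + m * η
  eq₂ = solve-∀ ℚ-ring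
  eq₃ : ∀ l u η → (- l + η) - - u ≡ u - l + η
  eq₃ = solve-∀ ℚ-ring
  eq₄ : ∀ x u η → u - - x ≡ x - (- u + η) + η
  eq₄ = solve-∀ ℚ-ring
  eq₅ : ∀ x l → - l - x ≡ - x - l
  eq₅ = solve-∀ ℚ-ring
  eq₆ : ∀ x l η → (- l + η) - x ≡ η + (- x - l)
  eq₆ = solve-∀ ℚ-ring
  eq₇ : ∀ x u → u - - x ≡ x - - u
  eq₇ = solve-∀ ℚ-ring
  module _ (b : Box (suc d)) (η : ℚ) (0<η : 0ℚ < η) where
    open Box b
    negate-⊆ : Slab (- upper zero + η) (- lower zero) (Box.points (tailBox b)) ⊆ points ∘ negate₀
    negate-⊆ {x} ((≤x , x<) , x∈) zero =
      ≤-resp (ℚ.<⇒≤ x<) (eq₅ (x zero) (lower zero)) ,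
      <-from _ (eq₄ (x zero) (upper zero) η)
        (subst (0ℚ <_) (ℚ.+-comm η _) (+-pos-nonNeg 0<η (p≤q⇒0≤q-p ≤x)))
    negate-⊆ (_ , x∈) (suc i) = x∈ i
    negate-⊇ : points ∘ negate₀ ⊆ Slab (- upper zero) (- lower zero + η) (Box.points (tailBox b))
    negate-⊇ {x} x∈ =
      (≤-resp (ℚ.<⇒≤ (proj₂ (x∈ zero))) (eq₇ (x zero) (upper zero)) ,
       <-from _ (eq₆ (x zero) (lower zero) η) (+-pos-nonNeg 0<η (p≤q⇒0≤q-p (proj₁ (x∈ zero))))) ,
      x∈ ∘ suc

subdivide : ∀ r η → 0ℚ ≤ r → 0ℚ < η → ∃₂ λ N δ → 0ℚ < δ × δ ≤ η × fromNat N * δ ≡ r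
subdivide r η 0≤r 0<η with 0ℚ ℚ.<? r
-- For `r = 0` the width `r / N` would not be positive, so zero slices of width `η` are taken.
... | no r≯0 = 0 , η , 0<η , ℚ.≤-refl , trans (ℚ.*-zeroˡ η) (ℚ.≤-antisym 0≤r (ℚ.≮⇒≥ r≯0))
... | yes 0<r with N , r/η≤N ← archimedean (r * recip η) =
  N , r * recip (fromNat N) , *-pos 0<r (recip-pos 0<N) ,
  *-cancelˡ-≤ (fromNat N) 0<N (subst (_≤ fromNat N * η) (sym N*δ≡r) r≤Nη) , N*δ≡r
  where
  0<N : 0ℚ < fromNat N
  0<N = ℚ.<-≤-trans (*-pos 0<r (recip-pos 0<η)) r/η≤N
  eq : ∀ n r x → n * (r * x) ≡ r * (n * x)
  eq = solve-∀ ℚ-ring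
  N*δ≡r : fromNat N * (r * recip (fromNat N)) ≡ r
  N*δ≡r = trans (eq (fromNat N) r (recip (fromNat N)))
    (trans (cong (r *_) (*-recip-pos 0<N)) (ℚ.*-identityʳ r))
  eq′ : ∀ r h η → r * h * η ≡ r * (η * h)
  eq′ = solve-∀ ℚ-ring
  r≤Nη : r ≤ fromNat N * η
  r≤Nη = subst (_≤ fromNat N * η)
    (trans (eq′ r (recip η) η) (trans (cong (r *_) (*-recip-pos 0<η)) (ℚ.*-identityʳ r)))
    (*-monoʳ-≤ η (ℚ.<⇒≤ 0<η) r/η≤N)

-- Cutting a set into N slices of width δ orthogonal to the first axis

module _ (T : Subset (suc d)) {δ : ℚ} (0<δ : 0ℚ < δ) {c : ℚ} where
  private
    Slices : ℕ → ℚ → Subset (suc d)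
    Slices N l x = (l ≤ x zero × x zero < l + fromNat N * δ) × T x

    value-suc : ∀ N → δ * c + fromNat N * (δ * c) ≡ fromNat (suc N) * (δ * c)
    value-suc N = trans (eq (δ * c) (fromNat N)) (cong (_* (δ * c)) (sym (fromNat-suc N)))
      where
      eq : ∀ x n → x + n * x ≡ (1ℚ + n) * x
      eq = solve-∀ ℚ-ring

    bound-suc : ∀ N l → l + δ + fromNat N * δ ≡ l + fromNat (suc N) * δ
    bound-suc N l = trans (eq l δ (fromNat N)) (cong (λ z → l + z * δ) (sym (fromNat-suc N)))
      where
      eq : ∀ l δ n → l + δ + n * δ ≡ l + (1ℚ + n) * δ
      eq = solve-∀ ℚ-ring

    l≤l+δ : ∀ l → l ≤ l + δ
    l≤l+δ l = ≤-from δ (eq l δ) (ℚ.<⇒≤ 0<δ)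
      where
      eq : ∀ l δ → l + δ - l ≡ δ
      eq = solve-∀ ℚ-ring

    l+δ≤ : ∀ N l → l + δ ≤ l + fromNat (suc N) * δ
    l+δ≤ N l = ≤-from (fromNat N * δ)
      (trans (cong (_- (l + δ)) (sym (bound-suc N l))) (eq l δ (fromNat N * δ)))
      (*-nonNeg (fromNat-nonNeg N) (ℚ.<⇒≤ 0<δ))
      where
      eq : ∀ l δ n → l + δ + n - (l + δ) ≡ n
      eq = solve-∀ ℚ-ring

    width : ∀ t → (t + δ - t) * c ≡ δ * c
    width t = eq t δ c
      where
      eq : ∀ t δ c → (t + δ - t) * c ≡ δ * c
      eq = solve-∀ ℚ-ring

  -- A Riemann sum whose section content `c` is the same for all slices. The set `I t` has to fit
  -- into every section over `[t, t + δ)`; in `outer-slices` the set `O t` has to contain them all.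
  inner-slices : (I : ℚ → Subset d) → (∀ t → Inner (I t) c) →
                 (∀ t x → Slab t (t + δ) (I t) x → T x) →
                 ∀ N l → Inner (Slices N l) (fromNat N * (δ * c))
  inner-slices I inner I⊆T with ℚ.≤-total 0ℚ c
  -- The value `c` is negative when the error exceeds the width of the section; the empty packing is
  -- then good enough.
  ... | inj₂ c≤0 = λ N l → inner-nonPos
    (≤-from _ (eq (fromNat N) δ c)
      (*-nonNeg (fromNat-nonNeg N) (*-nonNeg (ℚ.<⇒≤ 0<δ) (p≤q⇒0≤q-p c≤0))))
    where
    eq : ∀ n δ c → 0ℚ - n * (δ * c) ≡ n * (δ * (0ℚ - c))
    eq = solve-∀ ℚ-ring
  ... | inj₁ 0≤c = go
    where
    go : ∀ N l → Inner (Slices N l) (fromNat N * (δ * c))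
    go zero    l = inner-nonPos (ℚ.≤-reflexive (ℚ.*-zeroˡ (δ * c)))
    go (suc N) l = subst (Inner _) (value-suc N) (inner-⊎
      (λ {x} x∈ → (proj₁ (proj₁ x∈) , ℚ.<-≤-trans (proj₂ (proj₁ x∈)) (l+δ≤ N l)) , I⊆T l x x∈)
      (λ ((≤x , x<) , x∈T) →
        (ℚ.≤-trans (l≤l+δ l) ≤x , subst (_ <_) (bound-suc N l) x<) , x∈T)
      (λ (((_ , x<) , _) , ((≤x , _) , _)) → ≤⇒≯ ≤x x<)
      (subst (Inner _) (width l) (inner-slab 0≤c (inner l)))
      (go N (l + δ)))

  outer-slices : (O : ℚ → Subset d) → (∀ t → Outer (O t) c) →
                 (∀ t x → t ≤ x zero → x zero < t + δ → T x → O t (x ∘ suc)) →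
                 ∀ N l → Outer (Slices N l) (fromNat N * (δ * c))
  outer-slices O outer T⊆O zero    l = subst (Outer _) (sym (ℚ.*-zeroˡ (δ * c)))
    (outer-∅ λ ((≤x , x<) , _) → ≤⇒≯ ≤x (subst (_ <_) (eq l δ) x<))
    where
    eq : ∀ l δ → l + 0ℚ * δ ≡ l
    eq = solve-∀ ℚ-ring
  outer-slices O outer T⊆O (suc N) l = subst (Outer _) (value-suc N) (outer-∪ split
    (subst (Outer _) (width l) (outer-slab (l≤l+δ l) (outer l)))
    (outer-slices O outer T⊆O N (l + δ)))
    where
    split : Slices (suc N) l ⊆ Slab l (l + δ) (O l) ∪ Slices N (l + δ)
    split {x} ((≤x , x<) , x∈T) with x zero ℚ.<? l + δ
    ... | yes x<l+δ = inj₁ ((≤x , x<l+δ) , T⊆O l x ≤x x<l+δ x∈T)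
    ... | no  x≮l+δ = inj₂ ((ℚ.≮⇒≥ x≮l+δ , subst (x zero <_) (sym (bound-suc N l)) x<) , x∈T)

-- Shears preserve content

shear : ℚ → Point (suc (suc d)) → Point (suc (suc d))
shear k x zero          = x zero
shear k x (suc zero)    = x (suc zero) + k * x zero
shear k x (suc (suc i)) = x (suc (suc i))

module _ (k : ℚ) (b : Box (suc (suc d))) where
  private
    K = ∣ k ∣
    l₀ = Box.lower b zero
    u₀ = Box.upper b zero
    l₁ = Box.lower b (suc zero)
    u₁ = Box.upper b (suc zero)
    B  = tailBox (tailBox b)
    M  = Box.measure B
    r  = u₀ - l₀

    0≤K : 0ℚ ≤ K
    0≤K = ℚ.0≤∣p∣ k
    0≤M : 0ℚ ≤ M
    0≤M = measure-nonNeg B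
    0≤r : 0ℚ ≤ r
    0≤r = p≤q⇒0≤q-p (Box.lower≤upper b zero)

    0≤ks+Kδ : ∀ {s δ} → 0ℚ ≤ s → s ≤ δ → 0ℚ ≤ k * s + K * δ
    0≤ks+Kδ {s} {δ} 0≤s s≤δ = subst (0ℚ ≤_) (eq k K s δ)
      (+-nonNeg (*-nonNeg (p≤q⇒0≤q-p (-p≤∣p∣ k)) 0≤s) (*-nonNeg 0≤K (p≤q⇒0≤q-p s≤δ)))
      where
      eq : ∀ k K s δ → (K - - k) * s + K * (δ - s) ≡ k * s + K * δ
      eq = solve-∀ ℚ-ring

    0≤Kδ-ks : ∀ {s δ} → 0ℚ ≤ s → s ≤ δ → 0ℚ ≤ K * δ - k * s
    0≤Kδ-ks {s} {δ} 0≤s s≤δ = subst (0ℚ ≤_) (eq k K s δ)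
      (+-nonNeg (*-nonNeg (p≤q⇒0≤q-p (p≤∣p∣ k)) 0≤s) (*-nonNeg 0≤K (p≤q⇒0≤q-p s≤δ)))
      where
      eq : ∀ k K s δ → (K - k) * s + K * (δ - s) ≡ K * δ - k * s
      eq = solve-∀ ℚ-ring

    Strip : Subset (suc (suc d))
    Strip x = (l₁ ≤ x (suc zero) + k * x zero × x (suc zero) + k * x zero < u₁) ×
              Box.points B (λ i → x (suc (suc i)))

    Slices-⊆ : ∀ {x} → ((l₀ ≤ x zero × x zero < u₀) × Strip x) → Box.points b (shear k x)
    Slices-⊆ (x₀∈ , _)      zero          = x₀∈
    Slices-⊆ (_ , x₁∈ , _)  (suc zero)    = x₁∈
    Slices-⊆ (_ , _ , x∈)   (suc (suc i)) = x∈ i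

    Slices-⊇ : ∀ {x} → Box.points b (shear k x) → ((l₀ ≤ x zero × x zero < u₀) × Strip x)
    Slices-⊇ x∈ = x∈ zero , x∈ (suc zero) , λ i → x∈ (suc (suc i))

    constant : ℚ
    constant = r * ((K + K) * M)

    0≤constant : 0ℚ ≤ constant
    0≤constant = *-nonNeg 0≤r (*-nonNeg (+-nonNeg 0≤K 0≤K) 0≤M)

    end : ∀ N δ → fromNat N * δ ≡ r → l₀ + fromNat N * δ ≡ u₀
    end N δ eq = trans (cong (l₀ +_) eq) (eq′ l₀ u₀)
      where
      eq′ : ∀ l u → l + (u - l) ≡ u
      eq′ = solve-∀ ℚ-ring

    offset-≤ : ∀ {t δ x} → x < t + δ → x - t ≤ δ
    offset-≤ {t} {δ} {x} x< = ≤-resp (ℚ.<⇒≤ x<) (eq t δ x)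
      where
      eq : ∀ t δ x → t + δ - x ≡ δ - (x - t)
      eq = solve-∀ ℚ-ring

  -- Over a slice of width `δ` the sheared interval in the second coordinate moves by at most
  -- `K * δ`, so cutting `K * δ` off both of its ends leaves a box inside all sections. Over the
  -- whole length `r` the loss is `r * (K + K) * M * δ`, the origin of `constant`. For the outer
  -- content the interval is enlarged instead.
  innerBox-shear : Inner (Box.points b ∘ shear k) (1ℚ * Box.measure b)
  innerBox-shear = inner-limit constant 0≤constant step
    where
    step : ∀ η → 0ℚ < η → η ≤ 1ℚ → Inner (Box.points b ∘ shear k) (1ℚ * Box.measure b - constant * η)
    step η 0<η _ with N , δ , 0<δ , δ≤η , Nδ≡r ← subdivide r η 0≤r 0<η =
      inner-mono (λ { {x} ((≤x , x<) , x∈) → Slices-⊆ {x} ((≤x , subst (x zero <_) (end N δ Nδ≡r) x<) , x∈) })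
        value (inner-slices Strip 0<δ I innerI I⊆Strip N l₀)
      where
      I : ℚ → Subset (suc d)
      I t = Slab (l₁ - k * t + K * δ) (u₁ - k * t - K * δ) (Box.points B)

      innerI : ∀ t → Inner (I t) ((u₁ - l₁ - (K + K) * δ) * M)
      innerI t = subst (Inner _) (eq u₁ l₁ (k * t) K δ M) (inner-slab 0≤M (inner-box B))
        where
        eq : ∀ u l s K δ M → (u - s - K * δ - (l - s + K * δ)) * M ≡ (u - l - (K + K) * δ) * M
        eq = solve-∀ ℚ-ring

      I⊆Strip : ∀ t x → Slab t (t + δ) (I t) x → Strip x
      I⊆Strip t x ((t≤x₀ , x₀<) , (≤x₁ , x₁<) , x∈) =
        (≤-from _ (sym (eq₁ (x (suc zero)) (x zero) l₁ k t (K * δ)))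
          (+-nonNeg (p≤q⇒0≤q-p ≤x₁) (0≤ks+Kδ (p≤q⇒0≤q-p t≤x₀) (offset-≤ x₀<))) ,
         <-from _ (sym (eq₂ (x (suc zero)) (x zero) u₁ k t (K * δ)))
          (+-pos-nonNeg (p<q⇒0<q-p x₁<) (0≤Kδ-ks (p≤q⇒0≤q-p t≤x₀) (offset-≤ x₀<)))) , x∈
        where
        eq₁ : ∀ x₁ x₀ l k t z → x₁ - (l - k * t + z) + (k * (x₀ - t) + z) ≡ (x₁ + k * x₀) - l
        eq₁ = solve-∀ ℚ-ring
        eq₂ : ∀ x₁ x₀ u k t z → u - k * t - z - x₁ + (z - k * (x₀ - t)) ≡ u - (x₁ + k * x₀)
        eq₂ = solve-∀ ℚ-ring

      -- A ring identity cannot use the hypothesis `n * δ ≡ r`, so it carries a summand with the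
      -- factor `n * δ - r`, which is rewritten to 0 afterwards.
      eq : ∀ n δ w K M η r → n * (δ * ((w - (K + K) * δ) * M)) - (1ℚ * (r * (w * M)) - r * ((K + K) * M) * η) ≡
                             (n * δ - r) * ((w - (K + K) * δ) * M) + r * ((K + K) * M) * (η - δ)
      eq = solve-∀ ℚ-ring
      value : 1ℚ * Box.measure b - constant * η ≤ fromNat N * (δ * ((u₁ - l₁ - (K + K) * δ) * M))
      value = ≤-from (constant * (η - δ))
        (trans (eq (fromNat N) δ (u₁ - l₁) K M η r)
          (trans (cong (λ z → z * ((u₁ - l₁ - (K + K) * δ) * M) + constant * (η - δ))
                   (trans (cong (_- r) Nδ≡r) (ℚ.+-inverseʳ r)))
            (eq₀ ((u₁ - l₁ - (K + K) * δ) * M) (constant * (η - δ)))))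
        (*-nonNeg 0≤constant (p≤q⇒0≤q-p δ≤η))
        where
        eq₀ : ∀ x y → 0ℚ * x + y ≡ y
        eq₀ = solve-∀ ℚ-ring

  outerBox-shear : Outer (Box.points b ∘ shear k) (1ℚ * Box.measure b)
  outerBox-shear = outer-limit constant 0≤constant step
    where
    step : ∀ η → 0ℚ < η → η ≤ 1ℚ → Outer (Box.points b ∘ shear k) (1ℚ * Box.measure b + constant * η)
    step η 0<η _ with N , δ , 0<δ , δ≤η , Nδ≡r ← subdivide r η 0≤r 0<η =
      outer-mono (λ {x} x∈ → case Slices-⊇ {x} x∈ of λ where
          ((≤x , x<) , x∈Strip) → (≤x , subst (x zero <_) (sym (end N δ Nδ≡r)) x<) , x∈Strip)
        value (outer-slices Strip 0<δ O outerO Strip⊆O N l₀)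
      where
      O : ℚ → Subset (suc d)
      O t = Slab (l₁ - k * t - K * δ) (u₁ - k * t + K * δ) (Box.points B)

      eq₃ : ∀ u l s K δ → u - s + K * δ - (l - s - K * δ) ≡ u - l + (K + K) * δ
      eq₃ = solve-∀ ℚ-ring

      outerO : ∀ t → Outer (O t) ((u₁ - l₁ + (K + K) * δ) * M)
      outerO t = subst (Outer _) (cong (_* M) (eq₃ u₁ l₁ (k * t) K δ)) (outer-slab
        (≤-from _ (eq₃ u₁ l₁ (k * t) K δ)
          (+-nonNeg (p≤q⇒0≤q-p (Box.lower≤upper b (suc zero)))
            (*-nonNeg (+-nonNeg 0≤K 0≤K) (ℚ.<⇒≤ 0<δ))))
        (outer-box B))

      Strip⊆O : ∀ t x → t ≤ x zero → x zero < t + δ → Strip x → O t (x ∘ suc)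
      Strip⊆O t x t≤x₀ x₀< ((≤x₁ , x₁<) , x∈) =
        (≤-from _ (sym (eq₁ (x (suc zero)) (x zero) l₁ k t (K * δ)))
          (+-nonNeg (p≤q⇒0≤q-p ≤x₁) (0≤Kδ-ks (p≤q⇒0≤q-p t≤x₀) (offset-≤ x₀<))) ,
         <-from _ (sym (eq₂ (x (suc zero)) (x zero) u₁ k t (K * δ)))
          (+-pos-nonNeg (p<q⇒0<q-p x₁<) (0≤ks+Kδ (p≤q⇒0≤q-p t≤x₀) (offset-≤ x₀<)))) , x∈
        where
        eq₁ : ∀ x₁ x₀ l k t z → x₁ + k * x₀ - l + (z - k * (x₀ - t)) ≡ x₁ - (l - k * t - z)
        eq₁ = solve-∀ ℚ-ring
        eq₂ : ∀ x₁ x₀ u k t z → u - (x₁ + k * x₀) + (k * (x₀ - t) + z) ≡ u - k * t + z - x₁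
        eq₂ = solve-∀ ℚ-ring

      eq : ∀ n δ w K M η r → (1ℚ * (r * (w * M)) + r * ((K + K) * M) * η) - n * (δ * ((w + (K + K) * δ) * M)) ≡
                             (r - n * δ) * ((w + (K + K) * δ) * M) + r * ((K + K) * M) * (η - δ)
      eq = solve-∀ ℚ-ring
      value : fromNat N * (δ * ((u₁ - l₁ + (K + K) * δ) * M)) ≤ 1ℚ * Box.measure b + constant * η
      value = ≤-from (constant * (η - δ))
        (trans (eq (fromNat N) δ (u₁ - l₁) K M η r)
          (trans (cong (λ z → z * ((u₁ - l₁ + (K + K) * δ) * M) + constant * (η - δ))
                   (trans (cong (λ z → r - z) Nδ≡r) (ℚ.+-inverseʳ r)))
            (eq₀ ((u₁ - l₁ + (K + K) * δ) * M) (constant * (η - δ)))))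
        (*-nonNeg 0≤constant (p≤q⇒0≤q-p δ≤η))
        where
        eq₀ : ∀ x y → 0ℚ * x + y ≡ y
        eq₀ = solve-∀ ℚ-ring

scaling-shear : ∀ k → Scaling (shear {d} k) 1ℚ
scaling-shear k = record
  { factor-pos = 0<1
  ; innerBox   = innerBox-shear k
  ; outerBox   = outerBox-shear k
  }

product-recip-one : ∀ n → product {n} (λ _ → recip 1ℚ) ≡ 1ℚ
product-recip-one zero    = refl
product-recip-one (suc n) = trans (ℚ.*-identityˡ _) (product-recip-one n)

-- Content of the standard simplex

sum-nonNeg : ∀ {n} {x : Point n} → (∀ i → 0ℚ ≤ x i) → 0ℚ ≤ sum x
sum-nonNeg {zero}  0≤x = ℚ.≤-refl
sum-nonNeg {suc n} 0≤x = +-nonNeg (0≤x zero) (sum-nonNeg (0≤x ∘ suc))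

^-nonNeg : ∀ {s} n → 0ℚ ≤ s → 0ℚ ≤ s ^ n
^-nonNeg zero    0≤s = 0≤1
^-nonNeg (suc n) 0≤s = *-nonNeg 0≤s (^-nonNeg n 0≤s)

^-mono-≤ : ∀ {s t} n → 0ℚ ≤ s → s ≤ t → s ^ n ≤ t ^ n
^-mono-≤ zero    0≤s s≤t = ℚ.≤-refl
^-mono-≤ (suc n) 0≤s s≤t = *-mono-≤ (^-nonNeg n 0≤s) (ℚ.≤-trans 0≤s s≤t) s≤t (^-mono-≤ n 0≤s s≤t)

module _ {s δ : ℚ} (0≤s : 0ℚ ≤ s) (0≤δ : 0ℚ ≤ δ) where
  private
    0≤s+δ : 0ℚ ≤ s + δ
    0≤s+δ = +-nonNeg 0≤s 0≤δ

  -- With `^-increment-upper` this is the mean value estimate for `x ^ suc n` on `[s, s + δ]`: the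
  -- derivative is bounded by its values at the two ends.
  ^-increment-lower : ∀ n → fromNat (suc n) * (δ * s ^ n) ≤ (s + δ) ^ suc n - s ^ suc n
  ^-increment-lower zero    = ℚ.≤-reflexive (eq s δ)
    where
    eq : ∀ s δ → 1ℚ * (δ * 1ℚ) ≡ (s + δ) * 1ℚ - s * 1ℚ
    eq = solve-∀ ℚ-ring
  ^-increment-lower (suc n) = ≤-from _
    (trans (cong (λ z → (s + δ) * (s + δ) ^ suc n - s * s ^ suc n - z * (δ * (s * s ^ n))) (fromNat-suc (suc n)))
      (eq (fromNat (suc n)) s δ (s ^ n) ((s + δ) ^ suc n)))
    (+-nonNeg
      (*-nonNeg 0≤s+δ (p≤q⇒0≤q-p (^-increment-lower n)))
      (*-nonNeg (*-nonNeg (fromNat-nonNeg (suc n)) (*-nonNeg 0≤δ 0≤δ)) (^-nonNeg n 0≤s)))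
    where
    eq : ∀ c s δ p q → (s + δ) * q - s * (s * p) - (1ℚ + c) * (δ * (s * p)) ≡
                       (s + δ) * (q - s * p - c * (δ * p)) + c * (δ * δ) * p
    eq = solve-∀ ℚ-ring

  ^-increment-upper : ∀ n → (s + δ) ^ suc n - s ^ suc n ≤ fromNat (suc n) * (δ * (s + δ) ^ n)
  ^-increment-upper zero    = ℚ.≤-reflexive (eq s δ)
    where
    eq : ∀ s δ → (s + δ) * 1ℚ - s * 1ℚ ≡ 1ℚ * (δ * 1ℚ)
    eq = solve-∀ ℚ-ring
  ^-increment-upper (suc n) = ≤-from _
    (trans (cong (λ z → z * (δ * (s + δ) ^ suc n) - ((s + δ) * (s + δ) ^ suc n - s * s ^ suc n)) (fromNat-suc (suc n)))
      (eq (fromNat (suc n)) s δ (s ^ suc n) ((s + δ) ^ n)))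
    (+-nonNeg
      (*-nonNeg 0≤s (p≤q⇒0≤q-p (^-increment-upper n)))
      (*-nonNeg (*-nonNeg (fromNat-nonNeg (suc n)) (*-nonNeg 0≤δ 0≤δ)) (^-nonNeg n 0≤s+δ)))
    where
    eq : ∀ c s δ p q → (1ℚ + c) * (δ * ((s + δ) * q)) - ((s + δ) * ((s + δ) * q) - s * p) ≡
                       s * (c * (δ * q) - ((s + δ) * q - p)) + c * (δ * δ) * q
    eq = solve-∀ ℚ-ring

simplexVolume : ℕ → ℚ → ℚ
simplexVolume d r = r ^ d * recip (fromNat (d !))

0<d! : ∀ d → 0ℚ < fromNat (d !)
0<d! d = fromNat-pos (d !) (ℕ.1≤n! d)

recip-!-suc : ∀ d → fromNat (suc d) * recip (fromNat (suc d !)) ≡ recip (fromNat (d !))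
recip-!-suc d = recip-unique {fromNat (d !)} (begin
  fromNat (d !) * (fromNat (suc d) * recip (fromNat (suc d !)))  ≡⟨ eq (fromNat (d !)) (fromNat (suc d)) (recip (fromNat (suc d !))) ⟩
  fromNat (suc d) * fromNat (d !) * recip (fromNat (suc d !))  ≡⟨ cong (_* recip (fromNat (suc d !))) (fromNat-homo-* (suc d) (d !)) ⟨
  fromNat (suc d !) * recip (fromNat (suc d !))  ≡⟨ *-recip-pos (0<d! (suc d)) ⟩
  1ℚ  ∎)
  where
  open ≡-Reasoning
  eq : ∀ x y z → x * (y * z) ≡ y * x * z
  eq = solve-∀ ℚ-ring

simplexVolume-nonNeg : ∀ d {r} → 0ℚ ≤ r → 0ℚ ≤ simplexVolume d r
simplexVolume-nonNeg d 0≤r = *-nonNeg (^-nonNeg d 0≤r) (ℚ.<⇒≤ (recip-pos (0<d! d)))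

simplexVolume-mono : ∀ d {r s} → 0ℚ ≤ r → r ≤ s → simplexVolume d r ≤ simplexVolume d s
simplexVolume-mono d 0≤r r≤s =
  *-monoʳ-≤ (recip (fromNat (d !))) (ℚ.<⇒≤ (recip-pos (0<d! d))) (^-mono-≤ d 0≤r r≤s)

simplexVolume-zero : ∀ d → simplexVolume (suc d) 0ℚ ≡ 0ℚ
simplexVolume-zero d = eq (0ℚ ^ d) (recip (fromNat (suc d !)))
  where
  eq : ∀ x y → 0ℚ * x * y ≡ 0ℚ
  eq = solve-∀ ℚ-ring

module _ (d : ℕ) {s δ : ℚ} (0≤s : 0ℚ ≤ s) (0≤δ : 0ℚ ≤ δ) where
  private
    ρ = recip (fromNat (suc d !))
    0≤ρ : 0ℚ ≤ ρ
    0≤ρ = ℚ.<⇒≤ (recip-pos (0<d! (suc d)))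

    rescale : ∀ x → fromNat (suc d) * (δ * x) * ρ ≡ δ * (x * recip (fromNat (d !)))
    rescale x = trans (eq (fromNat (suc d)) δ x ρ) (cong (λ z → δ * (x * z)) (recip-!-suc d))
      where
      eq : ∀ c δ x ρ → c * (δ * x) * ρ ≡ δ * (x * (c * ρ))
      eq = solve-∀ ℚ-ring

  -- Geometrically, a slice between parallel sections of sizes `s` and `s + δ` contains the prism
  -- over the smaller section and, for the upper estimate, lies in the prism over the larger one.
  -- Stated for the formula of the volume, the estimates make sums over slices telescope.
  simplexVolume-increment-lower :
    δ * simplexVolume d s + simplexVolume (suc d) s ≤ simplexVolume (suc d) (s + δ)
  simplexVolume-increment-lower = ≤-resp
    (subst (_≤ ((s + δ) ^ suc d - s ^ suc d) * ρ) (rescale (s ^ d))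
      (*-monoʳ-≤ ρ 0≤ρ (^-increment-lower 0≤s 0≤δ d)))
    (eq ((s + δ) ^ suc d) (s ^ suc d) ρ (δ * simplexVolume d s))
    where
    eq : ∀ p q ρ x → (p - q) * ρ - x ≡ p * ρ - (x + q * ρ)
    eq = solve-∀ ℚ-ring

  simplexVolume-increment-upper :
    simplexVolume (suc d) (s + δ) ≤ δ * simplexVolume d (s + δ) + simplexVolume (suc d) s
  simplexVolume-increment-upper = ≤-resp
    (subst (((s + δ) ^ suc d - s ^ suc d) * ρ ≤_) (rescale ((s + δ) ^ d))
      (*-monoʳ-≤ ρ 0≤ρ (^-increment-upper 0≤s 0≤δ d)))
    (eq ((s + δ) ^ suc d) (s ^ suc d) ρ (δ * simplexVolume d (s + δ)))
    where
    eq : ∀ p q ρ x → x - (p - q) * ρ ≡ (x + q * ρ) - p * ρ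
    eq = solve-∀ ℚ-ring

Simplex : (d : ℕ) → ℚ → Subset d
Simplex d r x = (∀ i → 0ℚ ≤ x i) × sum x ≤ r

simplex-mono : ∀ {r s} → r ≤ s → Simplex d r ⊆ Simplex d s
simplex-mono r≤s (0≤x , ≤r) = 0≤x , ℚ.≤-trans ≤r r≤s

-- The simplex of size r with its vertex moved to (a, 0, …, 0).
Tower : (d : ℕ) → ℚ → ℚ → Subset (suc d)
Tower d a r x = a ≤ x zero × Simplex d (r - (x zero - a)) (x ∘ suc)

module _ (d : ℕ) (content : ∀ r → 0ℚ ≤ r → Content (Simplex d r) (simplexVolume d r))
         {δ : ℚ} (0<δ : 0ℚ < δ) where
  private
    0≤δ = ℚ.<⇒≤ 0<δ

    multiple-suc : ∀ k → fromNat k * δ + δ ≡ fromNat (suc k) * δ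
    multiple-suc k = trans (eq (fromNat k) δ) (cong (_* δ) (sym (fromNat-suc k)))
      where
      eq : ∀ k δ → k * δ + δ ≡ (1ℚ + k) * δ
      eq = solve-∀ ℚ-ring

    multiple-nonNeg : ∀ k → 0ℚ ≤ fromNat k * δ
    multiple-nonNeg k = *-nonNeg (fromNat-nonNeg k) 0≤δ

    a≤a+δ : ∀ a → a ≤ a + δ
    a≤a+δ a = ≤-from δ (eq a δ) 0≤δ
      where
      eq : ∀ a δ → a + δ - a ≡ δ
      eq = solve-∀ ℚ-ring

    width : ∀ a v → (a + δ - a) * v ≡ δ * v
    width a v = eq a δ v
      where
      eq : ∀ a δ v → (a + δ - a) * v ≡ δ * v
      eq = solve-∀ ℚ-ring

    shift : ∀ a r x → r - (x - (a + δ)) ≡ r + δ - (x - a)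
    shift a r x = eq a r x δ
      where
      eq : ∀ a r x δ → r - (x - (a + δ)) ≡ r + δ - (x - a)
      eq = solve-∀ ℚ-ring

  inner-tower-step : ∀ {a r} → 0ℚ ≤ r → Inner (Tower d (a + δ) (r + δ)) (simplexVolume (suc d) r) →
                     Inner (Tower d a (r + δ + δ)) (simplexVolume (suc d) (r + δ))
  inner-tower-step {a} {r} 0≤r inner = inner-mono id
    (simplexVolume-increment-upper d 0≤r 0≤δ)
    (inner-⊎ {U = Tower d a (r + δ + δ)} (λ {x} → first {x}) (λ {x} → rest {x}) (λ (((_ , x<) , _) , (≤x , _)) → ≤⇒≯ ≤x x<)
      (subst (Inner _) (width a _)
        (inner-slab (simplexVolume-nonNeg d 0≤r+δ) (proj₁ (content (r + δ) 0≤r+δ))))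
      inner)
    where
    0≤r+δ = +-nonNeg 0≤r 0≤δ
    first : Slab a (a + δ) (Simplex d (r + δ)) ⊆ Tower d a (r + δ + δ)
    first {x} ((a≤x₀ , x₀<) , x∈) = a≤x₀ ,
      simplex-mono (≤-resp (ℚ.<⇒≤ x₀<) (eq (x zero) a δ r)) x∈
      where
      eq : ∀ x a δ r → a + δ - x ≡ r + δ + δ - (x - a) - (r + δ)
      eq = solve-∀ ℚ-ring
    rest : Tower d (a + δ) (r + δ) ⊆ Tower d a (r + δ + δ)
    rest {x} (≤x₀ , x∈) = ℚ.≤-trans (a≤a+δ a) ≤x₀ ,
      simplex-mono (ℚ.≤-reflexive (shift a (r + δ) (x zero))) x∈

  -- A shift by one slice replaces a summation of powers. The prisms inscribed in the tower of size
  -- `(k + 1) δ` are circumscribed about the slices of the simplex of size `k δ`, so their total is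
  -- at least its volume. In `outer-tower` the prisms circumscribed about size `k δ` are those
  -- inscribed in size `(k + 1) δ`.
  inner-tower : ∀ k a → Inner (Tower d a (fromNat k * δ + δ)) (simplexVolume (suc d) (fromNat k * δ))
  inner-tower zero    a = inner-nonPos (ℚ.≤-reflexive
    (trans (cong (simplexVolume (suc d)) (ℚ.*-zeroˡ δ)) (simplexVolume-zero d)))
  inner-tower (suc k) a = subst (λ r → Inner (Tower d a (r + δ)) (simplexVolume (suc d) r))
    (multiple-suc k) (inner-tower-step (multiple-nonNeg k) (inner-tower k (a + δ)))

  -- A half-open interval of width 0 is empty, so even the single value `x zero = a` costs a slab of
  -- width `δ`.
  outer-tower-zero : ∀ a → Outer (Tower d a 0ℚ) (simplexVolume (suc d) (0ℚ + δ))
  outer-tower-zero a = outer-mono (λ {x} → flat {x}) value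
    (subst (Outer _) (width a _) (outer-slab (a≤a+δ a) (proj₂ (content 0ℚ ℚ.≤-refl))))
    where
    value : δ * simplexVolume d 0ℚ ≤ simplexVolume (suc d) (0ℚ + δ)
    value = subst (_≤ simplexVolume (suc d) (0ℚ + δ))
      (trans (cong (δ * simplexVolume d 0ℚ +_) (simplexVolume-zero d)) (ℚ.+-identityʳ _))
      (simplexVolume-increment-lower d ℚ.≤-refl 0≤δ)
    flat : Tower d a 0ℚ ⊆ Slab a (a + δ) (Simplex d 0ℚ)
    flat {x} (a≤x₀ , 0≤x , ∑≤) =
      (a≤x₀ , ℚ.≤-<-trans
        (≤-resp (ℚ.≤-trans (sum-nonNeg 0≤x) ∑≤) (eq₁ (x zero) a))
        (<-from δ (eq₂ a δ) 0<δ)) ,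
      0≤x , ℚ.≤-trans ∑≤ (≤-resp a≤x₀ (eq₃ (x zero) a))
      where
      eq₁ : ∀ x a → 0ℚ - (x - a) - 0ℚ ≡ a - x
      eq₁ = solve-∀ ℚ-ring
      eq₂ : ∀ a δ → a + δ - a ≡ δ
      eq₂ = solve-∀ ℚ-ring
      eq₃ : ∀ x a → x - a ≡ 0ℚ - (0ℚ - (x - a))
      eq₃ = solve-∀ ℚ-ring

  outer-tower-step : ∀ {a r} → 0ℚ ≤ r → Outer (Tower d (a + δ) r) (simplexVolume (suc d) (r + δ)) →
                     Outer (Tower d a (r + δ)) (simplexVolume (suc d) (r + δ + δ))
  outer-tower-step {a} {r} 0≤r outer = outer-mono id
    (simplexVolume-increment-lower d 0≤r+δ 0≤δ)
    (outer-∪ {U = Tower d a (r + δ)} (λ {x} → split {x})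
      (subst (Outer _) (width a _) (outer-slab (a≤a+δ a) (proj₂ (content (r + δ) 0≤r+δ))))
      outer)
    where
    0≤r+δ = +-nonNeg 0≤r 0≤δ
    split : Tower d a (r + δ) ⊆ Slab a (a + δ) (Simplex d (r + δ)) ∪ Tower d (a + δ) r
    split {x} (a≤x₀ , x∈) with x zero ℚ.<? a + δ
    ... | yes x₀< = inj₁ ((a≤x₀ , x₀<) , simplex-mono (≤-resp a≤x₀ (eq (x zero) a r δ)) x∈)
      where
      eq : ∀ x a r δ → x - a ≡ r + δ - (r + δ - (x - a))
      eq = solve-∀ ℚ-ring
    ... | no x₀≮ = inj₂ (ℚ.≮⇒≥ x₀≮ , simplex-mono (ℚ.≤-reflexive (sym (shift a r (x zero)))) x∈)

  outer-tower : ∀ k a → Outer (Tower d a (fromNat k * δ)) (simplexVolume (suc d) (fromNat k * δ + δ))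
  outer-tower zero    a = subst (λ r → Outer (Tower d a r) (simplexVolume (suc d) (r + δ)))
    (sym (ℚ.*-zeroˡ δ)) (outer-tower-zero a)
  outer-tower (suc k) a = subst (λ r → Outer (Tower d a r) (simplexVolume (suc d) (r + δ)))
    (multiple-suc k) (outer-tower-step (multiple-nonNeg k) (outer-tower k (a + δ)))

Tower-≐ : ∀ d r → Tower d 0ℚ r ≐ Simplex (suc d) r
Tower-≐ d r =
  (λ {x} (0≤x₀ , 0≤x , ∑≤) → (λ { zero → 0≤x₀ ; (suc i) → 0≤x i }) ,
    ≤-resp ∑≤ (eq r (x zero) (sum (x ∘ suc)))) ,
  (λ {x} (0≤x , ∑≤) → 0≤x zero , 0≤x ∘ suc , ≤-resp ∑≤ (sym (eq r (x zero) (sum (x ∘ suc)))))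
  where
  eq : ∀ r x s → r - (x - 0ℚ) - s ≡ r - (x + s)
  eq = solve-∀ ℚ-ring

content-simplex : ∀ d r → 0ℚ ≤ r → Content (Simplex d r) (simplexVolume d r)
content-simplex zero    r 0≤r =
  inner-mono (λ _ → (λ ()) , 0≤r) ℚ.≤-refl (inner-box point) ,
  outer-mono (λ _ ()) ℚ.≤-refl (outer-box point)
  where
  point : Box 0
  point = record { lower = λ () ; upper = λ () ; lower≤upper = λ () }
content-simplex (suc d) r 0≤r = content-≐ (Tower-≐ d r)
  (inner-limit (simplexVolume d r) (simplexVolume-nonNeg d 0≤r) innerStep ,
   outer-limit (simplexVolume d (r + 1ℚ)) (simplexVolume-nonNeg d (+-nonNeg 0≤r 0≤1)) outerStep)
  where
  innerStep : ∀ η → 0ℚ < η → η ≤ 1ℚ →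
              Inner (Tower d 0ℚ r) (simplexVolume (suc d) r - simplexVolume d r * η)
  innerStep η 0<η _ with subdivide r η 0≤r 0<η
  ... | zero  , δ , 0<δ , δ≤η , refl = inner-nonPos (≤-from _
    (trans (cong (λ z → 0ℚ - (z - c)) (trans (cong (simplexVolume (suc d)) (ℚ.*-zeroˡ δ)) (simplexVolume-zero d))) (eq c))
    (*-nonNeg (simplexVolume-nonNeg d 0≤r) (ℚ.<⇒≤ 0<η)))
    where
    c = simplexVolume d (0ℚ * δ) * η
    eq : ∀ c → 0ℚ - (0ℚ - c) ≡ c
    eq = solve-∀ ℚ-ring
  -- The packing reaches only the volume of size `k δ = r − δ`; by `simplexVolume-increment-upper`
  -- this loses at most `δ * simplexVolume d r`.
  ... | suc k , δ , 0<δ , δ≤η , kδ+δ≡r = inner-mono id value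
    (subst (λ r → Inner (Tower d 0ℚ r) _) s+δ≡r (inner-tower d (content-simplex d) 0<δ k 0ℚ))
    where
    s = fromNat k * δ
    s+δ≡r : s + δ ≡ r
    s+δ≡r = trans (trans (eq′ (fromNat k) δ) (cong (_* δ) (sym (fromNat-suc k)))) kδ+δ≡r
      where
      eq′ : ∀ k δ → k * δ + δ ≡ (1ℚ + k) * δ
      eq′ = solve-∀ ℚ-ring
    upper : simplexVolume (suc d) r ≤ δ * simplexVolume d r + simplexVolume (suc d) s
    upper = subst (λ r → simplexVolume (suc d) r ≤ δ * simplexVolume d r + simplexVolume (suc d) s) s+δ≡r
      (simplexVolume-increment-upper d (*-nonNeg (fromNat-nonNeg k) (ℚ.<⇒≤ 0<δ)) (ℚ.<⇒≤ 0<δ))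
    eq : ∀ δ v w u η → (δ * v + w - u) + v * (η - δ) ≡ w - (u - v * η)
    eq = solve-∀ ℚ-ring
    value : simplexVolume (suc d) r - simplexVolume d r * η ≤ simplexVolume (suc d) s
    value = ≤-from _
      (sym (eq δ (simplexVolume d r) (simplexVolume (suc d) s) (simplexVolume (suc d) r) η))
      (+-nonNeg (p≤q⇒0≤q-p upper) (*-nonNeg (simplexVolume-nonNeg d 0≤r) (p≤q⇒0≤q-p δ≤η)))

  outerStep : ∀ η → 0ℚ < η → η ≤ 1ℚ →
              Outer (Tower d 0ℚ r) (simplexVolume (suc d) r + simplexVolume d (r + 1ℚ) * η)
  outerStep η 0<η η≤1 with N , δ , 0<δ , δ≤η , Nδ≡r ← subdivide r η 0≤r 0<η =
    outer-mono id value
      (subst (λ r → Outer (Tower d 0ℚ r) (simplexVolume (suc d) (r + δ))) Nδ≡r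
        (outer-tower d (content-simplex d) 0<δ N 0ℚ))
    where
    value : simplexVolume (suc d) (r + δ) ≤ simplexVolume (suc d) r + simplexVolume d (r + 1ℚ) * η
    value = ℚ.≤-trans (simplexVolume-increment-upper d 0≤r (ℚ.<⇒≤ 0<δ))
      (subst (_≤ simplexVolume (suc d) r + simplexVolume d (r + 1ℚ) * η)
        (trans (ℚ.+-comm (simplexVolume (suc d) r) (simplexVolume d (r + δ) * δ)) (cong (_+ simplexVolume (suc d) r) (ℚ.*-comm (simplexVolume d (r + δ)) δ)))
        (ℚ.+-monoʳ-≤ (simplexVolume (suc d) r)
          (*-mono-≤ (ℚ.<⇒≤ 0<δ) (simplexVolume-nonNeg d (+-nonNeg 0≤r 0≤1))
            (simplexVolume-mono d (+-nonNeg 0≤r (ℚ.<⇒≤ 0<δ)) (ℚ.+-monoʳ-≤ r (ℚ.≤-trans δ≤η η≤1)))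
            δ≤η)))

-- Linear algebra

⟨⟩-cong : ∀ {u v x y : Point d} → u ≗ v → x ≗ y → ⟨ u , x ⟩ ≡ ⟨ v , y ⟩
⟨⟩-cong u≗v x≗y = sum-cong-≗ λ i → cong₂ _*_ (u≗v i) (x≗y i)

⟨⟩-comm : ∀ (u v : Point d) → ⟨ u , v ⟩ ≡ ⟨ v , u ⟩
⟨⟩-comm u v = sum-cong-≗ λ i → ℚ.*-comm (u i) (v i)

⟨⟩-+ : ∀ (u v x : Point d) → ⟨ (λ i → u i + v i) , x ⟩ ≡ ⟨ u , x ⟩ + ⟨ v , x ⟩
⟨⟩-+ u v x = trans (sum-cong-≗ λ i → ℚ.*-distribʳ-+ (x i) (u i) (v i))
  (∑-distrib-+ (λ i → u i * x i) (λ i → v i * x i))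

⟨⟩-* : ∀ c (u x : Point d) → ⟨ (λ i → c * u i) , x ⟩ ≡ c * ⟨ u , x ⟩
⟨⟩-* c u x = trans (sum-cong-≗ λ i → ℚ.*-assoc c (u i) (x i))
  (sym (*-distribˡ-sum c (λ i → u i * x i)))

⟨⟩-sum : ∀ (c : Point n) (V : Vector (Point d) n) x →
         ⟨ (λ k → sum (λ i → c i * V i k)) , x ⟩ ≡ sum (λ i → c i * ⟨ V i , x ⟩)
⟨⟩-sum c V x = begin
  sum (λ k → sum (λ i → c i * V i k) * x k)  ≡⟨ sum-cong-≗ (λ k → *-distribʳ-sum (x k) (λ i → c i * V i k)) ⟩
  sum (λ k → sum (λ i → c i * V i k * x k))  ≡⟨ ∑-comm (λ k i → c i * V i k * x k) ⟩
  sum (λ i → sum (λ k → c i * V i k * x k))  ≡⟨ sum-cong-≗ (λ i → ⟨⟩-* (c i) (V i) x) ⟩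
  sum (λ i → c i * ⟨ V i , x ⟩)  ∎
  where open ≡-Reasoning

⟨⟩-zeroʳ : ∀ (u : Point d) → ⟨ u , (λ _ → 0ℚ) ⟩ ≡ 0ℚ
⟨⟩-zeroʳ {d} u = trans (sum-cong-≗ λ i → ℚ.*-zeroʳ (u i)) (sum-replicate-zero d)

⟨⟩-zeroˡ : ∀ (u : Point d) → ⟨ (λ _ → 0ℚ) , u ⟩ ≡ 0ℚ
⟨⟩-zeroˡ u = trans (⟨⟩-comm _ u) (⟨⟩-zeroʳ u)

identity-suc : ∀ (i j : Fin n) → identity (suc i) (suc j) ≡ identity i j
identity-suc i j with i ≟ᶠ j
... | yes refl = refl
... | no  _    = refl

⟨⟩-identityˡ : ∀ i (x : Point d) → ⟨ identity i , x ⟩ ≡ x i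
⟨⟩-identityˡ zero    x = trans (cong (1ℚ * x zero +_) (⟨⟩-zeroˡ (x ∘ suc))) (eq (x zero))
  where
  eq : ∀ x → 1ℚ * x + 0ℚ ≡ x
  eq = solve-∀ ℚ-ring
⟨⟩-identityˡ (suc i) x = trans
  (cong (0ℚ * x zero +_) (trans (⟨⟩-cong (identity-suc i) (λ _ → refl)) (⟨⟩-identityˡ i (x ∘ suc))))
  (eq (x zero) (x (suc i)))
  where
  eq : ∀ x y → 0ℚ * x + y ≡ y
  eq = solve-∀ ℚ-ring

⟨⟩-identityʳ : ∀ (x : Point d) i → ⟨ x , identity i ⟩ ≡ x i
⟨⟩-identityʳ x i = trans (⟨⟩-comm x (identity i)) (⟨⟩-identityˡ i x)

-- Linear automorphisms which scale the content

record Bijection (f g : Point d → Point d) (m n : ℚ) : Set where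
  field
    f-cong   : ∀ {x y} → x ≗ y → f x ≗ f y
    g-cong   : ∀ {x y} → x ≗ y → g x ≗ g y
    f∘g      : ∀ x → f (g x) ≗ x
    g∘f      : ∀ x → g (f x) ≗ x
    scalingᶠ : Scaling f n
    scalingᵍ : Scaling g m

open Bijection

bijection-∘ : ∀ {f g f′ g′ : Point d → Point d} {m n m′ n′} →
              Bijection f g m n → Bijection f′ g′ m′ n′ → Bijection (f ∘ f′) (g′ ∘ g) (m * m′) (n * n′)
bijection-∘ {f = f} {g} {f′} {g′} {m = m} {m′ = m′} B B′ = record
  { f-cong   = f-cong B ∘ f-cong B′
  ; g-cong   = g-cong B′ ∘ g-cong B
  ; f∘g      = λ x i → trans (f-cong B (f∘g B′ (g x)) i) (f∘g B x i)
  ; g∘f      = λ x i → trans (g-cong B′ (g∘f B (f′ x)) i) (g∘f B′ x i)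
  ; scalingᶠ = scaling-∘ (scalingᶠ B) (scalingᶠ B′)
  ; scalingᵍ = scaling-cong (λ _ _ → refl) (ℚ.*-comm m′ m) (scaling-∘ (scalingᵍ B′) (scalingᵍ B))
  }

-- The scaling factors refer to preimages: det scales the preimage under inv, codet the one under fwd.
record Aut (d : ℕ) : Set where
  field
    fwd inv tr cotr : Point d → Point d
    det codet       : ℚ
    det*codet       : det * codet ≡ 1ℚ
    forward         : Bijection fwd inv det codet
    transposed      : Bijection tr cotr det codet
    adjoint         : ∀ x y → ⟨ tr x , y ⟩ ≡ ⟨ x , fwd y ⟩

open Aut

infixr 9 _∘ᴬ_
_∘ᴬ_ : Aut d → Aut d → Aut d
A ∘ᴬ B = record
  { fwd        = fwd A ∘ fwd B
  ; inv        = inv B ∘ inv A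
  ; tr         = tr B ∘ tr A
  ; cotr       = cotr A ∘ cotr B
  ; det        = det A * det B
  ; codet      = codet A * codet B
  ; det*codet  = trans (eq (det A) (det B) (codet A) (codet B))
                   (cong₂ _*_ (det*codet A) (det*codet B))
  ; forward    = bijection-∘ (forward A) (forward B)
  ; transposed = subst₂ (Bijection _ _) (ℚ.*-comm (det B) (det A)) (ℚ.*-comm (codet B) (codet A))
                   (bijection-∘ (transposed B) (transposed A))
  ; adjoint    = λ x y → trans (adjoint B (tr A x) y) (adjoint A x (fwd B y))
  }
  where
  eq : ∀ a b c d → a * b * (c * d) ≡ (a * c) * (b * d)
  eq = solve-∀ ℚ-ring

transposeᴬ : Aut d → Aut d
transposeᴬ A = record
  { fwd        = tr A
  ; inv        = cotr A
  ; tr         = fwd A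
  ; cotr       = inv A
  ; det        = det A
  ; codet      = codet A
  ; det*codet  = det*codet A
  ; forward    = transposed A
  ; transposed = forward A
  ; adjoint    = λ x y → trans (⟨⟩-comm (fwd A x) y) (trans (sym (adjoint A y x)) (⟨⟩-comm (tr A y) x))
  }

identityᴬ : Aut d
identityᴬ = record
  { fwd = id ; inv = id ; tr = id ; cotr = id
  ; det = 1ℚ ; codet = 1ℚ ; det*codet = refl
  ; forward = bijection ; transposed = bijection
  ; adjoint = λ _ _ → refl
  }
  where
  scaling : Scaling id 1ℚ
  scaling = record
    { factor-pos = 0<1
    ; innerBox   = λ b → subst (Inner _) (sym (ℚ.*-identityˡ _)) (inner-box b)
    ; outerBox   = λ b → subst (Outer _) (sym (ℚ.*-identityˡ _)) (outer-box b)
    }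
  bijection : Bijection id id 1ℚ 1ℚ
  bijection = record
    { f-cong = id ; g-cong = id ; f∘g = λ _ _ → refl ; g∘f = λ _ _ → refl
    ; scalingᶠ = scaling ; scalingᵍ = scaling
    }

swap-bijection : Bijection (swap {d}) swap 1ℚ 1ℚ
swap-bijection = record
  { f-cong = swap-cong ; g-cong = swap-cong
  ; f∘g = swap-involutive ; g∘f = swap-involutive
  ; scalingᶠ = scaling-swap ; scalingᵍ = scaling-swap
  }
  where
  swap-cong : ∀ {x y : Point (suc (suc d))} → x ≗ y → swap x ≗ swap y
  swap-cong x≗y zero          = x≗y (suc zero)
  swap-cong x≗y (suc zero)    = x≗y zero
  swap-cong x≗y (suc (suc i)) = x≗y (suc (suc i))
  swap-involutive : ∀ (x : Point (suc (suc d))) → swap (swap x) ≗ x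
  swap-involutive x zero          = refl
  swap-involutive x (suc zero)    = refl
  swap-involutive x (suc (suc i)) = refl

swapᴬ : Aut (suc (suc d))
swapᴬ = record
  { fwd = swap ; inv = swap ; tr = swap ; cotr = swap
  ; det = 1ℚ ; codet = 1ℚ ; det*codet = refl
  ; forward = swap-bijection ; transposed = swap-bijection
  ; adjoint = λ x y → eq (x (suc zero) * y zero) (x zero * y (suc zero)) _
  }
  where
  eq : ∀ a b c → a + (b + c) ≡ b + (a + c)
  eq = solve-∀ ℚ-ring

shear-bijection : ∀ k → Bijection (shear {d} k) (shear (- k)) 1ℚ 1ℚ
shear-bijection k = record
  { f-cong = shear-cong k ; g-cong = shear-cong (- k)
  ; f∘g = cancel′ ; g∘f = cancel
  ; scalingᶠ = scaling-shear k ; scalingᵍ = scaling-shear (- k)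
  }
  where
  shear-cong : ∀ k {x y : Point (suc (suc d))} → x ≗ y → shear k x ≗ shear k y
  shear-cong k x≗y zero          = x≗y zero
  shear-cong k x≗y (suc zero)    = cong₂ (λ a b → a + k * b) (x≗y (suc zero)) (x≗y zero)
  shear-cong k x≗y (suc (suc i)) = x≗y (suc (suc i))
  eq : ∀ k a b → a + k * b + - k * b ≡ a
  eq = solve-∀ ℚ-ring
  eq′ : ∀ k a b → a + - k * b + k * b ≡ a
  eq′ = solve-∀ ℚ-ring
  cancel : ∀ (x : Point (suc (suc d))) → shear (- k) (shear k x) ≗ x
  cancel x zero          = refl
  cancel x (suc zero)    = eq k (x (suc zero)) (x zero)
  cancel x (suc (suc i)) = refl
  cancel′ : ∀ (x : Point (suc (suc d))) → shear k (shear (- k) x) ≗ x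
  cancel′ x zero          = refl
  cancel′ x (suc zero)    = eq′ k (x (suc zero)) (x zero)
  cancel′ x (suc (suc i)) = refl

shearᴬ : ℚ → Aut (suc (suc d))
shearᴬ k = record
  { fwd        = shear k
  ; inv        = shear (- k)
  ; tr         = swap ∘ shear k ∘ swap
  ; cotr       = swap ∘ shear (- k) ∘ swap
  ; det        = 1ℚ
  ; codet      = 1ℚ
  ; det*codet  = refl
  ; forward    = shear-bijection k
  ; transposed = bijection-∘ (bijection-∘ swap-bijection (shear-bijection k)) swap-bijection
  ; adjoint    = λ x y → eq (x zero) (x (suc zero)) (y zero) (y (suc zero)) k _
  }
  where
  eq : ∀ a b c d k s → (a + k * b) * c + (b * d + s) ≡ a * c + (b * (d + k * c) + s)
  eq = solve-∀ ℚ-ring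

lift-bijection : ∀ {f g : Point d → Point d} {m n} → Bijection f g m n → Bijection (lift f) (lift g) m n
lift-bijection B = record
  { f-cong   = λ { x≗y zero → x≗y zero ; x≗y (suc i) → f-cong B (x≗y ∘ suc) i }
  ; g-cong   = λ { x≗y zero → x≗y zero ; x≗y (suc i) → g-cong B (x≗y ∘ suc) i }
  ; f∘g      = λ { x zero → refl ; x (suc i) → f∘g B (x ∘ suc) i }
  ; g∘f      = λ { x zero → refl ; x (suc i) → g∘f B (x ∘ suc) i }
  ; scalingᶠ = scaling-lift (scalingᶠ B)
  ; scalingᵍ = scaling-lift (scalingᵍ B)
  }

liftᴬ : Aut d → Aut (suc d)
liftᴬ A = record
  { fwd        = lift (fwd A)
  ; inv        = lift (inv A)
  ; tr         = lift (tr A)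
  ; cotr       = lift (cotr A)
  ; det        = det A
  ; codet      = codet A
  ; det*codet  = det*codet A
  ; forward    = lift-bijection (forward A)
  ; transposed = lift-bijection (transposed A)
  ; adjoint    = λ x y → cong (x zero * y zero +_) (adjoint A (x ∘ suc) (y ∘ suc))
  }

scale₀ : ℚ → Point (suc d) → Point (suc d)
scale₀ a x = (a * x zero) V.∷ (x ∘ suc)

scaling-scale₀-pos : ∀ {a} → 0ℚ < a → Scaling (scale₀ {d} a) (recip a)
scaling-scale₀-pos {d} {a} 0<a = scaling-cong {h = affine β (λ _ → 0ℚ)}
  (λ { x zero → ℚ.+-identityʳ (a * x zero) ; x (suc i) → eq (x (suc i)) })
  (trans (cong (recip a *_) (product-recip-one d)) (ℚ.*-identityʳ (recip a)))
  (scaling-affine {β = β} (λ _ → 0ℚ) λ { zero → 0<a ; (suc i) → 0<1 })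
  where
  β : Point (suc d)
  β = a V.∷ (λ _ → 1ℚ)
  eq : ∀ x → 1ℚ * x + 0ℚ ≡ x
  eq = solve-∀ ℚ-ring

scaling-scale₀ : ∀ {a} → a ≢ 0ℚ → Scaling (scale₀ {d} a) (recip ∣ a ∣)
scaling-scale₀ {d} {a} a≢0 with ℚ.≤-total 0ℚ a
... | inj₁ 0≤a = subst (Scaling (scale₀ a) ∘ recip) (sym (ℚ.0≤p⇒∣p∣≡p 0≤a))
  (scaling-scale₀-pos (ℚ.≰⇒> (a≢0 ∘ flip ℚ.≤-antisym 0≤a)))
... | inj₂ a≤0 = scaling-cong (λ { x zero → eq a (x zero) ; x (suc i) → refl })
  (trans (ℚ.*-identityˡ _) (cong recip (sym ∣a∣≡-a)))
  (scaling-∘ scaling-negate₀ (scaling-scale₀-pos 0<-a))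
  where
  eq : ∀ a x → - (- a * x) ≡ a * x
  eq = solve-∀ ℚ-ring
  ∣a∣≡-a : ∣ a ∣ ≡ - a
  ∣a∣≡-a = trans (sym (ℚ.∣-p∣≡∣p∣ a)) (ℚ.0≤p⇒∣p∣≡p (ℚ.neg-antimono-≤ a≤0))
  0<-a : 0ℚ < - a
  0<-a = ℚ.neg-antimono-< (ℚ.≰⇒> (a≢0 ∘ ℚ.≤-antisym a≤0))

module _ {a : ℚ} (a≢0 : a ≢ 0ℚ) where
  private
    recip-≢0 : recip a ≢ 0ℚ
    recip-≢0 eq = ℚ.1≢0 (trans (sym (*-recip a≢0)) (trans (cong (a *_) eq) (ℚ.*-zeroʳ a)))

    ∣a∣*∣recip∣ : ∣ recip a ∣ * ∣ a ∣ ≡ 1ℚ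
    ∣a∣*∣recip∣ = trans (sym (ℚ.∣p*q∣≡∣p∣*∣q∣ (recip a) a))
      (cong ∣_∣ (trans (ℚ.*-comm (recip a) a) (*-recip a≢0)))

    scale-bijection : Bijection (scale₀ {d} a) (scale₀ (recip a)) ∣ a ∣ (recip ∣ a ∣)
    scale-bijection = record
      { f-cong   = λ { x≗y zero → cong (a *_) (x≗y zero) ; x≗y (suc i) → x≗y (suc i) }
      ; g-cong   = λ { x≗y zero → cong (recip a *_) (x≗y zero) ; x≗y (suc i) → x≗y (suc i) }
      ; f∘g      = λ { x zero → trans (eq a (recip a) (x zero)) (cancel (x zero)) ; x (suc i) → refl }
      ; g∘f      = λ { x zero → trans (eq′ a (recip a) (x zero)) (cancel (x zero)) ; x (suc i) → refl }
      ; scalingᶠ = scaling-scale₀ a≢0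
      ; scalingᵍ = subst (Scaling _) (sym (recip-unique {∣ recip a ∣} ∣a∣*∣recip∣)) (scaling-scale₀ recip-≢0)
      }
      where
      eq : ∀ a r x → a * (r * x) ≡ a * r * x
      eq = solve-∀ ℚ-ring
      eq′ : ∀ a r x → r * (a * x) ≡ a * r * x
      eq′ = solve-∀ ℚ-ring
      cancel : ∀ x → a * recip a * x ≡ x
      cancel x = trans (cong (_* x) (*-recip a≢0)) (ℚ.*-identityˡ x)

  scaleᴬ : Aut (suc d)
  scaleᴬ = record
    { fwd        = scale₀ a
    ; inv        = scale₀ (recip a)
    ; tr         = scale₀ a
    ; cotr       = scale₀ (recip a)
    ; det        = ∣ a ∣
    ; codet      = recip ∣ a ∣
    ; det*codet  = *-recip λ ∣a∣≡0 → a≢0 (ℚ.∣p∣≡0⇒p≡0 a ∣a∣≡0)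
    ; forward    = scale-bijection
    ; transposed = scale-bijection
    ; adjoint    = λ x y → cong (_+ ⟨ x ∘ suc , y ∘ suc ⟩) (eq a (x zero) (y zero))
    }
    where
    eq : ∀ a x y → a * x * y ≡ x * (a * y)
    eq = solve-∀ ℚ-ring

-- The matrix that adds `c i` times coordinate 0 to coordinate `suc i`. The swaps carry coordinate 0
-- past its neighbour, so that the recursive call under `liftᴬ` finds it in first place.
columnShear : Point d → Aut (suc d)
columnShear {zero}  c = identityᴬ
columnShear {suc d} c = shearᴬ (c zero) ∘ᴬ swapᴬ ∘ᴬ liftᴬ (columnShear (c ∘ suc)) ∘ᴬ swapᴬ

columnShear-zero : ∀ (c : Point d) x → fwd (columnShear c) x zero ≡ x zero
columnShear-zero {zero}  c x = refl
columnShear-zero {suc d} c x = columnShear-zero (c ∘ suc) (swap x ∘ suc)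

columnShear-suc : ∀ (c : Point d) x i → fwd (columnShear c) x (suc i) ≡ x (suc i) + c i * x zero
columnShear-suc {suc d} c x zero    =
  cong (λ z → x (suc zero) + c zero * z) (columnShear-zero (c ∘ suc) (swap x ∘ suc))
columnShear-suc {suc d} c x (suc i) = columnShear-suc (c ∘ suc) (swap x ∘ suc) i

rowShear : Point d → Aut (suc d)
rowShear c = transposeᴬ (columnShear c)

rowShear-zero : ∀ (c : Point d) x → fwd (rowShear c) x zero ≡ x zero + ⟨ c , x ∘ suc ⟩
rowShear-zero {zero}  c x = sym (ℚ.+-identityʳ (x zero))
rowShear-zero {suc d} c x =
  trans (rowShear-zero (c ∘ suc) (swap (swap (shear (c zero) (swap x))) ∘ suc))
        (ℚ.+-assoc (x zero) (c zero * x (suc zero)) _)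

rowShear-suc : ∀ (c : Point d) x i → fwd (rowShear c) x (suc i) ≡ x (suc i)
rowShear-suc {suc d} c x zero    = refl
rowShear-suc {suc d} c x (suc i) =
  rowShear-suc (c ∘ suc) (swap (swap (shear (c zero) (swap x))) ∘ suc) i

-- Gaussian elimination into elementary automorphisms

TrivialKernel : Matrix ℚ d d → Set
TrivialKernel M = ∀ x → (∀ i → ⟨ M i , x ⟩ ≡ 0ℚ) → ∀ i → x i ≡ 0ℚ

private
  -- The corner is made nonzero by adding lower rows to the top row, not by exchanging rows, so that
  -- a single shape of factorisation covers all matrices. If the whole first column vanished, the
  -- first unit vector would lie in the kernel.
  pivot : ∀ (M : Matrix ℚ (suc d) (suc d)) → TrivialKernel M →
          ∃[ c ] M zero zero + sum (λ i → c i * M (suc i) zero) ≢ 0ℚ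
  pivot {d} M trivial with M zero zero ℚ.≟ 0ℚ
  ... | no M₀₀≢0 = (λ _ → 0ℚ) , λ eq → M₀₀≢0
    (trans (sym (trans (cong (M zero zero +_) (⟨⟩-zeroˡ (λ i → M (suc i) zero))) (ℚ.+-identityʳ _))) eq)
  ... | yes M₀₀≡0 with all? (λ i → M (suc i) zero ℚ.≟ 0ℚ)
  ...   | yes column≡0 = contradiction (trivial (identity zero) kernel zero) ℚ.1≢0
    where
    kernel : ∀ i → ⟨ M i , identity zero ⟩ ≡ 0ℚ
    kernel zero    = trans (⟨⟩-identityʳ (M zero) zero) M₀₀≡0
    kernel (suc i) = trans (⟨⟩-identityʳ (M (suc i)) zero) (column≡0 i)
  ...   | no column≢0 with i , Mᵢ₀≢0 ← ¬∀⟶∃¬ d (λ i → M (suc i) zero ≡ 0ℚ) (λ i → M (suc i) zero ℚ.≟ 0ℚ) column≢0 =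
    identity i , λ eq → Mᵢ₀≢0
      (trans (sym (trans (cong₂ _+_ M₀₀≡0 (⟨⟩-identityˡ i (λ i → M (suc i) zero))) (ℚ.+-identityˡ _))) eq)

module Elimination (M : Matrix ℚ (suc d) (suc d)) (c : Point d)
                   (a≢0 : M zero zero + sum (λ i → c i * M (suc i) zero) ≢ 0ℚ) where
  private
    b : Point (suc d)
    b j = M zero j + sum (λ i → c i * M (suc i) j)
    a = b zero
    r = b ∘ suc
    q : Point d
    q i = M (suc i) zero

  -- The Schur complement of the corner `a`, after the combination `c` of the lower rows has been
  -- added to the top row.
  reduced : Matrix ℚ d d
  reduced i j = M (suc i) (suc j) + (- (q i * recip a)) * r j

  private
    ⟨reduced⟩ : ∀ i x → ⟨ reduced i , x ⟩ ≡ ⟨ M (suc i) ∘ suc , x ⟩ + (- (q i * recip a)) * ⟨ r , x ⟩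
    ⟨reduced⟩ i x = trans (⟨⟩-+ (M (suc i) ∘ suc) (λ j → (- (q i * recip a)) * r j) x)
      (cong (⟨ M (suc i) ∘ suc , x ⟩ +_) (⟨⟩-* (- (q i * recip a)) r x))

    ⟨b⟩ : ∀ x → ⟨ b , x ⟩ ≡ ⟨ M zero , x ⟩ + sum (λ i → c i * ⟨ M (suc i) , x ⟩)
    ⟨b⟩ x = trans (⟨⟩-+ (M zero) (λ j → sum (λ i → c i * M (suc i) j)) x) (cong (⟨ M zero , x ⟩ +_) (⟨⟩-sum c (M ∘ suc) x))

  reduced-trivialKernel : TrivialKernel M → TrivialKernel reduced
  reduced-trivialKernel trivial x x∈kernel i = trivial x̂ kernel (suc i)
    where
    -- The solution of the pivot row `a * x₀ + ⟨ r , x ⟩ ≡ 0ℚ`.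
    x₀ = - (recip a * ⟨ r , x ⟩)
    x̂ : Point (suc d)
    x̂ = x₀ V.∷ x
    lower : ∀ i → ⟨ M (suc i) , x̂ ⟩ ≡ 0ℚ
    lower i = trans (eq (q i) (recip a) ⟨ r , x ⟩ ⟨ M (suc i) ∘ suc , x ⟩)
      (trans (sym (⟨reduced⟩ i x)) (x∈kernel i))
      where
      eq : ∀ q h r m → q * - (h * r) + m ≡ m + (- (q * h)) * r
      eq = solve-∀ ℚ-ring
    top : ⟨ b , x̂ ⟩ ≡ 0ℚ
    top = trans (eq a (recip a) ⟨ r , x ⟩) (trans (cong (λ z → (1ℚ - z) * ⟨ r , x ⟩) (*-recip a≢0)) (ℚ.*-zeroˡ ⟨ r , x ⟩))
      where
      eq : ∀ a h r → a * - (h * r) + r ≡ (1ℚ - a * h) * r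
      eq = solve-∀ ℚ-ring
    kernel : ∀ i → ⟨ M i , x̂ ⟩ ≡ 0ℚ
    kernel zero    = trans (sym (ℚ.+-identityʳ _)) (trans (cong (⟨ M zero , x̂ ⟩ +_)
      (sym (trans (sum-cong-≗ (λ i → trans (cong (c i *_) (lower i)) (ℚ.*-zeroʳ (c i)))) (sum-replicate-zero d))))
      (trans (sym (⟨b⟩ x̂)) top))
    kernel (suc i) = lower i

  module _ (A : Aut d) (fwd≗ : ∀ x → fwd A x ≗ λ i → ⟨ reduced i , x ⟩) where
    -- From right to left: the first coordinate becomes `⟨ b , x ⟩`, `A` applies the Schur
    -- complement to the others, the column shear turns these into `⟨ M (suc i) , x ⟩`, and the last
    -- shear takes the combination `c` off the top row again.
    extended : Aut (suc d)
    extended = rowShear (λ i → - c i) ∘ᴬ columnShear (λ i → q i * recip a) ∘ᴬ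
               liftᴬ A ∘ᴬ scaleᴬ a≢0 ∘ᴬ rowShear (λ j → recip a * r j)

    extended-fwd : ∀ x → fwd extended x ≗ λ i → ⟨ M i , x ⟩
    extended-fwd x = λ where
        zero → begin
          fwd (rowShear (λ i → - c i)) z zero  ≡⟨ rowShear-zero (λ i → - c i) z ⟩
          z zero + ⟨ (λ i → - c i) , z ∘ suc ⟩  ≡⟨ cong₂ _+_ (trans z-zero (⟨b⟩ x)) (⟨⟩-cong {u = λ i → - c i} (λ _ → refl) z-suc) ⟩
          ⟨ M zero , x ⟩ + C + ⟨ (λ i → - c i) , (λ i → ⟨ M (suc i) , x ⟩) ⟩  ≡⟨ cong (⟨ M zero , x ⟩ + C +_) (trans (⟨⟩-cong {x = λ i → ⟨ M (suc i) , x ⟩} (λ i → neg (c i)) (λ _ → refl)) (⟨⟩-* (- 1ℚ) c _)) ⟩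
          ⟨ M zero , x ⟩ + C + (- 1ℚ) * C  ≡⟨ cancel ⟨ M zero , x ⟩ C ⟩
          ⟨ M zero , x ⟩  ∎
        (suc i) → trans (rowShear-suc (λ i → - c i) z i) (z-suc i)
      where
      open ≡-Reasoning
      C = sum (λ i → c i * ⟨ M (suc i) , x ⟩)
      x′ = x ∘ suc
      y = fwd (scaleᴬ a≢0 ∘ᴬ rowShear (λ j → recip a * r j)) x
      z = fwd (columnShear (λ i → q i * recip a)) (lift (fwd A) y)
      neg : ∀ p → - p ≡ (- 1ℚ) * p
      neg = solve-∀ ℚ-ring
      cancel : ∀ m C → m + C + (- 1ℚ) * C ≡ m
      cancel = solve-∀ ℚ-ring
      y-zero : y zero ≡ ⟨ b , x ⟩
      y-zero = begin
        a * fwd (rowShear (λ j → recip a * r j)) x zero  ≡⟨ cong (a *_) (rowShear-zero (λ j → recip a * r j) x) ⟩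
        a * (x zero + ⟨ (λ j → recip a * r j) , x′ ⟩)  ≡⟨ cong (λ w → a * (x zero + w)) (⟨⟩-* (recip a) r x′) ⟩
        a * (x zero + recip a * ⟨ r , x′ ⟩)  ≡⟨ expand a (recip a) (x zero) ⟨ r , x′ ⟩ ⟩
        a * x zero + a * recip a * ⟨ r , x′ ⟩  ≡⟨ cong (λ w → a * x zero + w * ⟨ r , x′ ⟩) (*-recip a≢0) ⟩
        a * x zero + 1ℚ * ⟨ r , x′ ⟩  ≡⟨ cong (a * x zero +_) (ℚ.*-identityˡ _) ⟩
        ⟨ b , x ⟩  ∎
        where
        expand : ∀ a h x r → a * (x + h * r) ≡ a * x + a * h * r
        expand = solve-∀ ℚ-ring
      z-zero : z zero ≡ ⟨ b , x ⟩
      z-zero = trans (columnShear-zero (λ i → q i * recip a) (lift (fwd A) y)) y-zero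
      z-suc : ∀ i → z (suc i) ≡ ⟨ M (suc i) , x ⟩
      z-suc i = begin
        z (suc i)  ≡⟨ columnShear-suc (λ i → q i * recip a) (lift (fwd A) y) i ⟩
        fwd A (y ∘ suc) i + q i * recip a * y zero  ≡⟨ cong₂ (λ v w → v + q i * recip a * w) (trans (fwd≗ (y ∘ suc) i) (⟨⟩-cong {u = reduced i} (λ _ → refl) (rowShear-suc (λ j → recip a * r j) x))) y-zero ⟩
        ⟨ reduced i , x′ ⟩ + q i * recip a * (a * x zero + ⟨ r , x′ ⟩)  ≡⟨ cong (_+ q i * recip a * (a * x zero + ⟨ r , x′ ⟩)) (⟨reduced⟩ i x′) ⟩
        m + (- (q i * recip a)) * ⟨ r , x′ ⟩ + q i * recip a * (a * x zero + ⟨ r , x′ ⟩)  ≡⟨ collect m (q i) (recip a) ⟨ r , x′ ⟩ a (x zero) ⟩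
        q i * (a * recip a) * x zero + m  ≡⟨ cong (λ w → q i * w * x zero + m) (*-recip a≢0) ⟩
        q i * 1ℚ * x zero + m  ≡⟨ cong (λ w → w * x zero + m) (ℚ.*-identityʳ (q i)) ⟩
        ⟨ M (suc i) , x ⟩  ∎
        where
        m = ⟨ M (suc i) ∘ suc , x′ ⟩
        collect : ∀ m q h r a x → m + (- (q * h)) * r + q * h * (a * x + r) ≡ q * (a * h) * x + m
        collect = solve-∀ ℚ-ring

-- A trivial kernel is the form of invertibility that affine independence supplies, and it passes to
-- Schur complements.
matrix⇒Aut : ∀ (M : Matrix ℚ d d) → TrivialKernel M → Σ[ A ∈ Aut d ] ∀ x → fwd A x ≗ λ i → ⟨ M i , x ⟩
matrix⇒Aut {zero}  M trivial = identityᴬ , λ _ ()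
matrix⇒Aut {suc d} M trivial
  with c , a≢0 ← pivot M trivial
  with A , fwd≗ ← matrix⇒Aut (Elimination.reduced M c a≢0) (Elimination.reduced-trivialKernel M c a≢0 trivial) =
  Elimination.extended M c a≢0 A fwd≗ , Elimination.extended-fwd M c a≢0 A fwd≗

-- The inequality of arithmetic and geometric means

square-zero : ∀ p → p * p ≡ 0ℚ → p ≡ 0ℚ
square-zero p p*p≡0 with p ℚ.≟ 0ℚ
... | yes p≡0 = p≡0
... | no  p≢0 = *-cancelˡ-≡ p p≢0 (trans p*p≡0 (sym (ℚ.*-zeroʳ p)))

^-pos : ∀ {s} n → 0ℚ < s → 0ℚ < s ^ n
^-pos zero    0<s = 0<1
^-pos (suc n) 0<s = *-pos 0<s (^-pos n 0<s)

private
  -- The gap in Bernoulli's inequality for `(μ / ν) ^ suc n`, made homogeneous to avoid the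
  -- division.
  bernoulliGap : ℕ → ℚ → ℚ → ℚ
  bernoulliGap n ν μ = fromNat n * ν ^ suc n + μ ^ suc n - (1ℚ + fromNat n) * μ * ν ^ n

  bernoulliGap-suc : ∀ n ν μ → bernoulliGap (suc n) ν μ ≡
                     μ * bernoulliGap n ν μ + fromNat (suc n) * ν ^ n * ((ν - μ) * (ν - μ))
  bernoulliGap-suc n ν μ = subst (λ c → c * ν ^ suc (suc n) + μ ^ suc (suc n) - (1ℚ + c) * μ * ν ^ suc n ≡
                                        μ * bernoulliGap n ν μ + c * ν ^ n * ((ν - μ) * (ν - μ)))
    (sym (fromNat-suc n)) (eq (fromNat n) ν μ (ν ^ n) (μ ^ suc n))
    where
    eq : ∀ c ν μ p q → (1ℚ + c) * (ν * (ν * p)) + μ * q - (1ℚ + (1ℚ + c)) * μ * (ν * p) ≡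
                       μ * (c * (ν * p) + q - (1ℚ + c) * μ * p) + (1ℚ + c) * p * ((ν - μ) * (ν - μ))
    eq = solve-∀ ℚ-ring

  bernoulliGap-nonNeg : ∀ n {ν μ} → 0ℚ ≤ ν → 0ℚ ≤ μ → 0ℚ ≤ bernoulliGap n ν μ
  bernoulliGap-nonNeg zero    {ν} {μ} _ _ = ℚ.≤-reflexive (eq ν μ)
    where
    eq : ∀ ν μ → 0ℚ ≡ 0ℚ * (ν * 1ℚ) + μ * 1ℚ - (1ℚ + 0ℚ) * μ * 1ℚ
    eq = solve-∀ ℚ-ring
  bernoulliGap-nonNeg (suc n) {ν} {μ} 0≤ν 0≤μ = subst (0ℚ ≤_) (sym (bernoulliGap-suc n ν μ))
    (+-nonNeg (*-nonNeg 0≤μ (bernoulliGap-nonNeg n 0≤ν 0≤μ))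
      (*-nonNeg (*-nonNeg (fromNat-nonNeg (suc n)) (^-nonNeg n 0≤ν)) (0≤p*p (ν - μ))))

  bernoulliGap-zero : ∀ n {ν μ} → 0ℚ < ν → 0ℚ ≤ μ → bernoulliGap (suc n) ν μ ≡ 0ℚ → ν ≡ μ
  bernoulliGap-zero n {ν} {μ} 0<ν 0≤μ gap≡0 = trans (eq₁ ν μ) (trans (cong (_+ μ) ν-μ≡0) (ℚ.+-identityˡ μ))
    where
    eq₁ : ∀ ν μ → ν ≡ ν - μ + μ
    eq₁ = solve-∀ ℚ-ring
    c = fromNat (suc n) * ν ^ n
    0<c : 0ℚ < c
    0<c = *-pos (fromNat-pos (suc n) (ℕ.s≤s ℕ.z≤n)) (^-pos n 0<ν)
    eq₂ : ∀ x y → x + y - y ≡ x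
    eq₂ = solve-∀ ℚ-ring
    c□≤0 : c * ((ν - μ) * (ν - μ)) ≤ c * 0ℚ
    c□≤0 = subst (c * ((ν - μ) * (ν - μ)) ≤_) (sym (ℚ.*-zeroʳ c))
      (≤-from (μ * bernoulliGap n ν μ)
        (trans (cong (_- c * ((ν - μ) * (ν - μ))) (trans (sym gap≡0) (bernoulliGap-suc n ν μ)))
          (eq₂ (μ * bernoulliGap n ν μ) (c * ((ν - μ) * (ν - μ)))))
        (*-nonNeg 0≤μ (bernoulliGap-nonNeg n (ℚ.<⇒≤ 0<ν) 0≤μ)))
    ν-μ≡0 : ν - μ ≡ 0ℚ
    ν-μ≡0 = square-zero (ν - μ) (ℚ.≤-antisym (*-cancelˡ-≤ c 0<c c□≤0) (0≤p*p (ν - μ)))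

sum-pos : ∀ {z : Point (suc n)} → (∀ i → 0ℚ < z i) → 0ℚ < sum z
sum-pos 0<z = +-pos-nonNeg (0<z zero) (sum-nonNeg (ℚ.<⇒≤ ∘ 0<z ∘ suc))

product-pos : ∀ {z : Point n} → (∀ i → 0ℚ < z i) → 0ℚ < product z
product-pos {zero}  0<z = 0<1
product-pos {suc n} 0<z = *-pos (0<z zero) (product-pos (0<z ∘ suc))

-- A form without roots, hence meaningful over ℚ: `μ` is any positive upper bound for the mean, and
-- the product is compared with a power of it.
AM-GM : ℕ → Set
AM-GM n = ∀ (z : Point n) {μ} → 0ℚ < μ → (∀ i → 0ℚ < z i) → sum z ≤ fromNat n * μ →
          product z ≤ μ ^ n × (product z ≡ μ ^ n → ∀ i → z i ≡ μ)

-- Let `ν` be the mean of the last `k` numbers. Their product is at most `ν ^ k` by induction, and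
-- the bound on the sum leaves at most `w` for the first number. What remains,
-- `w * ν ^ k ≤ μ ^ suc k`, is Bernoulli's inequality. Equality forces equality in all three steps.
am-gm-suc : ∀ m → AM-GM (suc m) → AM-GM (suc (suc m))
am-gm-suc m am-gm-m z {μ} 0<μ 0<z ∑≤ = ℚ.≤-trans step₁ (ℚ.≤-trans step₂ step₃) , equality
  where
  k  = suc m
  z₀ = z zero
  N  = fromNat k
  P  = product (z ∘ suc)
  0<N : 0ℚ < N
  0<N = fromNat-pos k (ℕ.s≤s ℕ.z≤n)
  ν = sum (z ∘ suc) * recip N
  0<ν : 0ℚ < ν
  0<ν = *-pos (sum-pos (0<z ∘ suc)) (recip-pos 0<N)
  N*ν≡∑ : N * ν ≡ sum (z ∘ suc)
  N*ν≡∑ = trans (eq N (sum (z ∘ suc)) (recip N))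
    (trans (cong (_* sum (z ∘ suc)) (*-recip-pos 0<N)) (ℚ.*-identityˡ _))
    where
    eq : ∀ k s h → k * (s * h) ≡ k * h * s
    eq = solve-∀ ℚ-ring
  ih = am-gm-m (z ∘ suc) 0<ν (0<z ∘ suc) (ℚ.≤-reflexive (sym N*ν≡∑))
  w = (1ℚ + N) * μ - N * ν
  z₀≤w : z₀ ≤ w
  z₀≤w = ≤-resp ∑≤ (trans (cong₂ (λ c s → c * μ - (z₀ + s)) (fromNat-suc k) (sym N*ν≡∑)) (eq N μ ν z₀))
    where
    eq : ∀ N μ ν z → (1ℚ + N) * μ - (z + N * ν) ≡ (1ℚ + N) * μ - N * ν - z
    eq = solve-∀ ℚ-ring
  step₁ : z₀ * P ≤ z₀ * ν ^ k
  step₁ = *-monoˡ-≤ z₀ (ℚ.<⇒≤ (0<z zero)) (proj₁ ih)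
  step₂ : z₀ * ν ^ k ≤ w * ν ^ k
  step₂ = *-monoʳ-≤ (ν ^ k) (ℚ.<⇒≤ (^-pos k 0<ν)) z₀≤w
  gap : μ ^ suc k - w * ν ^ k ≡ bernoulliGap k ν μ
  gap = eq N μ ν (ν ^ k) (μ ^ suc k)
    where
    eq : ∀ N μ ν p q → q - ((1ℚ + N) * μ - N * ν) * p ≡ N * (ν * p) + q - (1ℚ + N) * μ * p
    eq = solve-∀ ℚ-ring
  step₃ : w * ν ^ k ≤ μ ^ suc k
  step₃ = ≤-from _ gap (bernoulliGap-nonNeg k (ℚ.<⇒≤ 0<ν) (ℚ.<⇒≤ 0<μ))
  equality : z₀ * P ≡ μ ^ suc k → ∀ i → z i ≡ μ
  equality eq = λ { zero → z₀≡μ ; (suc i) → trans (proj₂ ih P≡ν^k i) ν≡μ }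
    where
    wν≡μ : w * ν ^ k ≡ μ ^ suc k
    wν≡μ = ℚ.≤-antisym step₃ (subst (_≤ w * ν ^ k) eq (ℚ.≤-trans step₁ step₂))
    ν≡μ : ν ≡ μ
    ν≡μ = bernoulliGap-zero m 0<ν (ℚ.<⇒≤ 0<μ)
      (trans (sym gap) (trans (cong (λ x → μ ^ suc k - x) wν≡μ) (ℚ.+-inverseʳ (μ ^ suc k))))
    zν≡μ : z₀ * ν ^ k ≡ μ ^ suc k
    zν≡μ = ℚ.≤-antisym (ℚ.≤-trans step₂ step₃) (subst (_≤ z₀ * ν ^ k) eq step₁)
    P≡ν^k : P ≡ ν ^ k
    P≡ν^k = *-cancelˡ-≡ z₀ (pos⇒≢0 (0<z zero)) (trans eq (sym zν≡μ))
    z₀≡μ : z₀ ≡ μ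
    z₀≡μ = *-cancelˡ-≡ (μ ^ k) (pos⇒≢0 (^-pos k 0<μ))
      (trans (ℚ.*-comm (μ ^ k) z₀) (trans (subst (λ x → z₀ * x ^ k ≡ μ ^ suc k) ν≡μ zν≡μ) (ℚ.*-comm μ (μ ^ k))))

am-gm : ∀ n → AM-GM n
am-gm zero z 0<μ 0<z _ = ℚ.≤-refl , λ _ ()
-- Separate from the induction step, which divides by the number of remaining terms.
am-gm (suc zero) z {μ} 0<μ 0<z ∑≤ =
  *-monoʳ-≤ 1ℚ 0≤1 (subst₂ _≤_ (ℚ.+-identityʳ (z zero)) (ℚ.*-identityˡ μ) ∑≤) ,
  λ { eq zero → trans (sym (ℚ.*-identityʳ (z zero))) (trans eq (ℚ.*-identityʳ μ)) }
am-gm (suc (suc m)) = am-gm-suc m (am-gm (suc m))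

1^n≡1 : ∀ n → 1ℚ ^ n ≡ 1ℚ
1^n≡1 zero    = refl
1^n≡1 (suc n) = trans (ℚ.*-identityˡ (1ℚ ^ n)) (1^n≡1 n)

-- Egyptian fractions for 1/g

-- The largest number comes first, so that removing the head leaves the smaller denominators, to
-- which the induction applies; `sylvesters` is listed in the same order.
Descending : (Fin n → ℕ) → Set
Descending {zero}  A = ⊤
Descending {suc n} A = (∀ i → A (suc i) ℕ.≤ A zero) × Descending (A ∘ suc)

sylvesters : ℕ → ∀ n → Fin n → ℕ
sylvesters g (suc n) zero    = sylvester g n
sylvesters g (suc n) (suc i) = sylvesters g n i

sylvester≡suc : ∀ g n → sylvester g n ≡ suc (sylvesterPred g n)
sylvester≡suc g zero    = refl
sylvester≡suc g (suc n) = refl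

∑recip : (Fin n → ℕ) → ℚ
∑recip A = sum (λ i → recip (fromNat (A i)))

∏ : (Fin n → ℕ) → ℚ
∏ A = product (λ i → fromNat (A i))

module Egyptian (g : ℕ) (0<g : 0 ℕ.< g) where
  G = fromNat g
  T : ℕ → ℚ
  T n = fromNat (sylvesterPred g n)
  s : ℕ → ℚ
  s n = fromNat (sylvester g n)

  0<G : 0ℚ < G
  0<G = fromNat-pos g 0<g

  s≡1+T : ∀ n → s n ≡ 1ℚ + T n
  s≡1+T n = trans (cong fromNat (sylvester≡suc g n)) (fromNat-suc (sylvesterPred g n))

  T-suc : ∀ n → T (suc n) ≡ s n * T n
  T-suc n = fromNat-homo-* (sylvester g n) (sylvesterPred g n)

  0<T : ∀ n → 0ℚ < T n
  0<s : ∀ n → 0ℚ < s n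
  0<s n = subst (0ℚ <_) (sym (s≡1+T n)) (+-pos-nonNeg 0<1 (ℚ.<⇒≤ (0<T n)))
  0<T zero    = 0<G
  0<T (suc n) = subst (0ℚ <_) (sym (T-suc n)) (*-pos (0<s n) (0<T n))

  -- The Sylvester recursion is the greedy algorithm: as `s n` is `T n + 1`, taking `1 / s n` away
  -- from `1 / T n` leaves a unit fraction again.
  recip-T-suc : ∀ n → recip (T n) - recip (s n) ≡ recip (T (suc n))
  recip-T-suc n = recip-unique {T (suc n)} (begin
    T (suc n) * (recip (T n) - recip (s n))  ≡⟨ cong (_* (recip (T n) - recip (s n))) (T-suc n) ⟩
    s n * T n * (recip (T n) - recip (s n))  ≡⟨ eq (s n) (T n) (recip (s n)) (recip (T n)) ⟩
    s n * (T n * recip (T n)) - T n * (s n * recip (s n))  ≡⟨ cong₂ (λ x y → s n * x - T n * y) (*-recip-pos (0<T n)) (*-recip-pos (0<s n)) ⟩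
    s n * 1ℚ - T n * 1ℚ  ≡⟨ cong (λ x → x * 1ℚ - T n * 1ℚ) (s≡1+T n) ⟩
    (1ℚ + T n) * 1ℚ - T n * 1ℚ  ≡⟨ eq′ (T n) ⟩
    1ℚ  ∎)
    where
    open ≡-Reasoning
    eq : ∀ s t p q → s * t * (q - p) ≡ s * (t * q) - t * (s * p)
    eq = solve-∀ ℚ-ring
    eq′ : ∀ t → (1ℚ + t) * 1ℚ - t * 1ℚ ≡ 1ℚ
    eq′ = solve-∀ ℚ-ring

  0<sylvesters : ∀ n i → 0ℚ < fromNat (sylvesters g n i)
  0<sylvesters (suc n) zero    = 0<s n
  0<sylvesters (suc n) (suc i) = 0<sylvesters n i

  ∏-sylvesters : ∀ n → ∏ (sylvesters g n) * G ≡ T n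
  ∏-sylvesters zero    = ℚ.*-identityˡ G
  ∏-sylvesters (suc n) = trans (ℚ.*-assoc (s n) (∏ (sylvesters g n)) G)
    (trans (cong (s n *_) (∏-sylvesters n)) (sym (T-suc n)))

  ∏recip-sylvesters : ∀ n → product (λ i → recip (fromNat (sylvesters g n i))) * T n ≡ G
  ∏recip-sylvesters zero    = ℚ.*-identityˡ G
  ∏recip-sylvesters (suc n) = begin
    recip (s n) * R * T (suc n)  ≡⟨ cong (recip (s n) * R *_) (T-suc n) ⟩
    recip (s n) * R * (s n * T n)  ≡⟨ eq (recip (s n)) R (s n) (T n) ⟩
    s n * recip (s n) * (R * T n)  ≡⟨ cong₂ _*_ (*-recip-pos (0<s n)) (∏recip-sylvesters n) ⟩
    1ℚ * G  ≡⟨ ℚ.*-identityˡ G ⟩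
    G  ∎
    where
    open ≡-Reasoning
    R = product (λ i → recip (fromNat (sylvesters g n i)))
    eq : ∀ p r s t → p * r * (s * t) ≡ s * p * (r * t)
    eq = solve-∀ ℚ-ring

  ∑recip-sylvesters : ∀ n → ∑recip (sylvesters g n) ≡ recip G - recip (T n)
  ∑recip-sylvesters zero    = sym (ℚ.+-inverseʳ (recip G))
  ∑recip-sylvesters (suc n) = trans (cong (recip (s n) +_) (∑recip-sylvesters n))
    (trans (eq (recip (s n)) (recip G) (recip (T n))) (cong (λ x → recip G - x) (recip-T-suc n)))
    where
    eq : ∀ p q r → p + (q - r) ≡ q - (r - p)
    eq = solve-∀ ℚ-ring

  -- The first n Sylvester unit fractions add up to 1/g − 1/t_{g,n+1}.
  defect : (Fin n → ℕ) → ℚ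
  defect {n} A = recip G - ∑recip A - recip (T n)

  ratios : (Fin n → ℕ) → Point n
  ratios {n} A i = fromNat (A i) * recip (fromNat (sylvesters g n i))

  product-ratios : ∀ (A : Fin n → ℕ) → product (ratios A) * T n ≡ ∏ A * G
  product-ratios {n} A = begin
    product (ratios A) * T n  ≡⟨ cong (_* T n) (∏-distrib-* (λ i → fromNat (A i)) (λ i → recip (fromNat (sylvesters g n i)))) ⟩
    ∏ A * R * T n  ≡⟨ ℚ.*-assoc (∏ A) R (T n) ⟩
    ∏ A * (R * T n)  ≡⟨ cong (∏ A *_) (∏recip-sylvesters n) ⟩
    ∏ A * G  ∎
    where
    open ≡-Reasoning
    R = product (λ i → recip (fromNat (sylvesters g n i)))

  ratios-pos : ∀ (A : Fin n → ℕ) → (∀ i → 0 ℕ.< A i) → ∀ i → 0ℚ < ratios A i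
  ratios-pos {n} A 0<A i = *-pos (fromNat-pos (A i) (0<A i)) (recip-pos (0<sylvesters n i))

  -- The sum of unit fractions over the common denominator `∏ℕ A`, kept in ℕ so that `remainder-≥`
  -- can round a positive difference up to 1.
  ∏ℕ ∑recip-numerator : (Fin n → ℕ) → ℕ
  ∏ℕ {zero}  A = 1
  ∏ℕ {suc n} A = A zero ℕ.* ∏ℕ (A ∘ suc)
  ∑recip-numerator {zero}  A = 0
  ∑recip-numerator {suc n} A = ∏ℕ (A ∘ suc) ℕ.+ A zero ℕ.* ∑recip-numerator (A ∘ suc)

  ∏≡∏ℕ : ∀ (A : Fin n → ℕ) → ∏ A ≡ fromNat (∏ℕ A)
  ∏≡∏ℕ {zero}  A = refl
  ∏≡∏ℕ {suc n} A = trans (cong (fromNat (A zero) *_) (∏≡∏ℕ (A ∘ suc)))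
    (sym (fromNat-homo-* (A zero) (∏ℕ (A ∘ suc))))

  ∏*∑recip≡numerator : ∀ (A : Fin n → ℕ) → (∀ i → 0 ℕ.< A i) →
                       ∏ A * ∑recip A ≡ fromNat (∑recip-numerator A)
  ∏*∑recip≡numerator {zero}  A 0<A = refl
  ∏*∑recip≡numerator {suc n} A 0<A = begin
    a * ∏ A′ * (recip a + ∑recip A′)  ≡⟨ expand a (∏ A′) (recip a) (∑recip A′) ⟩
    a * recip a * ∏ A′ + a * (∏ A′ * ∑recip A′)  ≡⟨ cong₂ (λ x y → x * ∏ A′ + a * y) (*-recip-pos (fromNat-pos (A zero) (0<A zero))) (∏*∑recip≡numerator A′ (0<A ∘ suc)) ⟩
    1ℚ * ∏ A′ + a * fromNat N  ≡⟨ cong₂ _+_ (trans (ℚ.*-identityˡ (∏ A′)) (∏≡∏ℕ A′)) (sym (fromNat-homo-* (A zero) N)) ⟩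
    fromNat (∏ℕ A′) + fromNat (A zero ℕ.* N)  ≡⟨ fromNat-homo-+ (∏ℕ A′) (A zero ℕ.* N) ⟨
    fromNat (∏ℕ A′ ℕ.+ A zero ℕ.* N)  ∎
    where
    open ≡-Reasoning
    a = fromNat (A zero)
    A′ = A ∘ suc
    N = ∑recip-numerator A′
    expand : ∀ a p r s → a * p * (r + s) ≡ a * r * p + a * (p * s)
    expand = solve-∀ ℚ-ring

  -- A positive fraction with denominator g ∏ aᵢ is at least 1/(g ∏ aᵢ).
  remainder-≥ : ∀ (A : Fin n → ℕ) → (∀ i → 0 ℕ.< A i) → 0ℚ < recip G - ∑recip A →
                1ℚ ≤ (recip G - ∑recip A) * (∏ A * G)
  remainder-≥ A 0<A 0<r =
    subst (1ℚ ≤_) (sym value) (≤-resp (fromNat-mono-≤ (suc (g ℕ.* N)) P gN<P)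
      (trans (cong (λ x → fromNat P - x) (fromNat-suc (g ℕ.* N))) (regroup (fromNat P) (fromNat (g ℕ.* N)))))
    where
    r = recip G - ∑recip A
    P = ∏ℕ A
    N = ∑recip-numerator A
    regroup : ∀ x y → x - (1ℚ + y) ≡ x - y - 1ℚ
    regroup = solve-∀ ℚ-ring
    expand : ∀ h S p G → (h - S) * (p * G) ≡ G * h * p - G * (p * S)
    expand = solve-∀ ℚ-ring
    value : r * (∏ A * G) ≡ fromNat P - fromNat (g ℕ.* N)
    value = trans (expand (recip G) (∑recip A) (∏ A) G)
      (cong₂ _-_ (trans (cong (_* ∏ A) (*-recip-pos 0<G)) (trans (ℚ.*-identityˡ (∏ A)) (∏≡∏ℕ A)))
                 (trans (cong (G *_) (∏*∑recip≡numerator A 0<A)) (sym (fromNat-homo-* g N))))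
    gN<P : g ℕ.* N ℕ.< P
    gN<P = fromNat-cancel-< (g ℕ.* N) P (<-from _ refl (subst (0ℚ <_) value
      (*-pos 0<r (*-pos (product-pos (λ i → fromNat-pos (A i) (0<A i))) 0<G))))

  -- Summation by parts bounds ∑ aᵢ/sᵢ − n by the defect.  A negative defect would give
  -- ∑ aᵢ/sᵢ < n, hence ∏ aᵢ ≤ ∏ sᵢ by AM-GM, which contradicts remainder-≥.
  defect-nonNeg : ∀ n (A : Fin n → ℕ) → (∀ i → 0 ℕ.< A i) → Descending A → 0ℚ < recip G - ∑recip A →
    0ℚ ≤ defect A × (∀ M → (∀ i → A i ℕ.≤ M) → sum (ratios A) ≤ fromNat n * 1ℚ + fromNat M * defect A)
  defect-nonNeg zero A _ _ _ = ℚ.≤-reflexive (sym defect≡0) ,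
    λ M _ → ℚ.≤-reflexive (sym (trans (cong (λ z → 0ℚ * 1ℚ + fromNat M * z) defect≡0) (eq (fromNat M))))
    where
    defect≡0 : defect A ≡ 0ℚ
    defect≡0 = eq₀ (recip G)
      where
      eq₀ : ∀ h → h - 0ℚ - h ≡ 0ℚ
      eq₀ = solve-∀ ℚ-ring
    eq : ∀ M → 0ℚ * 1ℚ + M * 0ℚ ≡ 0ℚ
    eq = solve-∀ ℚ-ring
  defect-nonNeg (suc n) A 0<A (A≤A₀ , descending) 0<r = 0≤defect , λ M A≤M →
    -- Only a nonnegative defect permits the weight `A zero` to grow to `M`, which will be the next
    -- larger denominator.
    ℚ.≤-trans ∑≤ (ℚ.+-monoʳ-≤ (fromNat (suc n) * 1ℚ)
      (*-monoʳ-≤ (defect A) 0≤defect (fromNat-mono-≤ (A zero) M (A≤M zero))))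
    where
    a = fromNat (A zero)
    0<a : 0ℚ < a
    0<a = fromNat-pos (A zero) (0<A zero)
    A′ = A ∘ suc
    0<r′ : 0ℚ < recip G - ∑recip A′
    0<r′ = subst (0ℚ <_) (eq (recip G) (recip a) (∑recip A′))
      (+-pos-nonNeg 0<r (ℚ.<⇒≤ (recip-pos 0<a)))
      where
      eq : ∀ h p S → h - (p + S) + p ≡ h - S
      eq = solve-∀ ℚ-ring
    ih = defect-nonNeg n A′ (0<A ∘ suc) descending 0<r′
    defect′ : defect A′ ≡ defect A + recip a - recip (s n)
    defect′ = trans (eq (recip G) (∑recip A′) (recip (T n)) (recip a) (recip (s n)))
      (cong (λ z → recip G - (recip a + ∑recip A′) - z + recip a - recip (s n)) (recip-T-suc n))
      where
      eq : ∀ h S t p q → h - S - t ≡ h - (p + S) - (t - q) + p - q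
      eq = solve-∀ ℚ-ring
    -- One step of summation by parts. With the weight `A zero` in the induction hypothesis, the
    -- part `- a * recip (s n)` of `a * defect A′` cancels the new ratio, and the part `a * recip a`
    -- is the additional 1.
    ∑≤ : sum (ratios A) ≤ fromNat (suc n) * 1ℚ + a * defect A
    ∑≤ = subst (sum (ratios A) ≤_) rhs (ℚ.+-monoʳ-≤ (a * recip (s n)) (proj₂ ih (A zero) A≤A₀))
      where
      open ≡-Reasoning
      eq : ∀ a q N D p → a * q + (N * 1ℚ + a * (D + p - q)) ≡ (a * p + N) * 1ℚ + a * D
      eq = solve-∀ ℚ-ring
      rhs : a * recip (s n) + (fromNat n * 1ℚ + a * defect A′) ≡ fromNat (suc n) * 1ℚ + a * defect A
      rhs = begin
        a * recip (s n) + (fromNat n * 1ℚ + a * defect A′)  ≡⟨ cong (λ z → a * recip (s n) + (fromNat n * 1ℚ + a * z)) defect′ ⟩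
        a * recip (s n) + (fromNat n * 1ℚ + a * (defect A + recip a - recip (s n)))  ≡⟨ eq a (recip (s n)) (fromNat n) (defect A) (recip a) ⟩
        (a * recip a + fromNat n) * 1ℚ + a * defect A  ≡⟨ cong (λ z → (z + fromNat n) * 1ℚ + a * defect A) (*-recip-pos 0<a) ⟩
        (1ℚ + fromNat n) * 1ℚ + a * defect A  ≡⟨ cong (λ z → z * 1ℚ + a * defect A) (fromNat-suc n) ⟨
        fromNat (suc n) * 1ℚ + a * defect A  ∎
    r = recip G - ∑recip A
    t = T (suc n)
    increase : ∀ x a d → x - (x + a * d) ≡ a * (0ℚ - d)
    increase = solve-∀ ℚ-ring
    flip-difference : ∀ r h → 0ℚ - (r - h) ≡ h - r
    flip-difference = solve-∀ ℚ-ring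
    module _ (defect<0 : defect A < 0ℚ) where
      ∏ratios≤1 : product (ratios A) ≤ 1ℚ
      ∏ratios≤1 = subst (product (ratios A) ≤_) (1^n≡1 (suc n))
        (proj₁ (am-gm (suc n) (ratios A) 0<1 (ratios-pos A 0<A)
          (ℚ.≤-trans ∑≤ (≤-from _ (increase (fromNat (suc n) * 1ℚ) a (defect A))
            (*-nonNeg (ℚ.<⇒≤ 0<a) (p≤q⇒0≤q-p (ℚ.<⇒≤ defect<0)))))))
      ∏G≤t : ∏ A * G ≤ t
      ∏G≤t = subst₂ _≤_ (product-ratios A) (ℚ.*-identityˡ t)
        (*-monoʳ-≤ t (ℚ.<⇒≤ (0<T (suc n))) ∏ratios≤1)
      1≤rt : 1ℚ ≤ r * t
      1≤rt = ℚ.≤-trans (remainder-≥ A 0<A 0<r) (*-monoˡ-≤ r (ℚ.<⇒≤ 0<r) ∏G≤t)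
      rt<1 : r * t < 1ℚ
      rt<1 = subst₂ _<_ (ℚ.*-comm t r) (*-recip-pos (0<T (suc n)))
        (*-monoˡ-< t (0<T (suc n)) (<-resp defect<0 (flip-difference r (recip t))))
    0≤defect : 0ℚ ≤ defect A
    0≤defect = ℚ.≮⇒≥ λ defect<0 → ≤⇒≯ (1≤rt defect<0) (rt<1 defect<0)

  extremal : ∀ n → Fin (suc n) → ℕ
  extremal n zero    = sylvesterPred g n
  extremal n (suc i) = sylvesters g n i

  0<extremal : ∀ n i → 0ℚ < fromNat (extremal n i)
  0<extremal n zero    = 0<T n
  0<extremal n (suc i) = 0<sylvesters n i

  ∑recip-extremal : ∀ n → ∑recip (extremal n) ≡ recip G
  ∑recip-extremal n = trans (cong (recip (T n) +_) (∑recip-sylvesters n)) (eq (recip (T n)) (recip G))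
    where
    eq : ∀ t h → t + (h - t) ≡ h
    eq = solve-∀ ℚ-ring

  ∏-extremal : ∀ n → ∏ (extremal n) * G ≡ T n * T n
  ∏-extremal n = trans (ℚ.*-assoc (T n) (∏ (sylvesters g n)) G) (cong (T n *_) (∏-sylvesters n))

  -- The largest denominator `a` is compared with `t = T n` instead of a Sylvester number. The other
  -- unit fractions leave the remainder `1 / a`, so with weight `a` their ratios add up to at most
  -- `n + 1 − a / t`, and the ratio `a / t` completes the sum to `n + 1`.
  unitFractions-bound : ∀ n (A : Fin (suc n) → ℕ) → (∀ i → 0 ℕ.< A i) → Descending A → ∑recip A ≡ recip G →
    ∏ A * G ≤ T n * T n × (∏ A * G ≡ T n * T n → ∀ i → A i ≡ extremal n i)
  unitFractions-bound n A 0<A (A≤A₀ , descending) ∑≡ = bound , equality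
    where
    a = fromNat (A zero)
    0<a : 0ℚ < a
    0<a = fromNat-pos (A zero) (0<A zero)
    A′ = A ∘ suc
    t = T n
    r′≡ : recip G - ∑recip A′ ≡ recip a
    r′≡ = trans (cong (_- ∑recip A′) (sym ∑≡)) (eq (recip a) (∑recip A′))
      where
      eq : ∀ p S → p + S - S ≡ p
      eq = solve-∀ ℚ-ring
    z : Point (suc n)
    z = (a * recip t) V.∷ ratios A′
    0<z : ∀ i → 0ℚ < z i
    0<z zero    = *-pos 0<a (recip-pos (0<T n))
    0<z (suc i) = ratios-pos A′ (0<A ∘ suc) i
    ∑z≤ : sum z ≤ fromNat (suc n) * 1ℚ
    ∑z≤ = subst (sum z ≤_) rhs (ℚ.+-monoʳ-≤ (a * recip t)
      (proj₂ (defect-nonNeg n A′ (0<A ∘ suc) descending (subst (0ℚ <_) (sym r′≡) (recip-pos 0<a)))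
        (A zero) A≤A₀))
      where
      eq : ∀ a h N p → a * h + (N * 1ℚ + a * (p - h)) ≡ (a * p + N) * 1ℚ
      eq = solve-∀ ℚ-ring
      rhs : a * recip t + (fromNat n * 1ℚ + a * defect A′) ≡ fromNat (suc n) * 1ℚ
      rhs = trans (cong (λ w → a * recip t + (fromNat n * 1ℚ + a * (w - recip t))) r′≡)
        (trans (eq a (recip t) (fromNat n) (recip a))
          (cong (_* 1ℚ) (trans (cong (_+ fromNat n) (*-recip-pos 0<a)) (sym (fromNat-suc n)))))
    amgm = am-gm (suc n) z 0<1 0<z ∑z≤
    ∏z : product z * (t * t) ≡ ∏ A * G
    ∏z = trans (eq a (recip t) (product (ratios A′)) t)
      (trans (cong₂ (λ x y → a * x * y) (*-recip-pos (0<T n)) (product-ratios A′))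
        (eq′ a (∏ A′) G))
      where
      eq : ∀ a h p t → a * h * p * (t * t) ≡ a * (t * h) * (p * t)
      eq = solve-∀ ℚ-ring
      eq′ : ∀ a p G → a * 1ℚ * (p * G) ≡ a * p * G
      eq′ = solve-∀ ℚ-ring
    0<tt : 0ℚ < t * t
    0<tt = *-pos (0<T n) (0<T n)
    bound : ∏ A * G ≤ t * t
    bound = subst₂ _≤_ ∏z (ℚ.*-identityˡ (t * t))
      (*-monoʳ-≤ (t * t) (ℚ.<⇒≤ 0<tt) (subst (product z ≤_) (1^n≡1 (suc n)) (proj₁ amgm)))
    equality : ∏ A * G ≡ t * t → ∀ i → A i ≡ extremal n i
    equality eq = λ where
        zero    → fromNat-injective (A zero) _ (solved (pos⇒≢0 (0<T n)) (z≡1 zero))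
        (suc i) → fromNat-injective (A (suc i)) _ (solved (pos⇒≢0 (0<sylvesters n i)) (z≡1 (suc i)))
      where
      z≡1 : ∀ i → z i ≡ 1ℚ
      z≡1 = proj₂ amgm (trans (*-cancelˡ-≡ (t * t) (pos⇒≢0 0<tt)
        (trans (ℚ.*-comm (t * t) (product z)) (trans ∏z (trans eq (sym (ℚ.*-identityʳ (t * t)))))))
        (sym (1^n≡1 (suc n))))
      solved : ∀ {x y} → y ≢ 0ℚ → x * recip y ≡ 1ℚ → x ≡ y
      solved {x} {y} y≢0 xh≡1 = begin
        x  ≡⟨ ℚ.*-identityʳ x ⟨
        x * 1ℚ  ≡⟨ cong (x *_) (*-recip y≢0) ⟨
        x * (y * recip y)  ≡⟨ eq₁ x y (recip y) ⟩
        y * (x * recip y)  ≡⟨ cong (y *_) xh≡1 ⟩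
        y * 1ℚ  ≡⟨ ℚ.*-identityʳ y ⟩
        y  ∎
        where
        open ≡-Reasoning
        eq₁ : ∀ x y h → x * (y * h) ≡ y * (x * h)
        eq₁ = solve-∀ ℚ-ring

-- Sorting the denominators

argmax : ∀ (A : Fin (suc n) → ℕ) → ∃[ i ] ∀ j → A j ℕ.≤ A i
argmax {zero}  A = zero , λ { zero → ℕ.≤-refl }
argmax {suc n} A with i , A≤ ← argmax (A ∘ suc) with ℕ.≤-total (A zero) (A (suc i))
... | inj₁ A₀≤ = suc i , λ { zero → A₀≤ ; (suc j) → A≤ j }
... | inj₂ ≤A₀ = zero , λ { zero → ℕ.≤-refl ; (suc j) → ℕ.≤-trans (A≤ j) ≤A₀ }

descending-cong : ∀ {A B : Fin n → ℕ} → A ≗ B → Descending A → Descending B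
descending-cong {zero}  A≗B _           = tt
descending-cong {suc n} A≗B (≤A₀ , desc) =
  (λ i → subst₂ ℕ._≤_ (A≗B (suc i)) (A≗B zero) (≤A₀ i)) , descending-cong (A≗B ∘ suc) desc

sort : ∀ (A : Fin n → ℕ) → Σ[ π ∈ Permutation n n ] Descending (λ i → A (π ⟨$⟩ʳ i))
sort {zero}  A = Permutation.id , tt
sort {suc n} A with i , A≤ ← argmax A with π , desc ← sort (A ∘ punchIn i) =
  Permutation.insert zero i π ,
  (λ j → A≤ (Permutation.insert zero i π ⟨$⟩ʳ suc j)) ,
  descending-cong (λ j → cong A (sym (Permutation.insert-punchIn zero i π j))) desc

unitFractions-bound-unsorted : ∀ g (0<g : 0 ℕ.< g) → let open Egyptian g 0<g in
  ∀ n (A : Fin (suc n) → ℕ) → (∀ i → 0 ℕ.< A i) → ∑recip A ≡ recip G →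
  ∏ A * G ≤ T n * T n ×
  (∏ A * G ≡ T n * T n → Σ[ π ∈ Permutation (suc n) (suc n) ] ∀ i → A (π ⟨$⟩ʳ i) ≡ extremal n i)
unitFractions-bound-unsorted g 0<g n A 0<A ∑≡ = along (sort A)
  where
  open Egyptian g 0<g
  module _ (s : Σ[ π ∈ Permutation (suc n) (suc n) ] Descending (λ i → A (π ⟨$⟩ʳ i))) where
    π = proj₁ s
    A′ : Fin (suc n) → ℕ
    A′ i = A (π ⟨$⟩ʳ i)
    ∏≡ : ∏ A′ ≡ ∏ A
    ∏≡ = sym (product-permute (λ i → fromNat (A i)) π)
    sorted = unitFractions-bound n A′ (λ i → 0<A (π ⟨$⟩ʳ i)) (proj₂ s)
      (trans (sym (sum-permute (λ i → recip (fromNat (A i))) π)) ∑≡)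
    along : ∏ A * G ≤ T n * T n ×
      (∏ A * G ≡ T n * T n → Σ[ π ∈ Permutation (suc n) (suc n) ] ∀ i → A (π ⟨$⟩ʳ i) ≡ extremal n i)
    along = subst (λ x → x * G ≤ T n * T n) ∏≡ (proj₁ sorted) ,
      λ eq → π , proj₂ sorted (trans (cong (_* G) ∏≡) eq)

-- Convex hulls

identity-refl : ∀ (i : Fin n) → identity i i ≡ 1ℚ
identity-refl i with i ≟ᶠ i
... | yes _   = refl
... | no  i≢i = contradiction refl i≢i

identity-≢ : ∀ {i j : Fin n} → i ≢ j → identity i j ≡ 0ℚ
identity-≢ {i = i} {j} i≢j with i ≟ᶠ j
... | yes i≡j = contradiction i≡j i≢j
... | no  _   = refl

identity-nonNeg : ∀ (i j : Fin n) → 0ℚ ≤ identity i j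
identity-nonNeg i j with i ≟ᶠ j
... | yes _ = 0≤1
... | no  _ = ℚ.≤-refl

identity-sym : ∀ (i j : Fin n) → identity i j ≡ identity j i
identity-sym i j with i ≟ᶠ j
... | yes refl = sym (identity-refl i)
... | no  i≢j  = sym (identity-≢ (i≢j ∘ sym))

sum-identity : ∀ (i : Fin n) → sum (identity i) ≡ 1ℚ
sum-identity i = trans (sum-cong-≗ (λ j → sym (ℚ.*-identityʳ (identity i j)))) (⟨⟩-identityˡ i (λ _ → 1ℚ))

sum-single : ∀ i (f : Point n) → (∀ j → j ≢ i → f j ≡ 0ℚ) → sum f ≡ f i
sum-single i f f≡0 = trans (sum-cong-≗ (λ j → single j (i ≟ᶠ j))) (⟨⟩-identityˡ i f)
  where
  single : ∀ j → Dec (i ≡ j) → f j ≡ identity i j * f j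
  single j (yes refl) = sym (trans (cong (_* f j) (identity-refl i)) (ℚ.*-identityˡ (f j)))
  single j (no i≢j)   = trans (f≡0 j (i≢j ∘ sym)) (sym (trans (cong (_* f j) (identity-≢ i≢j)) (ℚ.*-zeroˡ (f j))))

sum-mono-≤ : ∀ {x y : Point n} → (∀ i → x i ≤ y i) → sum x ≤ sum y
sum-mono-≤ {zero}  x≤y = ℚ.≤-refl
sum-mono-≤ {suc n} x≤y = ℚ.+-mono-≤ (x≤y zero) (sum-mono-≤ (x≤y ∘ suc))

combination : Vector (Point d) n → Point n → Point d
combination v c k = sum (λ i → c i * v i k)

⟨combination⟩ : ∀ (v : Vector (Point d) n) c u → ⟨ u , combination v c ⟩ ≡ sum (λ i → c i * ⟨ u , v i ⟩)
⟨combination⟩ v c u = trans (⟨⟩-comm u (combination v c))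
  (trans (⟨⟩-sum c v u) (sum-cong-≗ λ i → cong (c i *_) (⟨⟩-comm (v i) u)))

combination-identity : ∀ (v : Vector (Point d) n) i → v i ≗ combination v (identity i)
combination-identity v i k = sym (⟨⟩-identityˡ i (λ j → v j k))

generator∈conv : ∀ (v : Vector (Point d) n) i → v i ∈ conv v
generator∈conv v i = identity i , identity-nonNeg i , sum-identity i , combination-identity v i

polar-conv : ∀ (v : Vector (Point d) n) {u} → (∀ i → - 1ℚ ≤ ⟨ u , v i ⟩) → u ∈ polar (conv v)
polar-conv v {u} bound x (c , 0≤c , ∑c≡1 , x≗) = subst₂ _≤_ lhs rhs
  (sum-mono-≤ λ i → *-monoˡ-≤ (c i) (0≤c i) (bound i))
  where
  lhs : sum (λ i → c i * (- 1ℚ)) ≡ - 1ℚ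
  lhs = trans (sym (*-distribʳ-sum (- 1ℚ) c)) (cong (_* (- 1ℚ)) ∑c≡1)
  rhs : sum (λ i → c i * ⟨ u , v i ⟩) ≡ ⟨ u , x ⟩
  rhs = trans (sym (⟨combination⟩ v c u)) (⟨⟩-cong {u = u} (λ _ → refl) (λ k → sym (x≗ k)))

-- Independence applied to the difference of the weights, which is written with the factor `- 1ℚ` so
-- that it distributes over sums.
combination-injective : ∀ (v : Vector (Point d) n) → AffinelyIndependent v → ∀ b c → sum b ≡ sum c →
                        combination v b ≗ combination v c → b ≗ c
combination-injective v independent b c ∑b≡∑c b≗c i =
  difference≡0 (independent (λ i → b i + (- 1ℚ) * c i) sum≡0 combination≡0 i)
  where
  cancel : ∀ x → x + (- 1ℚ) * x ≡ 0ℚ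
  cancel = solve-∀ ℚ-ring
  restore : ∀ x y → x ≡ x + (- 1ℚ) * y + y
  restore = solve-∀ ℚ-ring
  expand : ∀ b c x → (b + (- 1ℚ) * c) * x ≡ b * x + (- 1ℚ) * (c * x)
  expand = solve-∀ ℚ-ring
  difference≡0 : ∀ {x y} → x + (- 1ℚ) * y ≡ 0ℚ → x ≡ y
  difference≡0 {x} {y} eq = trans (restore x y) (trans (cong (_+ y) eq) (ℚ.+-identityˡ y))
  sum-difference : ∀ (f g : Point _) → sum f ≡ sum g → sum (λ i → f i + (- 1ℚ) * g i) ≡ 0ℚ
  sum-difference f g eq = trans (∑-distrib-+ f (λ i → (- 1ℚ) * g i))
    (trans (cong₂ _+_ eq (sym (*-distribˡ-sum (- 1ℚ) g))) (cancel (sum g)))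
  sum≡0 = sum-difference b c ∑b≡∑c
  combination≡0 : ∀ k → combination v (λ i → b i + (- 1ℚ) * c i) k ≡ 0ℚ
  combination≡0 k = trans (sum-cong-≗ λ i → expand (b i) (c i) (v i k))
    (sum-difference (λ i → b i * v i k) (λ i → c i * v i k) (b≗c k))

-- The map z ↦ z − βᵢ ∑ z, whose determinant is 1 − ∑ βᵢ; in the coordinates (∑ z, z₂, …, z_d) it is triangular.

private
  codet-columnShear : ∀ (c : Point n) → Aut.codet (columnShear c) ≡ 1ℚ
  codet-columnShear {zero}  c = refl
  codet-columnShear {suc n} c = trans (identities (Aut.codet (columnShear (c ∘ suc)))) (codet-columnShear (c ∘ suc))
    where
    identities : ∀ x → 1ℚ * (1ℚ * (x * 1ℚ)) ≡ x
    identities = solve-∀ ℚ-ring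

  scaling-columnShear : ∀ (c : Point n) → Scaling (Aut.fwd (columnShear c)) 1ℚ
  scaling-columnShear c = subst (Scaling _) (codet-columnShear c)
    (Bijection.scalingᶠ (Aut.forward (columnShear c)))

  scaling-rowShear : ∀ (c : Point n) → Scaling (Aut.fwd (rowShear c)) 1ℚ
  scaling-rowShear c = subst (Scaling _) (codet-columnShear c)
    (Bijection.scalingᶠ (Aut.forward (rowShear c)))

barycentricMap : Point d → Point d → Point d
barycentricMap β z i = z i + β i * (1ℚ - sum z)

scaling-barycentricMap : ∀ (β : Point (suc d)) {β₀} → 0ℚ < β₀ → β₀ + sum β ≡ 1ℚ →
                         Scaling (barycentricMap β) (recip β₀)
scaling-barycentricMap {d} β {β₀} 0<β₀ β₀+∑β≡1 =
  -- `T` puts `∑ z` in first place, `C` subtracts its multiples from the other coordinates, `scale₀`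
  -- multiplies it by `1 − ∑ β`, which is `β₀`; `T⁻¹` and the translation by `β` lead back to the
  -- original coordinates.
  scaling-cong {h = affine (λ _ → 1ℚ) β ∘ T⁻¹ ∘ scale₀ β₀ ∘ C ∘ T} agree factor
    (scaling-∘ (scaling-affine β λ _ → 0<1)
      (scaling-∘ (scaling-rowShear (λ _ → - 1ℚ))
        (scaling-∘ (scaling-scale₀-pos 0<β₀)
          (scaling-∘ (scaling-columnShear (λ i → - β (suc i))) (scaling-rowShear (λ _ → 1ℚ))))))
  where
  T   = Aut.fwd (rowShear {d} (λ _ → 1ℚ))
  T⁻¹ = Aut.fwd (rowShear {d} (λ _ → - 1ℚ))
  C   = Aut.fwd (columnShear {d} (λ i → - β (suc i)))
  factor : product {suc d} (λ _ → recip 1ℚ) * (1ℚ * (recip β₀ * (1ℚ * 1ℚ))) ≡ recip β₀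
  factor = trans (cong (_* (1ℚ * (recip β₀ * (1ℚ * 1ℚ)))) (product-recip-one (suc d))) (identities (recip β₀))
    where
    identities : ∀ x → 1ℚ * (1ℚ * (x * (1ℚ * 1ℚ))) ≡ x
    identities = solve-∀ ℚ-ring
  module _ (z : Point (suc d)) where
    open ≡-Reasoning
    w = scale₀ β₀ (C (T z))
    ∑′z = sum (z ∘ suc)
    ∑′β = sum (β ∘ suc)
    T-zero : T z zero ≡ sum z
    T-zero = trans (rowShear-zero (λ _ → 1ℚ) z)
      (cong (z zero +_) (sum-cong-≗ λ i → ℚ.*-identityˡ (z (suc i))))
    w-zero : w zero ≡ β₀ * sum z
    w-zero = cong (β₀ *_) (trans (columnShear-zero (λ i → - β (suc i)) (T z)) T-zero)
    w-suc : ∀ i → w (suc i) ≡ z (suc i) + (- β (suc i)) * sum z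
    w-suc i = trans (columnShear-suc (λ i → - β (suc i)) (T z) i)
      (cong₂ (λ x y → x + (- β (suc i)) * y) (rowShear-suc (λ _ → 1ℚ) z i) T-zero)
    negate-sum : ⟨ (λ _ → - 1ℚ) , w ∘ suc ⟩ ≡ - (∑′z - ∑′β * sum z)
    negate-sum = begin
      ⟨ (λ _ → - 1ℚ) , w ∘ suc ⟩  ≡⟨ sym (*-distribˡ-sum (- 1ℚ) (w ∘ suc)) ⟩
      (- 1ℚ) * sum (w ∘ suc)  ≡⟨ cong ((- 1ℚ) *_) (trans (sum-cong-≗ w-suc) (∑-distrib-+ (z ∘ suc) (λ i → (- β (suc i)) * sum z))) ⟩
      (- 1ℚ) * (∑′z + sum (λ i → (- β (suc i)) * sum z))  ≡⟨ cong (λ x → (- 1ℚ) * (∑′z + x)) (sum-cong-≗ λ i → negate (β (suc i)) (sum z)) ⟩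
      (- 1ℚ) * (∑′z + sum (λ i → β (suc i) * (- sum z)))  ≡⟨ cong (λ x → (- 1ℚ) * (∑′z + x)) (*-distribʳ-sum (- sum z) (β ∘ suc)) ⟨
      (- 1ℚ) * (∑′z + ∑′β * (- sum z))  ≡⟨ tidy ∑′z ∑′β (sum z) ⟩
      - (∑′z - ∑′β * sum z)  ∎
      where
      negate : ∀ b s → (- b) * s ≡ b * (- s)
      negate = solve-∀ ℚ-ring
      tidy : ∀ x b s → (- 1ℚ) * (x + b * (- s)) ≡ - (x - b * s)
      tidy = solve-∀ ℚ-ring
    agree : affine (λ _ → 1ℚ) β (T⁻¹ w) ≗ barycentricMap β z
    agree zero = begin
      1ℚ * T⁻¹ w zero + β zero  ≡⟨ cong (λ x → 1ℚ * x + β zero) (rowShear-zero (λ _ → - 1ℚ) w) ⟩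
      1ℚ * (w zero + ⟨ (λ _ → - 1ℚ) , w ∘ suc ⟩) + β zero  ≡⟨ cong₂ (λ x y → 1ℚ * (x + y) + β zero) w-zero negate-sum ⟩
      1ℚ * (β₀ * sum z + - (∑′z - ∑′β * sum z)) + β zero  ≡⟨ regroup (z zero) ∑′z β₀ (β zero) ∑′β ⟩
      z zero + β zero * (1ℚ - sum z) + (β₀ + sum β - 1ℚ) * sum z  ≡⟨ cong (λ x → z zero + β zero * (1ℚ - sum z) + (x - 1ℚ) * sum z) β₀+∑β≡1 ⟩
      z zero + β zero * (1ℚ - sum z) + (1ℚ - 1ℚ) * sum z  ≡⟨ vanish (z zero + β zero * (1ℚ - sum z)) (sum z) ⟩
      z zero + β zero * (1ℚ - sum z)  ∎
      where
      regroup : ∀ z s b₀ b B → 1ℚ * (b₀ * (z + s) + - (s - B * (z + s))) + b ≡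
                               z + b * (1ℚ - (z + s)) + (b₀ + (b + B) - 1ℚ) * (z + s)
      regroup = solve-∀ ℚ-ring
      vanish : ∀ x s → x + (1ℚ - 1ℚ) * s ≡ x
      vanish = solve-∀ ℚ-ring
    agree (suc i) = trans
      (cong (λ x → 1ℚ * x + β (suc i)) (trans (rowShear-suc (λ _ → - 1ℚ) w i) (w-suc i)))
      (regroup (z (suc i)) (β (suc i)) (sum z))
      where
      regroup : ∀ z b s → 1ℚ * (z + (- b) * s) + b ≡ z + b * (1ℚ - s)
      regroup = solve-∀ ℚ-ring

-- Extreme points of dilations

private
  tight-≤ : ∀ t {Y Z} → 0ℚ ≤ t → t < 1ℚ → - 1ℚ ≤ Z → (1ℚ - t) * Y + t * Z ≡ - 1ℚ → Y ≤ - 1ℚ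
  tight-≤ t {Y} {Z} 0≤t t<1 -1≤Z eq = *-cancelˡ-≤ (1ℚ - t) (p<q⇒0<q-p t<1)
    (≤-from (t * (Z - - 1ℚ))
      (trans (expand t Y Z)
        (trans (cong (λ w → t * (Z - - 1ℚ) + (- 1ℚ - w)) eq) (ℚ.+-identityʳ (t * (Z - - 1ℚ)))))
      (*-nonNeg 0≤t (p≤q⇒0≤q-p -1≤Z)))
    where
    expand : ∀ t Y Z → (1ℚ - t) * (- 1ℚ) - (1ℚ - t) * Y ≡ t * (Z - - 1ℚ) + (- 1ℚ - ((1ℚ - t) * Y + t * Z))
    expand = solve-∀ ℚ-ring

  -- A proper mean of two numbers that are at least -1 equals -1 only if both of them do.
  tight : ∀ t {Y Z} → 0ℚ < t → t < 1ℚ → - 1ℚ ≤ Y → - 1ℚ ≤ Z → (1ℚ - t) * Y + t * Z ≡ - 1ℚ → Y ≡ Z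
  tight t {Y} {Z} 0<t t<1 -1≤Y -1≤Z eq = trans
    (ℚ.≤-antisym (tight-≤ t (ℚ.<⇒≤ 0<t) t<1 -1≤Z eq) -1≤Y)
    (sym (ℚ.≤-antisym (tight-≤ (1ℚ - t) (p≤q⇒0≤q-p (ℚ.<⇒≤ t<1)) (<-resp 0<t (reflect t)) -1≤Y
      (trans (sym (exchange t Y Z)) eq)) -1≤Z))
    where
    reflect : ∀ t → t - 0ℚ ≡ 1ℚ - (1ℚ - t)
    reflect = solve-∀ ℚ-ring
    exchange : ∀ t Y Z → (1ℚ - t) * Y + t * Z ≡ (1ℚ - (1ℚ - t)) * Z + (1ℚ - t) * Y
    exchange = solve-∀ ℚ-ring

module _ {S : Subset d} (w : Vector (Point d) n) (β : Point n)
         (bound : ∀ x → S x → ∀ j → - 1ℚ ≤ ⟨ x , w j ⟩)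
         (balanced : ∀ x → S x → sum (λ j → β j * ⟨ x , w j ⟩) ≡ 0ℚ)
         (separated : ∀ x y → S x → S y → (∀ j → ⟨ x , w j ⟩ ≡ ⟨ y , w j ⟩) → x ≗ y) where

  -- Serves the simplex and its dual alike, with `w` the vertices of the other one. At `p` every
  -- inequality but the one for `i` is tight, so the ends of a segment through `p` agree in these
  -- pairings. The linear relation with `β i` nonzero transfers this to the pairing with `w i`, and
  -- `separated` identifies the ends.
  dilate-isVertex : ∀ {p} i → β i ≢ 0ℚ → S p → (∀ j → j ≢ i → ⟨ p , w j ⟩ ≡ - 1ℚ) →
                    ∀ {k} → 0 ℕ.< k → IsVertex (dilate k S) (λ c → fromNat k * p c)
  dilate-isVertex {p} i βᵢ≢0 p∈S p-tight {k} 0<k =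
    (p , p∈S , λ _ → refl) , λ _ _ t (y , y∈S , ≗y) (z , z∈S , ≗z) 0<t t<1 p≗ c →
      trans (≗y c) (trans (cong (fromNat k *_)
        (y≗z t y z y∈S z∈S 0<t t<1
          (λ c → trans (p≗ c) (cong₂ (λ a b → (1ℚ - t) * a + t * b) (≗y c) (≗z c))) c))
        (sym (≗z c)))
    where
    module _ (t : ℚ) (y z : Point d) (y∈S : S y) (z∈S : S z) (0<t : 0ℚ < t) (t<1 : t < 1ℚ)
             (p≗ : ∀ c → fromNat k * p c ≡ (1ℚ - t) * (fromNat k * y c) + t * (fromNat k * z c)) where
      factor : ∀ k t y z → (1ℚ - t) * (k * y) + t * (k * z) ≡ k * ((1ℚ - t) * y + t * z)
      factor = solve-∀ ℚ-ring
      p≗′ : p ≗ λ c → (1ℚ - t) * y c + t * z c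
      p≗′ c = *-cancelˡ-≡ (fromNat k) (pos⇒≢0 (fromNat-pos k 0<k))
        (trans (p≗ c) (factor (fromNat k) t (y c) (z c)))
      pairing : ∀ j → ⟨ p , w j ⟩ ≡ (1ℚ - t) * ⟨ y , w j ⟩ + t * ⟨ z , w j ⟩
      pairing j = trans (⟨⟩-cong {x = w j} p≗′ (λ _ → refl))
        (trans (⟨⟩-+ (λ c → (1ℚ - t) * y c) (λ c → t * z c) (w j))
          (cong₂ _+_ (⟨⟩-* (1ℚ - t) y (w j)) (⟨⟩-* t z (w j))))
      off-diagonal : ∀ j → j ≢ i → ⟨ y , w j ⟩ ≡ ⟨ z , w j ⟩
      off-diagonal j j≢i = tight t 0<t t<1 (bound y y∈S j) (bound z z∈S j)
        (trans (sym (pairing j)) (p-tight j j≢i))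
      difference : ℚ → ℚ → ℚ → ℚ
      difference b x y = b * x + (- 1ℚ) * (b * y)
      cancel : ∀ b x → b * x + (- 1ℚ) * (b * x) ≡ 0ℚ
      cancel = solve-∀ ℚ-ring
      restore : ∀ x y → x + (- 1ℚ) * y + y ≡ x
      restore = solve-∀ ℚ-ring
      diagonal : ⟨ y , w i ⟩ ≡ ⟨ z , w i ⟩
      diagonal = *-cancelˡ-≡ (β i) βᵢ≢0 (trans (sym (restore (β i * ⟨ y , w i ⟩) (β i * ⟨ z , w i ⟩)))
        (trans (cong (_+ β i * ⟨ z , w i ⟩) difference≡0) (ℚ.+-identityˡ (β i * ⟨ z , w i ⟩))))
        where
        differences : Point n
        differences j = difference (β j) ⟨ y , w j ⟩ ⟨ z , w j ⟩
        vanish : ∀ j → j ≢ i → differences j ≡ 0ℚ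
        vanish j j≢i = trans (cong (λ a → difference (β j) a ⟨ z , w j ⟩) (off-diagonal j j≢i))
          (cancel (β j) ⟨ z , w j ⟩)
        difference≡0 : differences i ≡ 0ℚ
        difference≡0 = trans (sym (sum-single i differences vanish))
          (trans (∑-distrib-+ (λ j → β j * ⟨ y , w j ⟩) (λ j → (- 1ℚ) * (β j * ⟨ z , w j ⟩)))
            (cong₂ _+_ (balanced y y∈S)
              (trans (sym (*-distribˡ-sum (- 1ℚ) (λ j → β j * ⟨ z , w j ⟩)))
                (cong ((- 1ℚ) *_) (balanced z z∈S)))))
      y≗z : y ≗ z
      y≗z = separated y z y∈S z∈S λ j → agree j (i ≟ᶠ j)
        where
        agree : ∀ j → Dec (i ≡ j) → ⟨ y , w j ⟩ ≡ ⟨ z , w j ⟩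
        agree j (yes refl) = diagonal
        agree j (no i≢j)   = off-diagonal j (i≢j ∘ sym)

-- A simplex with barycentric coordinates β of the origin, and its dual

module Simplices {m} (v : Vector (Point (suc m)) (suc (suc m))) (independent : AffinelyIndependent v)
                 (β : Point (suc (suc m))) (0<β : ∀ i → 0ℚ < β i) (∑β≡1 : sum β ≡ 1ℚ)
                 (origin : combination v β ≗ λ _ → 0ℚ) where

  dim = suc m

  β⁻¹ : Point (suc dim)
  β⁻¹ i = recip (β i)

  β*β⁻¹ : ∀ i → β i * β⁻¹ i ≡ 1ℚ
  β*β⁻¹ i = *-recip-pos (0<β i)

  -- The columns are all vertices but `v zero`, which the relation `β` recovers from the others.
  Coordinates : Matrix ℚ dim dim
  Coordinates k i = v (suc i) k

  -- If z is in the kernel then (0, z) − (∑ z) β is an affine relation between the vertices.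
  trivialKernel : TrivialKernel Coordinates
  trivialKernel z z∈kernel i =
    trans (relation (suc i)) (trans (cong (_* β (suc i)) s≡0) (ℚ.*-zeroˡ (β (suc i))))
    where
    s = sum z
    ẑ : Point (suc dim)
    ẑ = 0ℚ V.∷ z
    relation : ∀ i → ẑ i ≡ s * β i
    relation = combination-injective v independent ẑ (λ i → s * β i)
      (trans (ℚ.+-identityˡ s) (sym (trans (sym (*-distribˡ-sum s β)) (trans (cong (s *_) ∑β≡1) (ℚ.*-identityʳ s)))))
      λ k → trans (lhs k) (sym (rhs k))
      where
      lhs : ∀ k → combination v ẑ k ≡ 0ℚ
      lhs k = cong₂ _+_ (ℚ.*-zeroˡ (v zero k)) (trans (⟨⟩-comm z (Coordinates k)) (z∈kernel k))
      rhs : ∀ k → combination v (λ i → s * β i) k ≡ 0ℚ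
      rhs k = trans (⟨⟩-* s β (λ i → v i k)) (trans (cong (s *_) (origin k)) (ℚ.*-zeroʳ s))
    s≡0 : s ≡ 0ℚ
    s≡0 = *-cancelˡ-≡ (β zero) (pos⇒≢0 (0<β zero))
      (trans (ℚ.*-comm (β zero) s) (trans (sym (relation zero)) (sym (ℚ.*-zeroʳ (β zero)))))

  A : Aut dim
  A = proj₁ (matrix⇒Aut Coordinates trivialKernel)

  fwd≗ : ∀ z → Aut.fwd A z ≗ λ k → ⟨ Coordinates k , z ⟩
  fwd≗ = proj₂ (matrix⇒Aut Coordinates trivialKernel)

  tr≗ : ∀ u → Aut.tr A u ≗ λ i → ⟨ u , v (suc i) ⟩
  tr≗ u i = trans (sym (⟨⟩-identityʳ (Aut.tr A u) i))
    (trans (Aut.adjoint A u (identity i))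
      (⟨⟩-cong {u = u} (λ _ → refl) λ k → trans (fwd≗ (identity i) k) (⟨⟩-identityʳ (Coordinates k) i)))

  balance : ∀ u → sum (λ i → β i * ⟨ u , v i ⟩) ≡ 0ℚ
  balance u = trans (sym (⟨combination⟩ v β u))
    (trans (⟨⟩-cong {u = u} (λ _ → refl) origin) (⟨⟩-zeroʳ u))

  body = conv v

  private
    simplexVolume-1 : simplexVolume dim 1ℚ ≡ recip (fromNat (dim !))
    simplexVolume-1 = trans (cong (_* recip (fromNat (dim !))) (1^n≡1 dim)) (ℚ.*-identityˡ _)

    normalise : ∀ x → fromNat (dim !) * (x * simplexVolume dim 1ℚ) ≡ x
    normalise x = trans (cong (λ w → fromNat (dim !) * (x * w)) simplexVolume-1)
      (trans (rearrange (fromNat (dim !)) x (recip (fromNat (dim !))))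
        (trans (cong (_* x) (*-recip-pos (0<d! dim))) (ℚ.*-identityˡ x)))
      where
      rearrange : ∀ f x h → f * (x * h) ≡ f * h * x
      rearrange = solve-∀ ℚ-ring

    unit : Content (Simplex dim 1ℚ) (simplexVolume dim 1ℚ)
    unit = content-simplex dim 1ℚ 0≤1

    volume : ∀ {S : Subset dim} {h m} → Scaling h m → (Simplex dim 1ℚ ∘ h) ≐ S → IsVol S m
    volume {m = m} H eq = m * simplexVolume dim 1ℚ , content⇒volume (content-≐ eq (content-scale H unit)) , sym (normalise m)

  -- u lies in the dual iff the point with coordinates βᵢ (1 + ⟨u, vᵢ⟩), i ≥ 1, lies in the standard simplex.

  β′ : Point dim
  β′ = β ∘ suc

  dualCoordinates : Point dim → Point dim
  dualCoordinates u = affine β′ β′ (Aut.tr A u)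

  0<β′ : ∀ i → 0ℚ < β′ i
  0<β′ = 0<β ∘ suc

  private
    nonNeg-cancel : ∀ {b x} → 0ℚ < b → 0ℚ ≤ b * x → 0ℚ ≤ x
    nonNeg-cancel {b} 0<b 0≤bx = *-cancelˡ-≤ b 0<b (subst (_≤ b * _) (sym (ℚ.*-zeroʳ b)) 0≤bx)

    nonNeg⇒-1≤ : ∀ {y} → 0ℚ ≤ y - - 1ℚ → - 1ℚ ≤ y
    nonNeg⇒-1≤ {y} = ≤-from (y - - 1ℚ) refl

    -- By `balance` and `∑ β ≡ 1`, the slack in the last inequality of the standard simplex
    -- expresses the dual inequality at the omitted vertex `v zero`.
    1-sum-dualCoordinates : ∀ u → 1ℚ - sum (dualCoordinates u) ≡ β zero * (⟨ u , v zero ⟩ - - 1ℚ)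
    1-sum-dualCoordinates u = begin
      1ℚ - sum (dualCoordinates u)  ≡⟨ cong (λ w → 1ℚ - w) (trans (sum-cong-≗ λ i → cong (λ w → β′ i * w + β′ i) (tr≗ u i)) (∑-distrib-+ (λ i → β′ i * ⟨ u , v (suc i) ⟩) β′)) ⟩
      1ℚ - (Y + sum β′)  ≡⟨ collect b₀ y₀ Y (sum β′) ⟩
      b₀ * (y₀ - - 1ℚ) + (0ℚ - (b₀ * y₀ + Y)) + (1ℚ - sum β)  ≡⟨ cong₂ (λ x y → b₀ * (y₀ - - 1ℚ) + (0ℚ - x) + (1ℚ - y)) (balance u) ∑β≡1 ⟩
      b₀ * (y₀ - - 1ℚ) + (0ℚ - 0ℚ) + (1ℚ - 1ℚ)  ≡⟨ vanish (b₀ * (y₀ - - 1ℚ)) ⟩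
      b₀ * (y₀ - - 1ℚ)  ∎
      where
      open ≡-Reasoning
      b₀ = β zero
      y₀ = ⟨ u , v zero ⟩
      Y = sum (λ i → β′ i * ⟨ u , v (suc i) ⟩)
      collect : ∀ b y Y s → 1ℚ - (Y + s) ≡ b * (y - - 1ℚ) + (0ℚ - (b * y + Y)) + (1ℚ - (b + s))
      collect = solve-∀ ℚ-ring
      vanish : ∀ x → x + (0ℚ - 0ℚ) + (1ℚ - 1ℚ) ≡ x
      vanish = solve-∀ ℚ-ring

    dualCoordinate : ∀ u i → dualCoordinates u i ≡ β′ i * (⟨ u , v (suc i) ⟩ - - 1ℚ)
    dualCoordinate u i = trans (cong (λ w → β′ i * w + β′ i) (tr≗ u i)) (factor (β′ i) ⟨ u , v (suc i) ⟩)
      where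
      factor : ∀ b y → b * y + b ≡ b * (y - - 1ℚ)
      factor = solve-∀ ℚ-ring

  dual-≐ : (Simplex dim 1ℚ ∘ dualCoordinates) ≐ polar body
  dual-≐ = (λ {u} u∈ → polar-conv v {u} (bounds u u∈)) , λ {u} u∈ → simplex u λ i → u∈ (v i) (generator∈conv v i)
    where
    bounds : ∀ u → Simplex dim 1ℚ (dualCoordinates u) → ∀ i → - 1ℚ ≤ ⟨ u , v i ⟩
    bounds u (0≤ , ∑≤1) zero    = nonNeg⇒-1≤ (nonNeg-cancel (0<β zero)
      (subst (0ℚ ≤_) (1-sum-dualCoordinates u) (p≤q⇒0≤q-p ∑≤1)))
    bounds u (0≤ , ∑≤1) (suc i) = nonNeg⇒-1≤ (nonNeg-cancel (0<β′ i) (subst (0ℚ ≤_) (dualCoordinate u i) (0≤ i)))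
    simplex : ∀ u → (∀ i → - 1ℚ ≤ ⟨ u , v i ⟩) → Simplex dim 1ℚ (dualCoordinates u)
    simplex u -1≤ =
      (λ i → subst (0ℚ ≤_) (sym (dualCoordinate u i)) (*-nonNeg (ℚ.<⇒≤ (0<β′ i)) (p≤q⇒0≤q-p (-1≤ (suc i))))) ,
      ≤-from _ (1-sum-dualCoordinates u) (*-nonNeg (ℚ.<⇒≤ (0<β zero)) (p≤q⇒0≤q-p (-1≤ zero)))

  dual-Vol : IsVol (polar body) (product (recip ∘ β′) * Aut.codet A)
  dual-Vol = volume (scaling-∘ (scaling-affine β′ 0<β′) (Bijection.scalingᶠ (Aut.transposed A))) dual-≐

  -- The point `∑ zᵢ v (suc i)` comes with weights of total `∑ z`. Adding `1 − ∑ z` times the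
  -- weights `β` of the origin makes the total 1 and does not move the point.
  barycentric : Point dim → Point (suc dim)
  barycentric z = (β zero * (1ℚ - sum z)) V.∷ barycentricMap β′ z

  sum-barycentric : ∀ z → sum (barycentric z) ≡ 1ℚ
  sum-barycentric z = begin
    β zero * (1ℚ - s) + sum (barycentricMap β′ z)  ≡⟨ cong (β zero * (1ℚ - s) +_) (trans (∑-distrib-+ z (λ i → β′ i * (1ℚ - s))) (cong (s +_) (sym (*-distribʳ-sum (1ℚ - s) β′)))) ⟩
    β zero * (1ℚ - s) + (s + sum β′ * (1ℚ - s))  ≡⟨ collect (β zero) (sum β′) s ⟩
    sum β * (1ℚ - s) + s  ≡⟨ cong (λ w → w * (1ℚ - s) + s) ∑β≡1 ⟩
    1ℚ * (1ℚ - s) + s  ≡⟨ cancel s ⟩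
    1ℚ  ∎
    where
    open ≡-Reasoning
    s = sum z
    collect : ∀ b B s → b * (1ℚ - s) + (s + B * (1ℚ - s)) ≡ (b + B) * (1ℚ - s) + s
    collect = solve-∀ ℚ-ring
    cancel : ∀ s → 1ℚ * (1ℚ - s) + s ≡ 1ℚ
    cancel = solve-∀ ℚ-ring

  combination-barycentric : ∀ z → combination v (barycentric z) ≗ Aut.fwd A z
  combination-barycentric z k = begin
    β zero * (1ℚ - s) * v zero k + sum (λ i → (z i + β′ i * (1ℚ - s)) * v (suc i) k)  ≡⟨ cong (β zero * (1ℚ - s) * v zero k +_) (trans (sum-cong-≗ λ i → expand (z i) (β′ i) (1ℚ - s) (v (suc i) k)) (trans (∑-distrib-+ (λ i → v (suc i) k * z i) (λ i → (1ℚ - s) * (β′ i * v (suc i) k))) (cong (⟨ Coordinates k , z ⟩ +_) (sym (*-distribˡ-sum (1ℚ - s) (λ i → β′ i * v (suc i) k)))))) ⟩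
    β zero * (1ℚ - s) * v zero k + (⟨ Coordinates k , z ⟩ + (1ℚ - s) * V′)  ≡⟨ collect (β zero) (1ℚ - s) (v zero k) ⟨ Coordinates k , z ⟩ V′ ⟩
    (1ℚ - s) * (β zero * v zero k + V′) + ⟨ Coordinates k , z ⟩  ≡⟨ cong₂ (λ x y → (1ℚ - s) * x + y) (origin k) (sym (fwd≗ z k)) ⟩
    (1ℚ - s) * 0ℚ + Aut.fwd A z k  ≡⟨ vanish (1ℚ - s) (Aut.fwd A z k) ⟩
    Aut.fwd A z k  ∎
    where
    open ≡-Reasoning
    s = sum z
    V′ = sum (λ i → β′ i * v (suc i) k)
    expand : ∀ z b t x → (z + b * t) * x ≡ x * z + t * (b * x)
    expand = solve-∀ ℚ-ring
    collect : ∀ b t x y V → b * t * x + (y + t * V) ≡ t * (b * x + V) + y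
    collect = solve-∀ ℚ-ring
    vanish : ∀ t y → t * 0ℚ + y ≡ y
    vanish = solve-∀ ℚ-ring

  bodyCoordinates : Point dim → Point dim
  bodyCoordinates x = barycentricMap β′ (Aut.inv A x)

  body-≐ : (Simplex dim 1ℚ ∘ bodyCoordinates) ≐ body
  body-≐ = (λ {x} → convex x) , (λ {x} → simplex x)
    where
    complement : ∀ c → sum c ≡ 1ℚ → 1ℚ - sum (c ∘ suc) ≡ c zero
    complement c ∑c≡1 = trans (cong (_- sum (c ∘ suc)) (sym ∑c≡1)) (cancel (c zero) (sum (c ∘ suc)))
      where
      cancel : ∀ x y → x + y - y ≡ x
      cancel = solve-∀ ℚ-ring
    x≗combination : ∀ x → x ≗ combination v (barycentric (Aut.inv A x))
    x≗combination x k = sym (trans (combination-barycentric (Aut.inv A x) k)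
      (Bijection.f∘g (Aut.forward A) x k))
    convex : ∀ x → Simplex dim 1ℚ (bodyCoordinates x) → body x
    convex x (0≤ , ∑≤1) = barycentric z ,
      (λ { zero → subst (0ℚ ≤_) (complement (barycentric z) (sum-barycentric z)) (p≤q⇒0≤q-p ∑≤1)
         ; (suc i) → 0≤ i }) ,
      sum-barycentric z , x≗combination x
      where z = Aut.inv A x
    simplex : ∀ x → body x → Simplex dim 1ℚ (bodyCoordinates x)
    simplex x (c , 0≤c , ∑c≡1 , x≗) =
      (λ i → subst (0ℚ ≤_) (c≗ (suc i)) (0≤c (suc i))) ,
      ≤-from (barycentric z zero) (complement (barycentric z) (sum-barycentric z)) (subst (0ℚ ≤_) (c≗ zero) (0≤c zero))
      where
      z = Aut.inv A x
      c≗ : c ≗ barycentric z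
      c≗ = combination-injective v independent c (barycentric z) (trans ∑c≡1 (sym (sum-barycentric z)))
        λ k → trans (sym (x≗ k)) (x≗combination x k)

  body-Vol : IsVol body (recip (β zero) * Aut.det A)
  body-Vol = volume (scaling-∘ (scaling-barycentricMap β′ (0<β zero) ∑β≡1) (Bijection.scalingᵍ (Aut.forward A))) body-≐

  Vol-product : recip (β zero) * Aut.det A * (product (recip ∘ β′) * Aut.codet A) ≡ product β⁻¹
  Vol-product = trans (regroup (recip (β zero)) (Aut.det A) (product (recip ∘ β′)) (Aut.codet A))
    (trans (cong (product β⁻¹ *_) (Aut.det*codet A)) (ℚ.*-identityʳ (product β⁻¹)))
    where
    regroup : ∀ a b c d → a * b * (c * d) ≡ a * c * (b * d)
    regroup = solve-∀ ℚ-ring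

  pairing : Fin (suc dim) → Fin (suc dim) → ℚ
  pairing i j = identity i j * β⁻¹ i - 1ℚ

  pairing-≢ : ∀ {i j} → i ≢ j → pairing i j ≡ - 1ℚ
  pairing-≢ {i} i≢j = trans (cong (λ w → w * β⁻¹ i - 1ℚ) (identity-≢ i≢j)) (vanish (β⁻¹ i))
    where
    vanish : ∀ h → 0ℚ * h - 1ℚ ≡ - 1ℚ
    vanish = solve-∀ ℚ-ring

  sum-pairing : ∀ c i → sum (λ j → c j * pairing i j) ≡ c i * β⁻¹ i - sum c
  sum-pairing c i = trans (sum-cong-≗ λ j → expand (c j) (identity i j) (β⁻¹ i))
    (trans (∑-distrib-+ (λ j → identity i j * (c j * β⁻¹ i)) (λ j → (- 1ℚ) * c j))
      (trans (cong₂ _+_ (⟨⟩-identityˡ i (λ j → c j * β⁻¹ i)) (sym (*-distribˡ-sum (- 1ℚ) c)))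
        (collect (c i * β⁻¹ i) (sum c))))
    where
    expand : ∀ c e h → c * (e * h - 1ℚ) ≡ e * (c * h) + (- 1ℚ) * c
    expand = solve-∀ ℚ-ring
    collect : ∀ x y → x + (- 1ℚ) * y ≡ x - y
    collect = solve-∀ ℚ-ring

  dualVertex : Vector (Point dim) (suc dim)
  dualVertex i = Aut.cotr A (pairing i ∘ suc)

  -- The pairings with `v (suc j)` hold by construction of `dualVertex`. The one with `v zero`
  -- follows because `β` annihilates both the actual pairings and the row `pairing i`.
  ⟨dualVertex,vertex⟩ : ∀ i j → ⟨ dualVertex i , v j ⟩ ≡ pairing i j
  ⟨dualVertex,vertex⟩ i (suc j) = trans (sym (tr≗ (dualVertex i) j)) (Bijection.f∘g (Aut.transposed A) (pairing i ∘ suc) j)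
  ⟨dualVertex,vertex⟩ i zero    = *-cancelˡ-≡ (β zero) (pos⇒≢0 (0<β zero)) (begin
    β zero * ⟨ dualVertex i , v zero ⟩  ≡⟨ isolate (β zero * ⟨ dualVertex i , v zero ⟩) X ⟩
    β zero * ⟨ dualVertex i , v zero ⟩ + X - X ≡⟨ cong (_- X) (trans (cong (β zero * ⟨ dualVertex i , v zero ⟩ +_) X≡) (balance (dualVertex i))) ⟩
    0ℚ - X  ≡⟨ cong (_- X) (sym total) ⟩
    β zero * pairing i zero + X - X  ≡⟨ isolate (β zero * pairing i zero) X ⟨
    β zero * pairing i zero  ∎)
    where
    open ≡-Reasoning
    X = sum (λ j → β′ j * pairing i (suc j))
    X≡ : X ≡ sum (λ j → β′ j * ⟨ dualVertex i , v (suc j) ⟩)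
    X≡ = sum-cong-≗ λ j → cong (β′ j *_) (sym (⟨dualVertex,vertex⟩ i (suc j)))
    isolate : ∀ x y → x ≡ x + y - y
    isolate = solve-∀ ℚ-ring
    total : β zero * pairing i zero + X ≡ 0ℚ
    total = trans (sum-pairing β i) (cong₂ _-_ (β*β⁻¹ i) ∑β≡1)

  dualVertex∈polar : ∀ i → dualVertex i ∈ polar body
  dualVertex∈polar i = polar-conv v {dualVertex i} λ j → subst (- 1ℚ ≤_) (sym (⟨dualVertex,vertex⟩ i j))
    (≤-from (identity i j * β⁻¹ i) (shift (identity i j * β⁻¹ i))
      (*-nonNeg (identity-nonNeg i j) (ℚ.<⇒≤ (recip-pos (0<β i)))))
    where
    shift : ∀ x → x - 1ℚ - - 1ℚ ≡ x
    shift = solve-∀ ℚ-ring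

  polar-isVertex : ∀ i {l} → 0 ℕ.< l → IsVertex (dilate l (polar body)) (λ c → fromNat l * dualVertex i c)
  polar-isVertex i = dilate-isVertex {S = polar body} v β
    (λ x x∈ j → x∈ (v j) (generator∈conv v j))
    (λ x _ → balance x)
    (λ x y _ _ x≗y c → trans (sym (Bijection.g∘f (Aut.transposed A) x c))
      (trans (Bijection.g-cong (Aut.transposed A) (λ j → trans (tr≗ x j) (trans (x≗y (suc j)) (sym (tr≗ y j)))) c)
        (Bijection.g∘f (Aut.transposed A) y c)))
    i (pos⇒≢0 (0<β i)) (dualVertex∈polar i)
    (λ j j≢i → trans (⟨dualVertex,vertex⟩ i j) (pairing-≢ (j≢i ∘ sym)))

  ⟨body,dualVertex⟩ : ∀ {x} (x∈ : body x) j → ⟨ x , dualVertex j ⟩ ≡ proj₁ x∈ j * β⁻¹ j - 1ℚ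
  ⟨body,dualVertex⟩ {x} (c , _ , ∑c≡1 , x≗) j = begin
    ⟨ x , dualVertex j ⟩  ≡⟨ ⟨⟩-comm x (dualVertex j) ⟩
    ⟨ dualVertex j , x ⟩  ≡⟨ ⟨⟩-cong {u = dualVertex j} (λ _ → refl) x≗ ⟩
    ⟨ dualVertex j , combination v c ⟩  ≡⟨ ⟨combination⟩ v c (dualVertex j) ⟩
    sum (λ i → c i * ⟨ dualVertex j , v i ⟩)  ≡⟨ sum-cong-≗ (λ i → cong (c i *_) (⟨dualVertex,vertex⟩ j i)) ⟩
    sum (λ i → c i * pairing j i)  ≡⟨ sum-pairing c j ⟩
    c j * β⁻¹ j - sum c  ≡⟨ cong (λ w → c j * β⁻¹ j - w) ∑c≡1 ⟩
    c j * β⁻¹ j - 1ℚ  ∎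
    where open ≡-Reasoning

  body-isVertex : ∀ i {k} → 0 ℕ.< k → IsVertex (dilate k body) (λ c → fromNat k * v i c)
  body-isVertex i = dilate-isVertex {S = body} dualVertex β
    (λ x x∈ j → subst (- 1ℚ ≤_) (⟨⟩-comm (dualVertex j) x) (dualVertex∈polar j x x∈))
    balanced separated i (pos⇒≢0 (0<β i)) (generator∈conv v i)
    (λ j j≢i → trans (⟨⟩-comm (v i) (dualVertex j)) (trans (⟨dualVertex,vertex⟩ j i) (pairing-≢ j≢i)))
    where
    balanced : ∀ x → body x → sum (λ j → β j * ⟨ x , dualVertex j ⟩) ≡ 0ℚ
    balanced x x∈@(c , _ , ∑c≡1 , _) = trans (sum-cong-≗ term)
      (trans (∑-distrib-+ c (λ j → (- 1ℚ) * β j)) (cong₂ _+_ ∑c≡1 (trans (sym (*-distribˡ-sum (- 1ℚ) β)) (cong ((- 1ℚ) *_) ∑β≡1))))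
      where
      expand : ∀ b c h → b * (c * h - 1ℚ) ≡ b * h * c + (- 1ℚ) * b
      expand = solve-∀ ℚ-ring
      term : ∀ j → β j * ⟨ x , dualVertex j ⟩ ≡ c j + (- 1ℚ) * β j
      term j = trans (cong (β j *_) (⟨body,dualVertex⟩ {x} x∈ j))
        (trans (expand (β j) (c j) (β⁻¹ j))
          (cong (_+ (- 1ℚ) * β j) (trans (cong (_* c j) (β*β⁻¹ j)) (ℚ.*-identityˡ (c j)))))
    separated : ∀ x y → body x → body y → (∀ j → ⟨ x , dualVertex j ⟩ ≡ ⟨ y , dualVertex j ⟩) → x ≗ y
    separated x y x∈@(b , _ , _ , x≗) y∈@(c , _ , _ , y≗) eq k =
      trans (x≗ k) (trans (sum-cong-≗ λ i → cong (_* v i k) (b≗c i)) (sym (y≗ k)))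
      where
      restore : ∀ x → x ≡ x - 1ℚ + 1ℚ
      restore = solve-∀ ℚ-ring
      b≗c : b ≗ c
      b≗c j = *-cancelˡ-≡ (β⁻¹ j) (pos⇒≢0 (recip-pos (0<β j)))
        (trans (ℚ.*-comm (β⁻¹ j) (b j)) (trans
          (trans (restore (b j * β⁻¹ j)) (trans (cong (_+ 1ℚ)
            (trans (sym (⟨body,dualVertex⟩ {x} x∈ j)) (trans (eq j) (⟨body,dualVertex⟩ {y} y∈ j))))
            (sym (restore (c j * β⁻¹ j)))))
          (ℚ.*-comm (c j) (β⁻¹ j))))

-- Integral pairings

Integer : ℚ → Set
Integer q = ∃[ z ] q ≡ fromℤ z

integer-+ : ∀ {p q} → Integer p → Integer q → Integer (p + q)
integer-+ (y , refl) (z , refl) = y ℤ.+ z , sym (fromℤ-homo-+ y z)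

integer-* : ∀ {p q} → Integer p → Integer q → Integer (p * q)
integer-* (y , refl) (z , refl) = y ℤ.* z , sym (fromℤ-homo-* y z)

integer-⟨⟩ : ∀ {x y : Point n} → (∀ i → Integer (x i)) → (∀ i → Integer (y i)) → Integer ⟨ x , y ⟩
integer-⟨⟩ {zero}  _ _ = ℤ.+ 0 , refl
integer-⟨⟩ {suc n} x∈ℤ y∈ℤ = integer-+ (integer-* (x∈ℤ zero) (y∈ℤ zero)) (integer-⟨⟩ (x∈ℤ ∘ suc) (y∈ℤ ∘ suc))

-- Images of convex hulls

conv-cong : ∀ {v w : Vector (Point d) n} → (∀ i → v i ≗ w i) → conv v ⊆ conv w
conv-cong v≗w (c , 0≤c , ∑c≡1 , x≗) =
  c , 0≤c , ∑c≡1 , λ k → trans (x≗ k) (sum-cong-≗ λ i → cong (c i *_) (v≗w i k))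

conv-permute : ∀ (v : Vector (Point d) n) (π : Permutation n n) → conv v ≐ conv (λ i → v (π ⟨$⟩ʳ i))
conv-permute {d} {n} v π = (λ {x} → forth v π {x}) , (λ {x} x∈ → conv-cong
    (λ i k → cong (λ j → v j k) (Permutation.inverseʳ π)) (forth (λ i → v (π ⟨$⟩ʳ i)) (Permutation.flip π) {x} x∈))
  where
  forth : ∀ (v : Vector (Point d) n) (π : Permutation n n) → conv v ⊆ conv (λ i → v (π ⟨$⟩ʳ i))
  forth v π (c , 0≤c , ∑c≡1 , x≗) = (λ i → c (π ⟨$⟩ʳ i)) , (λ i → 0≤c (π ⟨$⟩ʳ i)) ,
    trans (sym (sum-permute c π)) ∑c≡1 ,
    λ k → trans (x≗ k) (sum-permute (λ i → c i * v i k) π)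

infixr 8 _·_
_·_ : Matrix ℚ d d → Point d → Point d
(M · x) i = ⟨ M i , x ⟩

image-conv : ∀ (M : Matrix ℚ d d) (v : Vector (Point d) n) → image M (conv v) ≐ conv (λ j → M · v j)
image-conv M v =
  (λ (y , (c , 0≤c , ∑c≡1 , y≗) , x≗) → c , 0≤c , ∑c≡1 ,
    λ i → trans (x≗ i) (trans (⟨⟩-cong {u = M i} (λ _ → refl) y≗) (⟨combination⟩ v c (M i)))) ,
  (λ (c , 0≤c , ∑c≡1 , x≗) → combination v c , (c , 0≤c , ∑c≡1 , λ _ → refl) ,
    λ i → trans (x≗ i) (sym (⟨combination⟩ v c (M i))))

image-mono : ∀ (M : Matrix ℚ d d) {S T : Subset d} → S ⊆ T → image M S ⊆ image M T
image-mono M S⊆T (y , y∈S , x≗) = y , S⊆T y∈S , x≗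

-- Elements of the general linear groups

private
  module ℤLinear = LinearAlgebra ℤ.+-*-commutativeRing

  ℤ-sum-zero : ∀ (f : Fin n → ℤ) → ℤLinear.sum (λ j → ℤ.+ 0 ℤ.* f j) ≡ ℤ.+ 0
  ℤ-sum-zero {zero}  f = refl
  ℤ-sum-zero {suc n} f = cong₂ ℤ._+_ (ℤ.*-zeroˡ (f zero)) (ℤ-sum-zero (f ∘ suc))

  ℤ-identity-suc : ∀ (i j : Fin n) → ℤLinear.identity (suc i) (suc j) ≡ ℤLinear.identity i j
  ℤ-identity-suc i j with i ≟ᶠ j
  ... | yes refl = refl
  ... | no  _    = refl

  ℤ-sum-identity : ∀ i (f : Fin n → ℤ) → ℤLinear.sum (λ j → ℤLinear.identity i j ℤ.* f j) ≡ f i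
  ℤ-sum-identity zero    f = trans (cong₂ ℤ._+_ (ℤ.*-identityˡ (f zero)) (ℤ-sum-zero (f ∘ suc))) (ℤ.+-identityʳ (f zero))
  ℤ-sum-identity (suc i) f = trans (cong₂ ℤ._+_ (ℤ.*-zeroˡ (f zero))
    (trans (ℤ-sum-cong λ j → cong (ℤ._* f (suc j)) (ℤ-identity-suc i j)) (ℤ-sum-identity i (f ∘ suc))))
    (ℤ.+-identityˡ (f (suc i)))
    where
    ℤ-sum-cong : ∀ {n} {f g : Fin n → ℤ} → f ≗ g → ℤLinear.sum f ≡ ℤLinear.sum g
    ℤ-sum-cong {zero}  f≗g = refl
    ℤ-sum-cong {suc n} f≗g = cong₂ ℤ._+_ (f≗g zero) (ℤ-sum-cong (f≗g ∘ suc))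

  fromℤ-identity : ∀ (i j : Fin n) → fromℤ (ℤLinear.identity i j) ≡ identity i j
  fromℤ-identity i j with i ≟ᶠ j
  ... | yes _ = refl
  ... | no  _ = refl

identityℤ : GLℤ d
identityℤ = record
  { matrix   = ℤLinear.identity
  ; inverse  = ℤLinear.identity
  ; inverseˡ = λ i j → ℤ-sum-identity i (λ k → ℤLinear.identity k j)
  ; inverseʳ = λ i j → ℤ-sum-identity i (λ k → ℤLinear.identity k j)
  }

≐⇒≅ : ∀ {S T : Subset d} → (∀ {x y} → x ≗ y → T x → T y) → S ≐ T → S ≅ T
≐⇒≅ T-resp (S⊆T , T⊆S) = identityℤ ,
  (λ {x} x∈S → x , S⊆T x∈S , λ i → sym (unit i x)) ,
  (λ {x} (y , y∈T , x≗) → T⊆S (T-resp (λ i → sym (trans (x≗ i) (unit i y))) y∈T))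
  where
  unit : ∀ i (x : Point _) → ⟨ (λ j → fromℤ (ℤLinear.identity i j)) , x ⟩ ≡ x i
  unit i x = trans (⟨⟩-cong {x = x} (fromℤ-identity i) (λ _ → refl)) (⟨⟩-identityˡ i x)

-- Adjointness takes the place of linearity of `inv A`. The rows `cotr A (identity i)` give a left
-- inverse at once; `inverse-entry` shows that the columns of the same matrix are
-- `inv A (identity j)`, which gives the right inverse.
Aut⇒GL : ∀ (M : Matrix ℚ d d) (A : Aut d) → (∀ x → fwd A x ≗ M · x) → Σ[ H ∈ GLℚ d ] GLℚ.matrix H ≡ M
Aut⇒GL M A fwd≗ = record
  { matrix   = M
  ; inverse  = λ i → cotr A (identity i)
  ; inverseˡ = λ i j → begin
      ⟨ cotr A (identity i) , (λ k → M k j) ⟩  ≡⟨ ⟨⟩-cong {u = cotr A (identity i)} (λ _ → refl) (λ k → sym (trans (fwd≗ (identity j) k) (⟨⟩-identityʳ (M k) j))) ⟩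
      ⟨ cotr A (identity i) , fwd A (identity j) ⟩  ≡⟨ adjoint A (cotr A (identity i)) (identity j) ⟨
      ⟨ tr A (cotr A (identity i)) , identity j ⟩  ≡⟨ ⟨⟩-identityʳ (tr A (cotr A (identity i))) j ⟩
      tr A (cotr A (identity i)) j  ≡⟨ f∘g (transposed A) (identity i) j ⟩
      identity i j  ∎
  ; inverseʳ = λ i j → begin
      ⟨ M i , (λ k → cotr A (identity k) j) ⟩  ≡⟨ ⟨⟩-cong {u = M i} (λ _ → refl) (λ k → inverse-entry k j) ⟩
      ⟨ M i , inv A (identity j) ⟩  ≡⟨ fwd≗ (inv A (identity j)) i ⟨
      fwd A (inv A (identity j)) i  ≡⟨ f∘g (forward A) (identity j) i ⟩
      identity j i  ≡⟨ identity-sym j i ⟩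
      identity i j  ∎
  } , refl
  where
  open ≡-Reasoning
  inverse-entry : ∀ k j → cotr A (identity k) j ≡ inv A (identity j) k
  inverse-entry k j = begin
    cotr A (identity k) j  ≡⟨ ⟨⟩-identityʳ (cotr A (identity k)) j ⟨
    ⟨ cotr A (identity k) , identity j ⟩  ≡⟨ ⟨⟩-cong {u = cotr A (identity k)} (λ _ → refl) (λ c → sym (f∘g (forward A) (identity j) c)) ⟩
    ⟨ cotr A (identity k) , fwd A (inv A (identity j)) ⟩  ≡⟨ adjoint A (cotr A (identity k)) (inv A (identity j)) ⟨
    ⟨ tr A (cotr A (identity k)) , inv A (identity j) ⟩  ≡⟨ ⟨⟩-cong {x = inv A (identity j)} (f∘g (transposed A) (identity k)) (λ _ → refl) ⟩
    ⟨ identity k , inv A (identity j) ⟩  ≡⟨ ⟨⟩-identityˡ k (inv A (identity j)) ⟩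
    inv A (identity j) k  ∎

-- Two simplices with the same convex hull have the same vertices

injective⇒permutation : ∀ (f : Fin n → Fin n) → (∀ {i j} → f i ≡ f j → i ≡ j) →
                        Σ[ π ∈ Permutation n n ] ∀ i → π ⟨$⟩ʳ i ≡ f i
injective⇒permutation {n} f injective =
  Permutation.permutation f (λ j → proj₁ (surjective f injective j)) (λ j → proj₂ (surjective f injective j))
    (λ i → injective (proj₂ (surjective f injective (f i)))) , λ _ → refl
  where
  surjective : ∀ {n} (f : Fin n → Fin n) → (∀ {i j} → f i ≡ f j → i ≡ j) → ∀ j → ∃[ i ] f i ≡ j
  surjective {suc n} f injective j with any? (λ i → f i ≟ᶠ j)
  ... | yes p = p
  -- A value missed by `f` can be punched out, which would give an injection into a smaller finite
  -- set.
  ... | no ¬p = contradiction (λ {i} {k} → punched {i} {k}) (<⇒notInjective ℕ.≤-refl)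
    where
    j≢f : ∀ i → j ≢ f i
    j≢f i eq = ¬p (i , sym eq)
    punched : ∀ {i k} → punchOut (j≢f i) ≡ punchOut (j≢f k) → i ≡ k
    punched {i} {k} eq = injective (punchOut-injective (j≢f i) (j≢f k) eq)

term-≤-sum : ∀ {x : Point n} → (∀ i → 0ℚ ≤ x i) → ∀ i → x i ≤ sum x
term-≤-sum {x = x} 0≤x zero    = ≤-from _ (cancel (x zero) (sum (x ∘ suc))) (sum-nonNeg (0≤x ∘ suc))
  where
  cancel : ∀ a b → a + b - a ≡ b
  cancel = solve-∀ ℚ-ring
term-≤-sum {x = x} 0≤x (suc i) = ℚ.≤-trans (term-≤-sum (0≤x ∘ suc) i) (≤-from _ (cancel (x zero) (sum (x ∘ suc))) (0≤x zero))
  where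
  cancel : ∀ a b → a + b - b ≡ a
  cancel = solve-∀ ℚ-ring

-- With M and N the stochastic matrices expressing v through w and w through v, M N = 1 by affine
-- independence; a nonzero entry M i j then forces row j of N to be the i-th unit vector, i.e. w j = v i.
module SameHull {d} (v w : Vector (Point d) (suc d)) (independent : AffinelyIndependent v)
                (v⊆w : conv v ⊆ conv w) (w⊆v : conv w ⊆ conv v) where
  private
    M N : Matrix ℚ (suc d) (suc d)
    M i = proj₁ (v⊆w (generator∈conv v i))
    N j = proj₁ (w⊆v (generator∈conv w j))

    0≤M : ∀ i j → 0ℚ ≤ M i j
    0≤M i = proj₁ (proj₂ (v⊆w (generator∈conv v i)))
    0≤N : ∀ i j → 0ℚ ≤ N i j
    0≤N j = proj₁ (proj₂ (w⊆v (generator∈conv w j)))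
    ∑M≡1 : ∀ i → sum (M i) ≡ 1ℚ
    ∑M≡1 i = proj₁ (proj₂ (proj₂ (v⊆w (generator∈conv v i))))
    ∑N≡1 : ∀ j → sum (N j) ≡ 1ℚ
    ∑N≡1 j = proj₁ (proj₂ (proj₂ (w⊆v (generator∈conv w j))))
    v≗Mw : ∀ i → v i ≗ combination w (M i)
    v≗Mw i = proj₂ (proj₂ (proj₂ (v⊆w (generator∈conv v i))))
    w≗Nv : ∀ j → w j ≗ combination v (N j)
    w≗Nv j = proj₂ (proj₂ (proj₂ (w⊆v (generator∈conv w j))))

    through : Point (suc d) → Point (suc d)
    through c k = sum (λ j → c j * N j k)

    sum-through : ∀ c → sum (through c) ≡ sum c
    sum-through c = trans (∑-comm (λ k j → c j * N j k)) (sum-cong-≗ λ j →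
      trans (sym (*-distribˡ-sum (c j) (N j))) (trans (cong (c j *_) (∑N≡1 j)) (ℚ.*-identityʳ (c j))))

    combination-through : ∀ c → combination v (through c) ≗ combination w c
    combination-through c k = trans (⟨⟩-sum c N (λ i → v i k)) (sum-cong-≗ λ j → cong (c j *_) (sym (w≗Nv j k)))

    MN≗identity : ∀ i → through (M i) ≗ identity i
    MN≗identity i = combination-injective v independent (through (M i)) (identity i)
      (trans (sum-through (M i)) (trans (∑M≡1 i) (sym (sum-identity i))))
      λ k → trans (combination-through (M i) k) (trans (sym (v≗Mw i k)) (combination-identity v i k))

    nonzero : ∀ i → ∃[ j ] M i j ≢ 0ℚ
    nonzero i = ¬∀⟶∃¬ (suc d) (λ j → M i j ≡ 0ℚ) (λ j → M i j ℚ.≟ 0ℚ) λ M≡0 →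
      ℚ.1≢0 (trans (sym (∑M≡1 i)) (trans (sum-cong-≗ M≡0) (sum-replicate-zero (suc d))))

    σ : Fin (suc d) → Fin (suc d)
    σ i = proj₁ (nonzero i)

    N-off-diagonal : ∀ i k → k ≢ i → N (σ i) k ≡ 0ℚ
    N-off-diagonal i k k≢i = *-cancelˡ-≡ (M i (σ i)) (proj₂ (nonzero i)) (trans
      (ℚ.≤-antisym
        (subst (M i (σ i) * N (σ i) k ≤_) (trans (MN≗identity i k) (identity-≢ (k≢i ∘ sym)))
          (term-≤-sum (λ j → *-nonNeg (0≤M i j) (0≤N j k)) (σ i)))
        (*-nonNeg (0≤M i (σ i)) (0≤N (σ i) k)))
      (sym (ℚ.*-zeroʳ (M i (σ i)))))

    N≗identity : ∀ i → N (σ i) ≗ identity i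
    N≗identity i k = entry (i ≟ᶠ k)
      where
      entry : Dec (i ≡ k) → N (σ i) k ≡ identity i k
      entry (yes refl) = trans (sym (sum-single i (N (σ i)) (N-off-diagonal i))) (trans (∑N≡1 (σ i)) (sym (identity-refl i)))
      entry (no i≢k)   = trans (N-off-diagonal i k (i≢k ∘ sym)) (sym (identity-≢ i≢k))

    σ-injective : ∀ {i j} → σ i ≡ σ j → i ≡ j
    σ-injective {i} {j} eq = decided (i ≟ᶠ j)
      where
      decided : Dec (i ≡ j) → i ≡ j
      decided (yes i≡j) = i≡j
      decided (no i≢j)  = contradiction
        (trans (sym (identity-refl i)) (trans (sym (N≗identity i i))
          (trans (cong (λ k → N k i) eq) (trans (N≗identity j i) (identity-≢ (i≢j ∘ sym))))))
        ℚ.1≢0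

    π = proj₁ (injective⇒permutation σ σ-injective)

  -- `through γ` expresses the point with weights `γ` on `w` by weights on `v`, where weights are
  -- unique; and `N` is a permutation matrix.
  weights-agree : ∀ (β γ : Point (suc d)) → sum β ≡ sum γ → combination v β ≗ combination w γ →
                  Σ[ π ∈ Permutation (suc d) (suc d) ] ∀ k → β k ≡ γ (π ⟨$⟩ʳ k)
  weights-agree β γ ∑β≡∑γ β≗γ = π , λ k → begin
    β k  ≡⟨ combination-injective v independent β (through γ) (trans ∑β≡∑γ (sym (sum-through γ))) (λ c → trans (β≗γ c) (sym (combination-through γ c))) k ⟩
    sum (λ j → γ j * N j k)  ≡⟨ sum-permute (λ j → γ j * N j k) π ⟩
    sum (λ i → γ (σ i) * N (σ i) k)  ≡⟨ sum-cong-≗ (λ i → trans (cong (γ (σ i) *_) (trans (N≗identity i k) (identity-sym i k))) (ℚ.*-comm (γ (σ i)) (identity k i))) ⟩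
    sum (λ i → identity k i * γ (σ i))  ≡⟨ ⟨⟩-identityˡ k (γ ∘ σ) ⟩
    γ (σ k)  ∎
    where open ≡-Reasoning

-- Barycentric coordinates of an interior origin

module Origin {d n} (v : Vector (Point d) n) (independent : AffinelyIndependent v)
              (interior : (λ _ → 0ℚ) ∈ Interior (conv v)) where
  private
    ε = proj₁ interior
    0<ε = proj₁ (proj₂ interior)
    ball = proj₂ (proj₂ interior)
    center = ball (λ _ → 0ℚ) (λ _ → ℚ.<⇒≤ 0<ε)

  β : Point n
  β = proj₁ center

  ∑β≡1 : sum β ≡ 1ℚ
  ∑β≡1 = proj₁ (proj₂ (proj₂ center))

  origin : combination v β ≗ λ _ → 0ℚ
  origin k = sym (proj₂ (proj₂ (proj₂ center)) k)

  -- For small τ the point −τ vᵢ = ∑ⱼ cⱼ vⱼ still lies in the hull, so that (1 + τ) βᵢ = cᵢ + τ.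
  0<β : ∀ i → 0ℚ < β i
  0<β i = *-cancelˡ-< (1ℚ + τ) (+-pos-nonNeg 0<1 (ℚ.<⇒≤ 0<τ))
    (subst₂ _<_ (sym (ℚ.*-zeroʳ (1ℚ + τ))) (sym (trans (weights i) (cong (λ e → τ * e + c i) (identity-refl i))))
      (+-pos-nonNeg (subst (0ℚ <_) (sym (ℚ.*-identityʳ τ)) 0<τ) (0≤c i)))
    where
    size = sum (λ k → ∣ v i k ∣)
    0<1+size : 0ℚ < 1ℚ + size
    0<1+size = +-pos-nonNeg 0<1 (sum-nonNeg λ k → ℚ.0≤∣p∣ (v i k))
    -- `size` bounds the sup-norm of `v i`, so `−τ vᵢ` stays in the ball of radius `ε`; the 1 avoids
    -- a division by 0.
    τ = ε * recip (1ℚ + size)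
    0<τ : 0ℚ < τ
    0<τ = *-pos 0<ε (recip-pos 0<1+size)
    x : Point d
    x k = - (τ * v i k)
    τ*≡ε : τ * (1ℚ + size) ≡ ε
    τ*≡ε = trans (rearrange ε (recip (1ℚ + size)) (1ℚ + size))
      (trans (cong (ε *_) (*-recip-pos 0<1+size)) (ℚ.*-identityʳ ε))
      where
      rearrange : ∀ e h s → e * h * s ≡ e * (s * h)
      rearrange = solve-∀ ℚ-ring
    ∣x-0∣ : ∀ k → ∣ x k - 0ℚ ∣ ≡ τ * ∣ v i k ∣
    ∣x-0∣ k = trans (cong ∣_∣ (ℚ.+-identityʳ (x k))) (trans (ℚ.∣-p∣≡∣p∣ (τ * v i k))
      (trans (ℚ.∣p*q∣≡∣p∣*∣q∣ τ (v i k)) (cong (_* ∣ v i k ∣) (ℚ.0≤p⇒∣p∣≡p (ℚ.<⇒≤ 0<τ)))))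
    near : ∀ k → ∣ x k - 0ℚ ∣ ≤ ε
    near k = subst₂ _≤_ (sym (∣x-0∣ k)) τ*≡ε (*-monoˡ-≤ τ (ℚ.<⇒≤ 0<τ)
      (ℚ.≤-trans (term-≤-sum (λ k → ℚ.0≤∣p∣ (v i k)) k) (≤-from 1ℚ (cancel size) 0≤1)))
      where
      cancel : ∀ s → 1ℚ + s - s ≡ 1ℚ
      cancel = solve-∀ ℚ-ring
    x∈ = ball x near
    c = proj₁ x∈
    0≤c = proj₁ (proj₂ x∈)
    weights : ∀ j → (1ℚ + τ) * β j ≡ τ * identity i j + c j
    weights = combination-injective v independent (λ j → (1ℚ + τ) * β j) (λ j → τ * identity i j + c j)
      (trans (trans (sym (*-distribˡ-sum (1ℚ + τ) β)) (cong ((1ℚ + τ) *_) ∑β≡1))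
        (sym (trans (∑-distrib-+ (λ j → τ * identity i j) c)
          (trans (cong₂ _+_ (trans (sym (*-distribˡ-sum τ (identity i))) (cong (τ *_) (sum-identity i))) (proj₁ (proj₂ (proj₂ x∈))))
            (collect τ)))))
      λ k → trans (trans (⟨⟩-* (1ℚ + τ) β (λ j → v j k)) (trans (cong ((1ℚ + τ) *_) (origin k)) (ℚ.*-zeroʳ (1ℚ + τ))))
        (sym (trans (⟨⟩-+ (λ j → τ * identity i j) c (λ j → v j k))
          (trans (cong₂ _+_ (trans (⟨⟩-* τ (identity i) (λ j → v j k)) (cong (τ *_) (⟨⟩-identityˡ i (λ j → v j k))))
                            (sym (proj₂ (proj₂ (proj₂ x∈)) k)))
            (ℚ.+-inverseʳ (τ * v i k)))))
      where
      collect : ∀ t → t * 1ℚ + 1ℚ ≡ (1ℚ + t) * 1ℚ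
      collect = solve-∀ ℚ-ring

-- The extremal simplex

product-const : ∀ n x → product {n} (λ _ → x) ≡ x ^ n
product-const zero    x = refl
product-const (suc n) x = cong (x *_) (product-const n x)

/≡*recip : ∀ z m .{{_ : NonZero m}} → z / m ≡ fromℤ z * recip (fromNat m)
/≡*recip z m@(suc _) = begin
  z / m  ≡⟨ ℚ.*-identityʳ (z / m) ⟨
  z / m * 1ℚ  ≡⟨ cong (z / m *_) (*-recip-pos (fromNat-pos m (ℕ.s≤s ℕ.z≤n))) ⟨
  z / m * (fromNat m * recip (fromNat m)) ≡⟨ ℚ.*-assoc (z / m) (fromNat m) (recip (fromNat m)) ⟨
  z / m * fromNat m * recip (fromNat m)  ≡⟨ cong (_* recip (fromNat m)) (/-*-cancel z m) ⟩
  fromℤ z * recip (fromNat m)  ∎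
  where open ≡-Reasoning

private
  ^-+2 : ∀ x n → x ^ (n ℕ.+ 2) ≡ x ^ suc n * x
  ^-+2 x zero    = trans (cong (x *_) (ℚ.*-identityʳ x)) (cong (_* x) (sym (ℚ.*-identityʳ x)))
  ^-+2 x (suc n) = trans (cong (x *_) (^-+2 x n)) (sym (ℚ.*-assoc x (x ^ suc n) x))

denominator-≡ : ∀ g d → fromNat (g ℕ.^ (d ℕ.+ 2)) ≡ fromNat g ^ suc d * fromNat g
denominator-≡ g d = trans (fromNat-homo-^ g (d ℕ.+ 2)) (^-+2 (fromNat g) d)

volumeBound-* : ∀ g d .{{_ : NonZero g}} → volumeBound g d * fromNat (g ℕ.^ (d ℕ.+ 2)) ≡
                fromNat (sylvesterPred g d) * fromNat (sylvesterPred g d)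
volumeBound-* g d = trans (/-*-cancel (ℤ.+ (t ℕ.^ 2)) (g ℕ.^ (d ℕ.+ 2)) {{ℕ.m^n≢0 g (d ℕ.+ 2)}})
  (trans (fromNat-homo-^ t 2) (cong (fromNat t *_) (ℚ.*-identityʳ (fromNat t))))
  where
  t = sylvesterPred g d

-- aᵢ = g/βᵢ turns barycentric coordinates of the origin into denominators of unit fractions.
module Weights {n} {G : ℚ} (0<G : 0ℚ < G) (A : Fin n → ℕ) (β : Point n) (0<β : ∀ i → 0ℚ < β i)
               (A≡ : ∀ i → fromNat (A i) ≡ G * recip (β i)) where

  ∏≡ : ∏ A ≡ product (recip ∘ β) * G ^ n
  ∏≡ = trans (product-cong-≗ A≡) (trans (∏-distrib-* (λ _ → G) (recip ∘ β))
    (trans (cong (_* product (recip ∘ β)) (product-const n G)) (ℚ.*-comm (G ^ n) (product (recip ∘ β)))))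

  recip-A : ∀ i → recip (fromNat (A i)) ≡ β i * recip G
  recip-A i = sym (recip-unique {fromNat (A i)} (begin
    fromNat (A i) * (β i * recip G)  ≡⟨ cong (_* (β i * recip G)) (A≡ i) ⟩
    G * recip (β i) * (β i * recip G)  ≡⟨ regroup G (recip (β i)) (β i) (recip G) ⟩
    (G * recip G) * (β i * recip (β i))  ≡⟨ cong₂ _*_ (*-recip-pos 0<G) (*-recip-pos (0<β i)) ⟩
    1ℚ  ∎))
    where
    open ≡-Reasoning
    regroup : ∀ a b c d → a * b * (c * d) ≡ (a * d) * (c * b)
    regroup = solve-∀ ℚ-ring

  ∑recip≡ : ∑recip A ≡ sum β * recip G
  ∑recip≡ = trans (sum-cong-≗ recip-A) (sym (*-distribʳ-sum (recip G) β))

  β≡ : ∀ i → β i ≡ G * recip (fromNat (A i))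
  β≡ i = sym (trans (cong (G *_) (recip-A i)) (trans (rearrange G (β i) (recip G))
    (trans (cong (_* β i) (*-recip-pos 0<G)) (ℚ.*-identityˡ (β i)))))
    where
    rearrange : ∀ g b h → g * (b * h) ≡ g * h * b
    rearrange = solve-∀ ℚ-ring

sylvesters≡sylvester : ∀ g n i → sylvesters g n i ≡ sylvester g (toℕ (opposite i))
sylvesters≡sylvester g (suc n) zero    = cong (sylvester g) (sym (toℕ-fromℕ n))
sylvesters≡sylvester g (suc n) (suc i) = trans (sylvesters≡sylvester g n i) (cong (sylvester g) (sym (opposite-suc i)))

module ExtremalSimplex (g d : ℕ) (0<g : 0 ℕ.< g) where
  open Egyptian g 0<g

  -- The estimate lists Sylvester numbers in descending order, the matrix in ascending order. Index
  -- 0, which carries `t`, is fixed.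
  reversal : Permutation (suc d) (suc d)
  reversal = Permutation.lift₀ (Permutation.permutation opposite opposite opposite-involutive opposite-involutive)

  B : Fin (suc d) → ℕ
  B i = extremal d (reversal ⟨$⟩ʳ i)

  b : Fin (suc d) → ℚ
  b i = fromNat (B i)

  0<b : ∀ i → 0ℚ < b i
  0<b i = 0<extremal d (reversal ⟨$⟩ʳ i)

  B-suc : ∀ j → B (suc j) ≡ sylvester g (toℕ j)
  B-suc j = trans (sylvesters≡sylvester g d (opposite j)) (cong (sylvester g ∘ toℕ) (opposite-involutive j))

  γ : Point (suc d)
  γ i = G * recip (b i)

  0<γ : ∀ i → 0ℚ < γ i
  0<γ i = *-pos 0<G (recip-pos (0<b i))

  B≡ : ∀ i → b i ≡ G * recip (γ i)
  B≡ i = *-cancelˡ-≡ (γ i) (pos⇒≢0 (0<γ i)) (begin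
    G * recip (b i) * b i  ≡⟨ rearrange₁ G (recip (b i)) (b i) ⟩
    G * (b i * recip (b i))  ≡⟨ cong (G *_) (trans (*-recip-pos (0<b i)) (sym (*-recip-pos (0<γ i)))) ⟩
    G * (γ i * recip (γ i))  ≡⟨ rearrange₂ G (γ i) (recip (γ i)) ⟩
    γ i * (G * recip (γ i))  ∎)
    where
    open ≡-Reasoning
    rearrange₁ : ∀ g h b → g * h * b ≡ g * (b * h)
    rearrange₁ = solve-∀ ℚ-ring
    rearrange₂ : ∀ g c h → g * (c * h) ≡ c * (g * h)
    rearrange₂ = solve-∀ ℚ-ring

  ∑γ≡1 : sum γ ≡ 1ℚ
  ∑γ≡1 = trans (sym (*-distribˡ-sum G (λ i → recip (b i))))
    (trans (cong (G *_) (trans (sym (sum-permute (λ i → recip (fromNat (extremal d i))) reversal)) (∑recip-extremal d)))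
      (*-recip-pos 0<G))

  product-recip-γ : product (recip ∘ γ) * (G ^ suc d * G) ≡ T d * T d
  product-recip-γ = begin
    product (recip ∘ γ) * (G ^ suc d * G)  ≡⟨ ℚ.*-assoc (product (recip ∘ γ)) (G ^ suc d) G ⟨
    product (recip ∘ γ) * G ^ suc d * G  ≡⟨ cong (_* G) (Weights.∏≡ 0<G B γ 0<γ B≡) ⟨
    ∏ B * G  ≡⟨ cong (_* G) (sym (product-permute (λ i → fromNat (extremal d i)) reversal)) ⟩
    ∏ (extremal d) * G  ≡⟨ ∏-extremal d ⟩
    T d * T d  ∎
    where open ≡-Reasoning

  -- Brings the last column to index 0, where its weight is `g / t`, and the unit vectors to the
  -- indices `suc j`.
  columns : Permutation (suc d) (suc d)
  columns = Permutation.insert zero (fromℕ d) Permutation.id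

  vertices : Vector (Point d) (suc d)
  vertices i = V.transpose (extremalMatrix g d) (columns ⟨$⟩ʳ i)

  columnHull-≐ : columnHull (extremalMatrix g d) ≐ conv vertices
  columnHull-≐ = conv-permute (V.transpose (extremalMatrix g d)) columns

  vertices-suc : ∀ j → vertices (suc j) ≗ identity j
  vertices-suc j k = trans (cong (λ i → extremalMatrix g d k i) (Permutation.insert-punchIn zero (fromℕ d) Permutation.id j))
    (cong (λ x → x k) (insertAt-punchIn identity (fromℕ d) _ j))

  vertices-zero : ∀ k → vertices zero k ≡ - (T d * recip (b (suc k)))
  vertices-zero k = trans (cong (λ x → x k) (insertAt-lookup identity (fromℕ d) _))
    (cong -_ (trans (/≡*recip (ℤ.+ sylvesterPred g d) (sylvester g (toℕ k)))
      (cong (λ m → T d * recip (fromNat m)) (sym (B-suc k)))))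

  -- In coordinate `k` the last column contributes `(g / t) * (− t / s)` and the unit vector
  -- `g / s`, for the same Sylvester number `s`. This fixes the entries of the matrix.
  origin : combination vertices γ ≗ λ _ → 0ℚ
  origin k = begin
    γ zero * vertices zero k + sum (λ j → γ (suc j) * vertices (suc j) k)  ≡⟨ cong₂ _+_ (cong (γ zero *_) (vertices-zero k)) (sum-cong-≗ λ j → trans (cong (γ (suc j) *_) (trans (vertices-suc j k) (identity-sym j k))) (ℚ.*-comm (γ (suc j)) (identity k j))) ⟩
    γ zero * - (T d * recip (b (suc k))) + ⟨ identity k , γ ∘ suc ⟩  ≡⟨ cong (γ zero * - (T d * recip (b (suc k))) +_) (⟨⟩-identityˡ k (γ ∘ suc)) ⟩
    G * recip (T d) * - (T d * recip (b (suc k))) + G * recip (b (suc k))  ≡⟨ factor G (recip (T d)) (T d) (recip (b (suc k))) ⟩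
    G * recip (b (suc k)) * (1ℚ - T d * recip (T d))  ≡⟨ cong (λ x → G * recip (b (suc k)) * (1ℚ - x)) (*-recip-pos (0<T d)) ⟩
    G * recip (b (suc k)) * (1ℚ - 1ℚ)  ≡⟨ ℚ.*-zeroʳ (G * recip (b (suc k))) ⟩
    0ℚ  ∎
    where
    open ≡-Reasoning
    factor : ∀ g h t r → g * h * - (t * r) + g * r ≡ g * r * (1ℚ - t * h)
    factor = solve-∀ ℚ-ring

independent-permute : ∀ {d n} (v : Vector (Point d) n) (π : Permutation n n) → AffinelyIndependent v →
                      AffinelyIndependent (λ i → v (π ⟨$⟩ʳ i))
independent-permute v π independent c ∑c≡0 relation i =
  trans (cong c (sym (Permutation.inverseˡ π))) (independent (λ j → c (π ⟨$⟩ˡ j))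
    (trans (sym (sum-permute c (Permutation.flip π))) ∑c≡0)
    (λ k → trans (sum-cong-≗ λ j → cong (λ w → c (π ⟨$⟩ˡ j) * v w k) (sym (Permutation.inverseʳ π)))
      (trans (sym (sum-permute (λ i → c i * v (π ⟨$⟩ʳ i) k) (Permutation.flip π))) (relation k)))
    (π ⟨$⟩ʳ i))

-- The bound and the case of equality

module Main {m} (v : Vector (Point (suc m)) (suc (suc m))) (independent : AffinelyIndependent v)
            (interior : (λ _ → 0ℚ) ∈ Interior (conv v))
            (g : ℕ) .{{_ : NonZero g}} (gorenstein : IsGorensteinIndex (conv v) g) where

  open Origin v independent interior
  open Simplices v independent β 0<β ∑β≡1 origin

  0<g : 0 ℕ.< g
  0<g = ℕ.>-nonZero⁻¹ g

  open Egyptian g 0<g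
  module E = ExtremalSimplex g dim 0<g

  private
    k = proj₁ gorenstein
    l = proj₁ (proj₂ gorenstein)
    kIndex = proj₁ (proj₂ (proj₂ gorenstein))
    lIndex = proj₁ (proj₂ (proj₂ (proj₂ gorenstein)))
    K = fromNat k
    L = fromNat l

    G≡K*L : G ≡ K * L
    G≡K*L = trans (cong fromNat (proj₂ (proj₂ (proj₂ (proj₂ gorenstein))))) (fromNat-homo-* k l)

    -- Adding `k l` removes the `−1` from `⟨uᵢ, vᵢ⟩ = 1/βᵢ − 1`, so that `g / βᵢ` is a pairing of
    -- two integral vectors plus an integer.
    scaled-pairing : ∀ i → ⟨ (λ c → L * dualVertex i c) , (λ c → K * v i c) ⟩ + L * K ≡ G * β⁻¹ i
    scaled-pairing i = begin
      ⟨ (λ c → L * u c) , (λ c → K * v i c) ⟩ + L * K  ≡⟨ cong (_+ L * K) (trans (⟨⟩-* L u (λ c → K * v i c)) (cong (L *_) (trans (⟨⟩-comm u (λ c → K * v i c)) (trans (⟨⟩-* K (v i) u) (cong (K *_) (⟨⟩-comm (v i) u)))))) ⟩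
      L * (K * ⟨ u , v i ⟩) + L * K  ≡⟨ cong (λ x → L * (K * x) + L * K) (trans (⟨dualVertex,vertex⟩ i i) (cong (λ e → e * β⁻¹ i - 1ℚ) (identity-refl i))) ⟩
      L * (K * (1ℚ * β⁻¹ i - 1ℚ)) + L * K  ≡⟨ collect L K (β⁻¹ i) ⟩
      K * L * β⁻¹ i  ≡⟨ cong (_* β⁻¹ i) G≡K*L ⟨
      G * β⁻¹ i  ∎
      where
      open ≡-Reasoning
      u = dualVertex i
      collect : ∀ l k h → l * (k * (1ℚ * h - 1ℚ)) + l * k ≡ k * l * h
      collect = solve-∀ ℚ-ring

    integral : ∀ i → Integer (G * β⁻¹ i)
    integral i = subst Integer (scaled-pairing i)
      (integer-+ (integer-⟨⟩ (proj₁ (proj₂ lIndex) _ (polar-isVertex i (proj₁ lIndex)))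
                             (proj₁ (proj₂ kIndex) _ (body-isVertex i (proj₁ kIndex))))
                 (integer-* (ℤ.+ l , refl) (ℤ.+ k , refl)))

    natural : ∀ i → ∃[ a ] 0 ℕ.< a × fromℤ (proj₁ (integral i)) ≡ fromNat a
    natural i = pos-fromℤ⇒fromNat (proj₁ (integral i))
      (subst (0ℚ <_) (proj₂ (integral i)) (*-pos 0<G (recip-pos (0<β i))))

    abstract
      a : Fin (suc dim) → ℕ
      a i = proj₁ (natural i)

      0<a : ∀ i → 0 ℕ.< a i
      0<a i = proj₁ (proj₂ (natural i))

      a≡ : ∀ i → fromNat (a i) ≡ G * β⁻¹ i
      a≡ i = sym (trans (proj₂ (integral i)) (proj₂ (proj₂ (natural i))))

    module W = Weights 0<G a β 0<β a≡

    unitFractions : ∏ a * G ≤ T dim * T dim ×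
      (∏ a * G ≡ T dim * T dim → Σ[ π ∈ Permutation (suc dim) (suc dim) ] ∀ i → a (π ⟨$⟩ʳ i) ≡ extremal dim i)
    unitFractions = unitFractions-bound-unsorted g 0<g dim a 0<a
      (trans W.∑recip≡ (trans (cong (_* recip G) ∑β≡1) (ℚ.*-identityˡ (recip G))))

    D = fromNat (g ℕ.^ (dim ℕ.+ 2))

    0<D : 0ℚ < D
    0<D = fromNat-pos (g ℕ.^ (dim ℕ.+ 2)) (ℕ.m^n>0 g (dim ℕ.+ 2))

    -- Each of the `dim + 1` factors `aᵢ = g / βᵢ` contains one `g`, and the estimate is for
    -- `g ∏ aᵢ`: hence the exponent `dim + 2`.
    D*product : D * product β⁻¹ ≡ ∏ a * G
    D*product = begin
      D * product β⁻¹  ≡⟨ cong (_* product β⁻¹) (denominator-≡ g dim) ⟩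
      G ^ suc dim * G * product β⁻¹  ≡⟨ rearrange (G ^ suc dim) G (product β⁻¹) ⟩
      product β⁻¹ * G ^ suc dim * G  ≡⟨ cong (_* G) W.∏≡ ⟨
      ∏ a * G  ∎
      where
      open ≡-Reasoning
      rearrange : ∀ x g p → x * g * p ≡ p * x * g
      rearrange = solve-∀ ℚ-ring

    D*volumeBound : D * volumeBound g dim ≡ T dim * T dim
    D*volumeBound = trans (ℚ.*-comm D (volumeBound g dim)) (volumeBound-* g dim)

  bound : product β⁻¹ ≤ volumeBound g dim
  bound = *-cancelˡ-≤ D 0<D (subst₂ _≤_ (sym D*product) (sym D*volumeBound) (proj₁ unitFractions))

  Extremal : Set
  Extremal = Σ[ H ∈ GLℚ dim ] conv v ≅ image (GLℚ.matrix H) (columnHull (extremalMatrix g dim))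

  module _ (equality : product β⁻¹ ≡ volumeBound g dim) where
    private
      sorted : Σ[ π ∈ Permutation (suc dim) (suc dim) ] ∀ i → a (π ⟨$⟩ʳ i) ≡ extremal dim i
      sorted = proj₂ unitFractions (trans (sym D*product) (trans (cong (D *_) equality) D*volumeBound))

      ρ : Permutation (suc dim) (suc dim)
      -- The reversal acts before the sorting permutation, so that vertex `ρ ⟨$⟩ʳ i` has the
      -- denominator `E.B i`.
      ρ = E.reversal Permutation.∘ₚ proj₁ sorted

      w : Vector (Point dim) (suc dim)
      w i = v (ρ ⟨$⟩ʳ i)

      β≡γ : ∀ i → β (ρ ⟨$⟩ʳ i) ≡ E.γ i
      β≡γ i = trans (W.β≡ (ρ ⟨$⟩ʳ i)) (cong (λ m → G * recip (fromNat m)) (proj₂ sorted (E.reversal ⟨$⟩ʳ i)))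

      origin-w : combination w E.γ ≗ λ _ → 0ℚ
      origin-w c = trans (sum-cong-≗ λ i → cong (_* w i c) (sym (β≡γ i)))
        (trans (sym (sum-permute (λ i → β i * v i c) ρ)) (origin c))

      module S = Simplices w (independent-permute v ρ independent) E.γ E.0<γ E.∑γ≡1 origin-w

      H : Matrix ℚ dim dim
      H = S.Coordinates

      H·vertices-suc : ∀ j → H · E.vertices (suc j) ≗ w (suc j)
      H·vertices-suc j c = trans (⟨⟩-cong {u = H c} (λ _ → refl) (E.vertices-suc j)) (⟨⟩-identityʳ (H c) j)

      -- On unit vectors this is the choice of `H`. The vertex 0 is determined on both sides by the
      -- others, since the origin has the same weights `E.γ` in both simplices.
      H·vertices : ∀ i → H · E.vertices i ≗ w i
      H·vertices (suc j) = H·vertices-suc j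
      H·vertices zero c  = *-cancelˡ-≡ (E.γ zero) (pos⇒≢0 (E.0<γ zero)) (begin
        E.γ zero * (H · E.vertices zero) c  ≡⟨ isolate (E.γ zero * (H · E.vertices zero) c) X ⟩
        E.γ zero * (H · E.vertices zero) c + X - X ≡⟨ cong (_- X) lhs ⟩
        0ℚ - X  ≡⟨ cong (_- X) (sym (origin-w c)) ⟩
        E.γ zero * w zero c + X - X  ≡⟨ isolate (E.γ zero * w zero c) X ⟨
        E.γ zero * w zero c  ∎)
        where
        open ≡-Reasoning
        X = sum (λ j → E.γ (suc j) * w (suc j) c)
        isolate : ∀ x y → x ≡ x + y - y
        isolate = solve-∀ ℚ-ring
        lhs : E.γ zero * (H · E.vertices zero) c + X ≡ 0ℚ
        lhs = trans (cong (E.γ zero * (H · E.vertices zero) c +_)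
                (sum-cong-≗ λ j → cong (E.γ (suc j) *_) (sym (H·vertices-suc j c))))
              (trans (sym (⟨combination⟩ E.vertices E.γ (H c)))
                (trans (⟨⟩-cong {u = H c} (λ _ → refl) E.origin) (⟨⟩-zeroʳ (H c))))

    equality⇒extremal : Extremal
    equality⇒extremal = proj₁ (Aut⇒GL H S.A S.fwd≗) ,
      -- The unimodular map can be the identity, because `H` already maps one hull exactly onto the
      -- other.
      ≐⇒≅ (λ x≗y (z , z∈ , x≗) → z , z∈ , λ i → trans (sym (x≗y i)) (x≗ i))
        ((λ {x} x∈ → image-mono H (λ {y} → proj₂ E.columnHull-≐ {y}) {x} (proj₂ (image-conv H E.vertices) {x}
            (conv-cong (λ i c → sym (H·vertices i c)) (proj₁ (conv-permute v ρ) {x} x∈)))) ,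
         (λ {x} x∈ → proj₂ (conv-permute v ρ) {x} (conv-cong H·vertices
            (proj₁ (image-conv H E.vertices) {x} (image-mono H (λ {y} → proj₁ E.columnHull-≐ {y}) {x} x∈)))))

  module _ (extremality : Extremal) where
    private
      H U : Matrix ℚ dim dim
      H = GLℚ.matrix (proj₁ extremality)
      U i j = fromℤ (GLℤ.matrix (proj₁ (proj₂ extremality)) i j)

      w : Vector (Point dim) (suc dim)
      w i = U · H · E.vertices i

      v⊆w : conv v ⊆ conv w
      v⊆w {x} x∈ = proj₁ (image-conv U (λ i → H · E.vertices i)) {x}
        (image-mono U (λ {y} → proj₁ (image-conv H E.vertices) {y}) {x}
          (image-mono U (λ {y} → image-mono H (λ {z} → proj₁ E.columnHull-≐ {z}) {y}) {x} (proj₁ (proj₂ (proj₂ extremality)) {x} x∈)))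

      w⊆v : conv w ⊆ conv v
      w⊆v {x} x∈ = proj₂ (proj₂ (proj₂ extremality)) {x}
        (image-mono U (λ {y} → image-mono H (λ {z} → proj₂ E.columnHull-≐ {z}) {y}) {x}
          (image-mono U (λ {y} → proj₂ (image-conv H E.vertices) {y}) {x} (proj₂ (image-conv U (λ i → H · E.vertices i)) {x} x∈)))

      balanced-· : ∀ (M : Matrix ℚ dim dim) (p : Vector (Point dim) (suc dim)) → combination p E.γ ≗ (λ _ → 0ℚ) →
                   combination (λ i → M · p i) E.γ ≗ λ _ → 0ℚ
      balanced-· M p p≗0 c = trans (sym (⟨combination⟩ p E.γ (M c)))
        (trans (⟨⟩-cong {u = M c} (λ _ → refl) p≗0) (⟨⟩-zeroʳ (M c)))

      origin-w : combination w E.γ ≗ λ _ → 0ℚ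
      origin-w = balanced-· U (λ i → H · E.vertices i) (balanced-· H E.vertices E.origin)

      agree : Σ[ π ∈ Permutation (suc dim) (suc dim) ] ∀ i → β i ≡ E.γ (π ⟨$⟩ʳ i)
      agree = SameHull.weights-agree v w independent (λ {x} → v⊆w {x}) (λ {x} → w⊆v {x}) β E.γ
        (trans ∑β≡1 (sym E.∑γ≡1)) λ c → trans (origin c) (sym (origin-w c))

    -- Linear maps fix the origin and preserve its weights, and the hull determines the weights up
    -- to order. Hence the `βᵢ` are the `E.γ` in some order, and the product of their reciprocals is
    -- the extremal one.
    extremal⇒equality : product β⁻¹ ≡ volumeBound g dim
    extremal⇒equality = *-cancelˡ-≡ D (pos⇒≢0 0<D) (begin
      D * product β⁻¹  ≡⟨ cong (D *_) (product-cong-≗ (λ i → cong recip (proj₂ agree i))) ⟩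
      D * product (λ i → recip (E.γ (proj₁ agree ⟨$⟩ʳ i)))  ≡⟨ cong (D *_) (product-permute (recip ∘ E.γ) (proj₁ agree)) ⟨
      D * product (recip ∘ E.γ)  ≡⟨ trans (ℚ.*-comm D (product (recip ∘ E.γ))) (cong (product (recip ∘ E.γ) *_) (denominator-≡ g dim)) ⟩
      product (recip ∘ E.γ) * (G ^ suc dim * G)  ≡⟨ E.product-recip-γ ⟩
      T dim * T dim  ≡⟨ D*volumeBound ⟨
      D * volumeBound g dim  ∎)
      where open ≡-Reasoning

  theorem : ∃[ a ] ∃[ b ] IsVol (conv v) a × IsVol (polar (conv v)) b ×
            a * b ≤ volumeBound g dim × (a * b ≡ volumeBound g dim ⇔ Extremal)
  theorem = recip (β zero) * Aut.det A , product (recip ∘ β′) * Aut.codet A , body-Vol , dual-Vol ,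
    subst (_≤ volumeBound g dim) (sym Vol-product) bound ,
    mk⇔ (λ eq → equality⇒extremal (trans (sym Vol-product) eq)) (λ e → trans Vol-product (extremal⇒equality e))

theorem1p3 : (d : ℕ) → 2 ℕ.≤ d → (Δ : IPSimplex d) →
    (g : ℕ) → .{{_ : NonZero g}} → IsGorensteinIndex (IPSimplex.body Δ) g →
    ∃[ a ] ∃[ b ] IsVol (IPSimplex.body Δ) a × IsVol (polar (IPSimplex.body Δ)) b ×
    a * b ≤ volumeBound g d ×
    (a * b ≡ volumeBound g d ⇔
    (Σ[ H ∈ GLℚ d ] IPSimplex.body Δ ≅ image (GLℚ.matrix H) (columnHull (extremalMatrix g d))))
theorem1p3 (suc d) _ Δ g gorenstein =
  Main.theorem (IPSimplex.vertex Δ) (IPSimplex.affineIndependent Δ) (IPSimplex.originInterior Δ) g gorenstein
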